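{- Let $\mathcal{C}$ be a $d$-dimensional shellable simplicial complex, and let $r>d$ be an integer. Then the $h$-polynomial $h(\mathcal{C}^{\langle r\rangle};x)$ of the $r$-th edgewise subdivision of $\mathcal{C}$ is real-rooted.
   Context: Edgewise subdivision: let $\Delta=\mathrm{conv}(e^{(1)},\ldots,e^{(n)})\subset\mathbb{R}^n$ be the $(n-1)$-dimensional standard simplex. For $x\in\mathbb{Z}^n$ let $\mathrm{supp}(x)=\{i:x_i\ne0\}$, and let $\iota(x)=(x_1,x_1+x_2,\ldots,x_1+\cdots+x_n)$. For $r\ge1$, the $r$-th edgewise subdivision $\Delta^{\langle r\rangle}$ is the simplicial complex with vertex set $r\Delta\cap\mathbb{Z}^n$ in which $F\subset r\Delta\cap\mathbb{Z}^n$ is a face if and only if $\bigcup_{x\in F}\mathrm{supp}(x)$ is a face of $\Delta$ and, for all $x,y\in F$, $\iota(x)-\iota(y)\in\{0,1\}^n$ or $\iota(y)-\iota(x)\in\{0,1\}^n$. For a simplicial complex $\mathcal{C}$, $\mathcal{C}^{\langle r\rangle}$ is obtained by gluing together the $r$-th edgewise subdivisions of its facets (the vertices of each facet being ordered according to a fixed total order on the vertices of $\mathcal{C}$, so that the subdivisions agree on common faces). A shelling of a pure $d$-dimensional complex is a linear ordering $(F_1,\ldots,F_s)$ of its facets such that either $d=0$, or (1) the boundary complex of $F_1$ has a shelling, and (2) for $2\le j\le s$, $F_j\cap\bigcup_{i<j}F_i$ is nonempty and equals $G_1\cup\cdots\cup G_m$ for some shelling $(G_1,\ldots,G_m,\ldots,G_t)$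 of the boundary complex of $F_j$ and some $m\in[t]$. A complex is shellable if it is pure and admits a shelling. For an $(m-1)$-dimensional complex $\mathcal{K}$, $f(\mathcal{K};x)=\sum_{k=-1}^{m-1}f_k(\mathcal{K})x^{k+1}$, where $f_k$ is the number of $k$-dimensional faces ($f_{ -1}=1$), and $h(\mathcal{K};x)=(1-x)^m f(\mathcal{K};\frac{x}{1-x})$. A real polynomial is real-rooted if it is identically zero or has only real zeros. -}

module Defs where

open import Level using (0ℓ)
open import Data.Empty using (⊥-elim)
open import Data.Fin using (Fin; zero; suc; toℕ)
open import Data.Fin.Properties using (all?)
open import Data.Fin.Subset using (Subset; inside; outside; ⊥; ∣_∣; Nonempty; _∈_; _⊆_; _⊂_)
open import Data.Fin.Subset.Properties using (_∈?_; _⊆?_; _⊂?_; ⊆-refl; ⊆-trans; ∉⊥; ∣p∣≤n; p⊂q⇒p⊆q; p⊂q⇒∣p∣<∣q∣; anySubset?)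
open import Data.Integer as ℤ using (ℤ; 0ℤ; 1ℤ; -1ℤ; _⊖_)
open import Data.List using (List; []; _∷_; _++_; [_]; map; filter; foldr; length; lookup; take; upTo)
open import Data.List.Membership.Propositional using () renaming (_∈_ to _∈ₗ_)
open import Data.List.Membership.Propositional.Properties using (∈-map⁺; ∈-map⁻; ∈-++⁺ˡ; ∈-++⁺ʳ; ∈-++⁻)
open import Data.List.Relation.Unary.All using (All; [])
open import Data.List.Relation.Unary.Any using (Any; here)
open import Data.List.Relation.Unary.AllPairs using ([]; _∷_)
open import Data.List.Relation.Unary.Unique.Propositional using (Unique)
import Data.List.Relation.Unary.Unique.Propositional.Properties as Uniqueₚ
open import Data.Nat as ℕ using (ℕ; zero; suc; _≤_; _∸_; _⊔_)
import Data.Nat.Properties as ℕₚ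
open import Data.Product using (∃-syntax; _×_; _,_)
open import Data.Rational as ℚ using (ℚ; 0ℚ; 1ℚ; ½)
import Data.Rational.Properties as ℚₚ
import Data.Rational.Solver as ℚSolver
open import Data.Sum using (_⊎_; inj₁; inj₂)
import Data.Vec as Vec
open import Data.Vec using (Vec; []; _∷_)
open import Function.Bundles using (_⇔_)
open import Relation.Binary.PropositionalEquality using (_≡_; refl; sym; trans; cong; cong₂; subst; subst₂)
open import Relation.Nullary using (¬_; Dec; yes; no; ¬?; does)
open import Relation.Nullary.Decidable using (_×-dec_; _⊎-dec_; _→-dec_)
open import Relation.Unary using (Pred; Decidable)

-- Finite simplicial complexes with vertices among Fin n.  An i for which ⁅ i ⁆
-- is not a face is not a vertex of the complex.

record SimplicialComplex (n : ℕ) : Set₁ where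
  field
    IsFace   : Pred (Subset n) 0ℓ
    isFace?  : Decidable IsFace
    ⊥-isFace : IsFace ⊥
    ⊆-closed : ∀ {S T} → S ⊆ T → IsFace T → IsFace S

open SimplicialComplex public

-- Facets, purity and shellings only refer to the set of faces; this makes them
-- applicable to boundary complexes without carrying the closure properties.

Facet : ∀ {n} → Pred (Subset n) 0ℓ → Pred (Subset n) 0ℓ
Facet 𝓕 F = 𝓕 F × ¬ (∃[ T ] (𝓕 T × F ⊂ T))

Pure : ∀ {n} → ℕ → Pred (Subset n) 0ℓ → Set
Pure d 𝓕 = ∀ F → Facet 𝓕 F → ∣ F ∣ ≡ suc d

∂ : ∀ {n} → Subset n → Pred (Subset n) 0ℓ
∂ F S = S ⊂ F

FacetOrdering : ∀ {n} → Pred (Subset n) 0ℓ → List (Subset n) → Set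
FacetOrdering 𝓕 Fs = Unique Fs × (∀ F → F ∈ₗ Fs ⇔ Facet 𝓕 F)

-- The complex spanned by a list of simplices.

Span : ∀ {n} → List (Subset n) → Pred (Subset n) 0ℓ
Span Gs S = Any (S ⊆_) Gs

-- F_j ∩ ⋃_{i<j} F_i as a set of faces, where F_j = lookup Fs j.

Attaching : ∀ {n} (Fs : List (Subset n)) → Fin (length Fs) → Pred (Subset n) 0ℓ
Attaching Fs j S = S ⊆ lookup Fs j × Span (take (toℕ j) Fs) S

-- Positions are numbered from 0, so that toℕ j ≡ 0 singles out F₁.  As a union
-- of geometric simplices, Attaching Fs j is nonempty when it contains a face
-- other than ∅.

IsShelling : ∀ {n} → ℕ → Pred (Subset n) 0ℓ → List (Subset n) → Set
IsShelling zero    𝓕 Fs = FacetOrdering 𝓕 Fs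
IsShelling (suc d) 𝓕 Fs =
    FacetOrdering 𝓕 Fs
  × (∀ j → toℕ j ≡ 0 → ∃[ Gs ] IsShelling d (∂ (lookup Fs j)) Gs)
  × (∀ j → 1 ≤ toℕ j →
       (∃[ S ] (Nonempty S × Attaching Fs j S))
     × (∃[ Gs ] (IsShelling d (∂ (lookup Fs j)) Gs
         × (∃[ m ] (1 ≤ m × m ≤ length Gs
             × (∀ S → Attaching Fs j S ⇔ Span (take m Gs) S))))))

Shellable : ∀ {n} → ℕ → SimplicialComplex n → Set
Shellable d K = Pure d (IsFace K) × (∃[ Fs ] IsShelling d (IsFace K) Fs)

facet? : ∀ {n} (K : SimplicialComplex n) → Decidable (Facet (IsFace K))
facet? K F = isFace? K F ×-dec ¬? (anySubset? (λ T → isFace? K T ×-dec (F ⊂? T)))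

face⊆facet : ∀ {n} (K : SimplicialComplex n) S → IsFace K S →
             ∃[ F ] (Facet (IsFace K) F × S ⊆ F)
face⊆facet {n} K S S∈K = go n S S∈K (ℕₚ.m≤m+n n ∣ S ∣)
  where
  go : ∀ fuel S → IsFace K S → n ≤ fuel ℕ.+ ∣ S ∣ → ∃[ F ] (Facet (IsFace K) F × S ⊆ F)
  go fuel S S∈K n≤ with anySubset? (λ T → isFace? K T ×-dec (S ⊂? T))
  go fuel S S∈K n≤ | no ¬T = S , (S∈K , ¬T) , ⊆-refl
  go zero S S∈K n≤ | yes (T , T∈K , S⊂T) =
    ⊥-elim (ℕₚ.<-irrefl refl (ℕₚ.<-≤-trans (p⊂q⇒∣p∣<∣q∣ S⊂T) (ℕₚ.≤-trans (∣p∣≤n T) n≤)))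
  go (suc fuel) S S∈K n≤ | yes (T , T∈K , S⊂T)
    with go fuel T T∈K
           (ℕₚ.≤-trans n≤ (ℕₚ.≤-trans (ℕₚ.≤-reflexive (sym (ℕₚ.+-suc fuel ∣ S ∣)))
                                      (ℕₚ.+-monoʳ-≤ fuel (p⊂q⇒∣p∣<∣q∣ S⊂T))))
  ... | F , F-facet , T⊆F = F , F-facet , ⊆-trans (p⊂q⇒p⊆q S⊂T) T⊆F

-- The points of rΔ ∩ ℤⁿ: vectors of naturals with coordinate sum r.

incHead : ∀ {n} → Vec ℕ (suc n) → Vec ℕ (suc n)
incHead (x ∷ xs) = suc x ∷ xs

latticePoints : ∀ n → ℕ → List (Vec ℕ n)
latticePoints zero    zero    = [ [] ]
latticePoints zero    (suc r) = []
latticePoints (suc n) zero    = map (0 ∷_) (latticePoints n 0)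
latticePoints (suc n) (suc r) =
  map (0 ∷_) (latticePoints n (suc r)) ++ map incHead (latticePoints (suc n) r)

latticePoints-sound : ∀ n r {x} → x ∈ₗ latticePoints n r → Vec.sum x ≡ r
latticePoints-sound zero zero (here refl) = refl
latticePoints-sound (suc n) zero x∈ with ∈-map⁻ (0 ∷_) x∈
... | y , y∈ , refl = latticePoints-sound n 0 y∈
latticePoints-sound (suc n) (suc r) x∈ with ∈-++⁻ (map (0 ∷_) (latticePoints n (suc r))) x∈
... | inj₁ x∈ˡ with ∈-map⁻ (0 ∷_) x∈ˡ
...   | y , y∈ , refl = latticePoints-sound n (suc r) y∈
latticePoints-sound (suc n) (suc r) x∈ | inj₂ x∈ʳ with ∈-map⁻ incHead x∈ʳ
...   | (y ∷ ys) , y∈ , refl = cong suc (latticePoints-sound (suc n) r y∈)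

latticePoints-complete : ∀ n r (x : Vec ℕ n) → Vec.sum x ≡ r → x ∈ₗ latticePoints n r
latticePoints-complete zero    _       []           refl = here refl
latticePoints-complete (suc n) zero    (zero  ∷ xs) eq = ∈-map⁺ (0 ∷_) (latticePoints-complete n 0 xs eq)
latticePoints-complete (suc n) (suc r) (zero  ∷ xs) eq =
  ∈-++⁺ˡ (∈-map⁺ (0 ∷_) (latticePoints-complete n (suc r) xs eq))
latticePoints-complete (suc n) (suc r) (suc x ∷ xs) eq =
  ∈-++⁺ʳ (map (0 ∷_) (latticePoints n (suc r)))
         (∈-map⁺ incHead (latticePoints-complete (suc n) r (x ∷ xs) (ℕₚ.suc-injective eq)))

latticePoints-unique : ∀ n r → Unique (latticePoints n r)
latticePoints-unique zero    zero    = [] ∷ []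
latticePoints-unique zero    (suc r) = []
latticePoints-unique (suc n) zero    = Uniqueₚ.map⁺ (λ { refl → refl }) (latticePoints-unique n 0)
latticePoints-unique (suc n) (suc r) =
  Uniqueₚ.++⁺ (Uniqueₚ.map⁺ (λ { refl → refl }) (latticePoints-unique n (suc r)))
              (Uniqueₚ.map⁺ (λ { {_ ∷ _} {_ ∷ _} refl → refl }) (latticePoints-unique (suc n) r))
              disjoint
  where
  disjoint : ∀ {v} → ¬ (v ∈ₗ map (0 ∷_) (latticePoints n (suc r))
                        × v ∈ₗ map incHead (latticePoints (suc n) r))
  disjoint (p , q) with ∈-map⁻ (0 ∷_) p | ∈-map⁻ incHead q
  ... | _ , _ , refl | (_ ∷ _) , _ , ()

-- The vertices of a subdivision are numbered through the list latticePoints n r.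

Index : ℕ → ℕ → ℕ
Index n r = length (latticePoints n r)

point : ∀ n r → Fin (Index n r) → Vec ℕ n
point n r = lookup (latticePoints n r)

supp : ∀ {n} → Vec ℕ n → Subset n
supp = Vec.map (λ k → does (¬? (k ℕ.≟ 0)))

ι : ∀ {n} → Vec ℕ n → Fin n → ℕ
ι (x ∷ xs) zero    = x
ι (x ∷ xs) (suc i) = x ℕ.+ ι xs i

-- ι(x) - ι(y) ∈ {0,1}^F.  For x supported in F, the numbers ι x i with i ∈ F are
-- the partial sums of the coordinates of x in ℝ^F, where F is ordered as a
-- subset of Fin n.

ι-Diff01 : ∀ {n} → Subset n → Vec ℕ n → Vec ℕ n → Set
ι-Diff01 F x y = ∀ i → i ∈ F → (ι x i ⊖ ι y i ≡ 0ℤ) ⊎ (ι x i ⊖ ι y i ≡ 1ℤ)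

ι-diff01? : ∀ {n} (F : Subset n) x y → Dec (ι-Diff01 F x y)
ι-diff01? F x y = all? λ i → (i ∈? F) →-dec ((_ ℤ.≟ 0ℤ) ⊎-dec (_ ℤ.≟ 1ℤ))

-- The r-th edgewise subdivision of the simplex Δ_F = conv(e⁽ⁱ⁾ : i ∈ F), placed in
-- ℝⁿ ⊇ ℝ^F.  The first condition of its IsFace says that the union of the
-- supports is a face of Δ_F.

simplexSubdivision : ∀ {n} → Subset n → (r : ℕ) → SimplicialComplex (Index n r)
simplexSubdivision {n} F r = record
  { IsFace   = λ S →
        (∀ i → i ∈ S → supp (pt i) ⊆ F)
      × (∀ i → i ∈ S → ∀ j → j ∈ S → ι-Diff01 F (pt i) (pt j) ⊎ ι-Diff01 F (pt j) (pt i))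
  ; isFace?  = λ S →
      all? (λ i → (i ∈? S) →-dec (supp (pt i) ⊆? F))
      ×-dec
      all? (λ i → (i ∈? S) →-dec all? (λ j → (j ∈? S) →-dec
        (ι-diff01? F (pt i) (pt j) ⊎-dec ι-diff01? F (pt j) (pt i))))
  ; ⊥-isFace = (λ i i∈⊥ → ⊥-elim (∉⊥ i∈⊥)) , (λ i i∈⊥ → ⊥-elim (∉⊥ i∈⊥))
  ; ⊆-closed = λ S⊆T (a , b) →
      (λ i i∈S → a i (S⊆T i∈S)) , (λ i i∈S j j∈S → b i (S⊆T i∈S) j (S⊆T j∈S))
  }
  where
  pt : Fin (Index n r) → Vec ℕ n
  pt = point n r

-- The fixed total order on the vertices is the order of Fin n.  The subdivided
-- facets all live in ℝⁿ, so gluing them is taking their union.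

_⟨_⟩ : ∀ {n} → SimplicialComplex n → (r : ℕ) → SimplicialComplex (Index n r)
K ⟨ r ⟩ = record
  { IsFace   = λ S → ∃[ F ] (Facet (IsFace K) F × IsFace (simplexSubdivision F r) S)
  ; isFace?  = λ S → anySubset? (λ F → facet? K F ×-dec isFace? (simplexSubdivision F r) S)
  ; ⊥-isFace = let F , F-facet , _ = face⊆facet K ⊥ (⊥-isFace K)
               in F , F-facet , ⊥-isFace (simplexSubdivision F r)
  ; ⊆-closed = λ S⊆T (F , F-facet , T∈) → F , F-facet , ⊆-closed (simplexSubdivision F r) S⊆T T∈
  }

allSubsets : ∀ n → List (Subset n)
allSubsets zero    = [ [] ]
allSubsets (suc n) = map (inside ∷_) (allSubsets n) ++ map (outside ∷_) (allSubsets n)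

faces : ∀ {n} → SimplicialComplex n → List (Subset n)
faces {n} K = filter (isFace? K) (allSubsets n)

-- faceCount K k is f_{k-1}, the number of faces with k elements.

faceCount : ∀ {n} → SimplicialComplex n → ℕ → ℕ
faceCount K k = length (filter (λ S → ∣ S ∣ ℕ.≟ k) (faces K))

-- dim K + 1, the largest number of elements of a face.

rank : ∀ {n} → SimplicialComplex n → ℕ
rank K = foldr _⊔_ 0 (map ∣_∣ (faces K))

-- Univariate polynomials as coefficient lists, constant term first; trailing
-- zeros are allowed.

Poly : Set → Set
Poly A = List A

infixl 6 _⊕_
infixl 7 _⊗_
infixr 8 _^^_

_⊕_ : Poly ℤ → Poly ℤ → Poly ℤ
[]      ⊕ q       = q
(a ∷ p) ⊕ []      = a ∷ p
(a ∷ p) ⊕ (b ∷ q) = (a ℤ.+ b) ∷ (p ⊕ q)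

_⊗_ : Poly ℤ → Poly ℤ → Poly ℤ
[]      ⊗ q = []
(a ∷ p) ⊗ q = map (a ℤ.*_) q ⊕ (0ℤ ∷ (p ⊗ q))

_^^_ : Poly ℤ → ℕ → Poly ℤ
p ^^ zero  = [ 1ℤ ]
p ^^ suc k = p ⊗ (p ^^ k)

X 1-X : Poly ℤ
X   = 0ℤ ∷ 1ℤ ∷ []
1-X = 1ℤ ∷ -1ℤ ∷ []

-- (1-x)^m f(x/(1-x)) with f(x) = Σ_{k=0}^m f_{k-1} x^k and denominators cleared:
-- Σ_{k=0}^m f_{k-1} x^k (1-x)^(m-k).

hPoly : ∀ {n} → SimplicialComplex n → Poly ℤ
hPoly K = foldr _⊕_ [] (map term (upTo (suc m)))
  where
  m : ℕ
  m = rank K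
  term : ℕ → Poly ℤ
  term k = [ ℤ.+ faceCount K k ] ⊗ X ^^ k ⊗ 1-X ^^ (m ∸ k)

-- Real numbers as Cauchy sequences of rationals, with the equality _≃_ of
-- sequences whose difference tends to 0.

Cauchy : (ℕ → ℚ) → Set
Cauchy s = ∀ ε → 0ℚ ℚ.< ε → ∃[ N ] (∀ m n → N ≤ m → N ≤ n → ℚ.∣ s m ℚ.- s n ∣ ℚ.< ε)

record ℝ : Set where
  constructor mkℝ
  field
    seq    : ℕ → ℚ
    cauchy : Cauchy seq

open ℝ public

infix 4 _≃_

_≃_ : ℝ → ℝ → Set
x ≃ y = ∀ ε → 0ℚ ℚ.< ε → ∃[ N ] (∀ n → N ≤ n → ℚ.∣ seq x n ℚ.- seq y n ∣ ℚ.< ε)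

module _ where
  open ℚSolver.+-*-Solver

  private
    +-rearrange : ∀ a b c d → (a ℚ.+ b) ℚ.- (c ℚ.+ d) ≡ (a ℚ.- c) ℚ.+ (b ℚ.- d)
    +-rearrange = solve 4 (λ a b c d → ((a :+ b) :- (c :+ d)) := ((a :- c) :+ (b :- d))) refl

    *-rearrange : ∀ a b c d → a ℚ.* b ℚ.- c ℚ.* d ≡ a ℚ.* (b ℚ.- d) ℚ.+ d ℚ.* (a ℚ.- c)
    *-rearrange = solve 4 (λ a b c d → ((a :* b) :- (c :* d)) := ((a :* (b :- d)) :+ (d :* (a :- c)))) refl

    neg-rearrange : ∀ a b → (ℚ.- a) ℚ.- (ℚ.- b) ≡ ℚ.- (a ℚ.- b)
    neg-rearrange = solve 2 (λ a b → ((:- a) :- (:- b)) := (:- (a :- b))) refl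

    split : ∀ a b → a ≡ (a ℚ.- b) ℚ.+ b
    split = solve 2 (λ a b → a := ((a :- b) :+ b)) refl

    halves : ∀ ε → ½ ℚ.* ε ℚ.+ ½ ℚ.* ε ≡ ε
    halves ε = trans (sym (ℚₚ.*-distribʳ-+ ε ½ ½)) (ℚₚ.*-identityˡ ε)

    half-pos : ∀ {ε} → 0ℚ ℚ.< ε → 0ℚ ℚ.< ½ ℚ.* ε
    half-pos {ε} ε>0 = ℚₚ.positive⁻¹ (½ ℚ.* ε) {{ℚₚ.pos*pos⇒pos ½ ε {{ℚ.positive ε>0}}}}

  +-cauchy : ∀ s t → Cauchy s → Cauchy t → Cauchy (λ n → s n ℚ.+ t n)
  +-cauchy s t cs ct ε ε>0 with cs (½ ℚ.* ε) (half-pos ε>0) | ct (½ ℚ.* ε) (half-pos ε>0)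
  ... | M , p | N , q = M ⊔ N , λ m n m≥ n≥ →
    ℚₚ.≤-<-trans
      (subst (ℚ._≤ ℚ.∣ s m ℚ.- s n ∣ ℚ.+ ℚ.∣ t m ℚ.- t n ∣)
             (cong ℚ.∣_∣ (sym (+-rearrange (s m) (t m) (s n) (t n))))
             (ℚₚ.∣p+q∣≤∣p∣+∣q∣ (s m ℚ.- s n) (t m ℚ.- t n)))
      (subst (ℚ.∣ s m ℚ.- s n ∣ ℚ.+ ℚ.∣ t m ℚ.- t n ∣ ℚ.<_) (halves ε)
        (ℚₚ.+-mono-< (p m n (ℕₚ.≤-trans (ℕₚ.m≤m⊔n M N) m≥) (ℕₚ.≤-trans (ℕₚ.m≤m⊔n M N) n≥))
                     (q m n (ℕₚ.≤-trans (ℕₚ.m≤n⊔m M N) m≥) (ℕₚ.≤-trans (ℕₚ.m≤n⊔m M N) n≥))))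

  neg-cauchy : ∀ s → Cauchy s → Cauchy (λ n → ℚ.- s n)
  neg-cauchy s cs ε ε>0 with cs ε ε>0
  ... | N , p = N , λ m n m≥ n≥ →
    subst (ℚ._< ε)
      (sym (trans (cong ℚ.∣_∣ (neg-rearrange (s m) (s n))) (ℚₚ.∣-p∣≡∣p∣ (s m ℚ.- s n))))
      (p m n m≥ n≥)

  cauchy-bounded : ∀ s → Cauchy s → ∃[ B ] (0ℚ ℚ.< B × ∃[ N ] (∀ n → N ≤ n → ℚ.∣ s n ∣ ℚ.≤ B))
  cauchy-bounded s cs with cs 1ℚ (ℚₚ.positive⁻¹ 1ℚ)
  ... | N , p = 1ℚ ℚ.+ ℚ.∣ s N ∣
              , ℚₚ.+-mono-<-≤ (ℚₚ.positive⁻¹ 1ℚ) (ℚₚ.0≤∣p∣ (s N))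
              , N , λ n n≥ →
    ℚₚ.≤-trans
      (subst (ℚ._≤ ℚ.∣ s n ℚ.- s N ∣ ℚ.+ ℚ.∣ s N ∣) (cong ℚ.∣_∣ (sym (split (s n) (s N))))
             (ℚₚ.∣p+q∣≤∣p∣+∣q∣ (s n ℚ.- s N) (s N)))
      (ℚₚ.+-monoˡ-≤ ℚ.∣ s N ∣ (ℚₚ.<⇒≤ (p n N n≥ ℕₚ.≤-refl)))

  private
    scale : ∀ B ε → 0ℚ ℚ.< B → 0ℚ ℚ.< ε → ∃[ δ ] (0ℚ ℚ.< δ × B ℚ.* δ ≡ ½ ℚ.* ε)
    scale B ε B>0 ε>0 = δ , δ>0 , eq
      where
      instance
        B-pos : ℚ.Positive B
        B-pos = ℚ.positive B>0
        B-nz : ℚ.NonZero B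
        B-nz = ℚₚ.pos⇒nonZero B
        ½ε-pos : ℚ.Positive (½ ℚ.* ε)
        ½ε-pos = ℚ.positive (half-pos ε>0)
        1/B-pos : ℚ.Positive (ℚ.1/ B)
        1/B-pos = ℚₚ.1/pos⇒pos B
      δ : ℚ
      δ = (ℚ.1/ B) ℚ.* (½ ℚ.* ε)
      δ>0 : 0ℚ ℚ.< δ
      δ>0 = ℚₚ.positive⁻¹ δ {{ℚₚ.pos*pos⇒pos (ℚ.1/ B) (½ ℚ.* ε)}}
      eq : B ℚ.* δ ≡ ½ ℚ.* ε
      eq = trans (sym (ℚₚ.*-assoc B (ℚ.1/ B) (½ ℚ.* ε)))
             (trans (cong (ℚ._* (½ ℚ.* ε)) (ℚₚ.*-inverseʳ B)) (ℚₚ.*-identityˡ (½ ℚ.* ε)))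

    *-bound : ∀ {a b B δ} → 0ℚ ℚ.< B → ℚ.∣ a ∣ ℚ.≤ B → ℚ.∣ b ∣ ℚ.< δ → ℚ.∣ a ℚ.* b ∣ ℚ.< B ℚ.* δ
    *-bound {a} {b} {B} {δ} B>0 a≤ b< =
      subst (ℚ._< B ℚ.* δ) (sym (ℚₚ.∣p*q∣≡∣p∣*∣q∣ a b))
        (ℚₚ.≤-<-trans (ℚₚ.*-monoʳ-≤-nonNeg ℚ.∣ b ∣ {{ℚₚ.∣-∣-nonNeg b}} a≤)
                      (ℚₚ.*-monoʳ-<-pos B {{ℚ.positive B>0}} b<))

    *-estimate : ∀ a b c d {A B δ η ε} → 0ℚ ℚ.< A → 0ℚ ℚ.< B →
                 A ℚ.* δ ≡ ½ ℚ.* ε → B ℚ.* η ≡ ½ ℚ.* ε →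
                 ℚ.∣ a ∣ ℚ.≤ A → ℚ.∣ d ∣ ℚ.≤ B →
                 ℚ.∣ b ℚ.- d ∣ ℚ.< δ → ℚ.∣ a ℚ.- c ∣ ℚ.< η →
                 ℚ.∣ a ℚ.* b ℚ.- c ℚ.* d ∣ ℚ.< ε
    *-estimate a b c d {A} {B} {δ} {η} {ε} A>0 B>0 Aδ Bη a≤ d≤ bd ac =
      subst₂ ℚ._<_ (cong ℚ.∣_∣ (sym (*-rearrange a b c d))) (trans (cong₂ ℚ._+_ Aδ Bη) (halves ε))
        (ℚₚ.≤-<-trans (ℚₚ.∣p+q∣≤∣p∣+∣q∣ (a ℚ.* (b ℚ.- d)) (d ℚ.* (a ℚ.- c)))
          (ℚₚ.+-mono-< (*-bound {a} {b ℚ.- d} A>0 a≤ bd) (*-bound {d} {a ℚ.- c} B>0 d≤ ac)))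

  *-cauchy : ∀ s t → Cauchy s → Cauchy t → Cauchy (λ n → s n ℚ.* t n)
  *-cauchy s t cs ct ε ε>0 =
    let A , A>0 , K , s≤ = cauchy-bounded s cs
        B , B>0 , L , t≤ = cauchy-bounded t ct
        δ , δ>0 , Aδ     = scale A ε A>0 ε>0
        η , η>0 , Bη     = scale B ε B>0 ε>0
        M , p            = ct δ δ>0
        N , q            = cs η η>0
        K⊔L≤ : ∀ {i} → (K ⊔ L) ⊔ (M ⊔ N) ≤ i → K ⊔ L ≤ i
        K⊔L≤ = ℕₚ.m⊔n≤o⇒m≤o (K ⊔ L) (M ⊔ N)
        M⊔N≤ : ∀ {i} → (K ⊔ L) ⊔ (M ⊔ N) ≤ i → M ⊔ N ≤ i
        M⊔N≤ = ℕₚ.m⊔n≤o⇒n≤o (K ⊔ L) (M ⊔ N)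
    in (K ⊔ L) ⊔ (M ⊔ N) , λ m n m≥ n≥ →
      *-estimate (s m) (t m) (s n) (t n) A>0 B>0 Aδ Bη
        (s≤ m (ℕₚ.m⊔n≤o⇒m≤o K L (K⊔L≤ m≥)))
        (t≤ n (ℕₚ.m⊔n≤o⇒n≤o K L (K⊔L≤ n≥)))
        (p m n (ℕₚ.m⊔n≤o⇒m≤o M N (M⊔N≤ m≥)) (ℕₚ.m⊔n≤o⇒m≤o M N (M⊔N≤ n≥)))
        (q m n (ℕₚ.m⊔n≤o⇒n≤o M N (M⊔N≤ m≥)) (ℕₚ.m⊔n≤o⇒n≤o M N (M⊔N≤ n≥)))

  const-cauchy : ∀ q → Cauchy (λ _ → q)
  const-cauchy q ε ε>0 = 0 , λ _ _ _ _ →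
    subst (ℚ._< ε) (cong ℚ.∣_∣ (sym (ℚₚ.+-inverseʳ q))) ε>0

fromℚ : ℚ → ℝ
fromℚ q = mkℝ (λ _ → q) (const-cauchy q)

fromℤ : ℤ → ℝ
fromℤ z = fromℚ (z ℚ./ 1)

0ℝ : ℝ
0ℝ = fromℤ 0ℤ

infixl 6 _+ℝ_ _-ℝ_
infixl 7 _*ℝ_

_+ℝ_ _-ℝ_ _*ℝ_ : ℝ → ℝ → ℝ
x +ℝ y = mkℝ (λ n → seq x n ℚ.+ seq y n) (+-cauchy (seq x) (seq y) (cauchy x) (cauchy y))
x -ℝ y = mkℝ (λ n → seq x n ℚ.- seq y n)
             (+-cauchy (seq x) (λ n → ℚ.- seq y n) (cauchy x) (neg-cauchy (seq y) (cauchy y)))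
x *ℝ y = mkℝ (λ n → seq x n ℚ.* seq y n) (*-cauchy (seq x) (seq y) (cauchy x) (cauchy y))

infix 6 _+i_

record ℂ : Set where
  constructor _+i_
  field
    re im : ℝ

open ℂ public

infixl 6 _+ℂ_
infixl 7 _*ℂ_

_+ℂ_ _*ℂ_ : ℂ → ℂ → ℂ
z +ℂ w = (re z +ℝ re w) +i (im z +ℝ im w)
z *ℂ w = (re z *ℝ re w -ℝ im z *ℝ im w) +i (re z *ℝ im w +ℝ im z *ℝ re w)

eval : Poly ℝ → ℂ → ℂ
eval []      z = 0ℝ +i 0ℝ
eval (a ∷ p) z = (a +i 0ℝ) +ℂ z *ℂ eval p z

IsZero : Poly ℝ → ℂ → Set
IsZero p z = re (eval p z) ≃ 0ℝ × im (eval p z) ≃ 0ℝ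

IsReal : ℂ → Set
IsReal z = im z ≃ 0ℝ

RealRooted : Poly ℝ → Set
RealRooted p = All (_≃ 0ℝ) p ⊎ (∀ z → IsZero p z → IsReal z)

{-# OPTIONS --safe #-}
-- Let u^D_i be the polynomial with coefficients the number of ways to write r N - i
-- as an ordered sum of D numbers below r.  Its values at z satisfy u_{i+r} = z u_i, and
-- u^{D+1}_i is the sum of the window u^D_i, …, u^D_{i+r-1}.  If Im z > 0, then
-- Im (conj u_i · u_j) ≥ 0 whenever i ≤ j ≤ i + r: two windows overlap in a common block,
-- and what remains differs by the factor z.  Inductively, a sum of such u_i with i ≤ r
-- that contains u_0 does not vanish at z, with an explicit lower bound.
--
-- A shelling partitions the faces of C into intervals [R_j, F_j] with |F_j| = d + 1 and
-- R_1 = ∅.  Sorting writes each lattice point of degree r N supported in C uniquely as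
-- the sum of a multichain of N vertices of C⟨r⟩ contained in a face; hence
-- h(C⟨r⟩) = Σ_j u^{d+1}_{|R_j|}, up to powers of 1 - x, where |R_j| ≤ d + 1 ≤ r.
module Submission where

open import Defs
open import Data.Nat using (ℕ; _<_)
open import Data.List using (map)

-- A real number here is a Cauchy sequence of rationals, for which neither the sign nor equality
-- with 0 is decidable. For this reason the analysis is done in exact arithmetic on the terms of the
-- sequences, which are Gaussian rationals, and absolute values occur only squared, since square
-- roots leave ℚ. The polynomials u^D_i arise as follows: sampling the power series x^i / (1 - x)^D
-- at the multiples of r and multiplying the result by (1 - x)^D gives u^D_i. These samples count
-- lattice points whose support lies between two given faces, so both complexes are compared through
-- lattice points, never face by face. The powers of 1 - x remain because the dimension of C⟨r⟩ is
-- not computed: the two sides are compared after multiplication by (1 - x)^(d+1) and by (1 - x) to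
-- the rank of C⟨r⟩. The factors can be handled because |1 - z| ≥ |Im z|.

-- Gaussian rationals and evaluation of integer polynomials at them.

module GaussianRationals where

  open import Data.List using (map; []; _∷_; [_])
  open import Algebra using (CommutativeRing; IsCommutativeRing)
  import Algebra.Solver.Ring.AlmostCommutativeRing as ACR
  import Algebra.Solver.Ring.Simple as RingSolver
  open import Data.Integer as ℤ using (ℤ; 0ℤ)
  import Data.Integer.Properties as ℤₚ
  open import Data.Product using (_×_; _,_)
  open import Data.Product.Properties using (≡-dec)
  open import Data.Rational as ℚ using (ℚ; 0ℚ; 1ℚ)
  import Data.Rational.Properties as ℚₚ
  import Data.Rational.Solver as ℚSolver
  open import Data.Rational.Unnormalised as ℚᵘ using (mkℚᵘ; *≡*)
  import Data.Rational.Unnormalised.Properties as ℚᵘₚ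
  open import Level using (0ℓ)
  open import Relation.Binary.PropositionalEquality hiding ([_])
  open import Relation.Binary.PropositionalEquality.Properties using (isEquivalence)

  𝔾 : Set
  𝔾 = ℚ × ℚ

  infixl 6 _⊞_
  infixl 7 _⊠_

  _⊞_ _⊠_ : 𝔾 → 𝔾 → 𝔾
  (a , b) ⊞ (c , d) = (a ℚ.+ c) , (b ℚ.+ d)
  (a , b) ⊠ (c , d) = (a ℚ.* c ℚ.- b ℚ.* d) , (a ℚ.* d ℚ.+ b ℚ.* c)

  ⊟_ : 𝔾 → 𝔾
  ⊟ (a , b) = (ℚ.- a) , (ℚ.- b)

  0𝔾 1𝔾 : 𝔾
  0𝔾 = 0ℚ , 0ℚ
  1𝔾 = 1ℚ , 0ℚ

  module _ where
    open ℚSolver.+-*-Solver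

    𝔾-isCommutativeRing : IsCommutativeRing _≡_ _⊞_ _⊠_ ⊟_ 0𝔾 1𝔾
    𝔾-isCommutativeRing = record
      { isRing = record
        { +-isAbelianGroup = record
          { isGroup = record
            { isMonoid = record
              { isSemigroup = record
                { isMagma = record { isEquivalence = isEquivalence ; ∙-cong = cong₂ _⊞_ }
                ; assoc = λ (a , b) (c , d) (e , f) → cong₂ _,_ (ℚₚ.+-assoc a c e) (ℚₚ.+-assoc b d f)
                }
              ; identity = (λ (a , b) → cong₂ _,_ (ℚₚ.+-identityˡ a) (ℚₚ.+-identityˡ b))
                         , (λ (a , b) → cong₂ _,_ (ℚₚ.+-identityʳ a) (ℚₚ.+-identityʳ b))
              }
            ; inverse = (λ (a , b) → cong₂ _,_ (ℚₚ.+-inverseˡ a) (ℚₚ.+-inverseˡ b))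
                      , (λ (a , b) → cong₂ _,_ (ℚₚ.+-inverseʳ a) (ℚₚ.+-inverseʳ b))
            ; ⁻¹-cong = cong ⊟_
            }
          ; comm = λ (a , b) (c , d) → cong₂ _,_ (ℚₚ.+-comm a c) (ℚₚ.+-comm b d)
          }
        ; *-cong = cong₂ _⊠_
        ; *-assoc = λ (a , b) (c , d) (e , f) → cong₂ _,_
            (solve 6 (λ a b c d e f → (a :* c :- b :* d) :* e :- (a :* d :+ b :* c) :* f
                                   := a :* (c :* e :- d :* f) :- b :* (c :* f :+ d :* e)) refl a b c d e f)
            (solve 6 (λ a b c d e f → (a :* c :- b :* d) :* f :+ (a :* d :+ b :* c) :* e
                                   := a :* (c :* f :+ d :* e) :+ b :* (c :* e :- d :* f)) refl a b c d e f)
        ; *-identity = (λ (a , b) → cong₂ _,_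
            (solve 2 (λ a b → con 1ℚ :* a :- con 0ℚ :* b := a) refl a b)
            (solve 2 (λ a b → con 1ℚ :* b :+ con 0ℚ :* a := b) refl a b))
                     , (λ (a , b) → cong₂ _,_
            (solve 2 (λ a b → a :* con 1ℚ :- b :* con 0ℚ := a) refl a b)
            (solve 2 (λ a b → a :* con 0ℚ :+ b :* con 1ℚ := b) refl a b))
        ; distrib = (λ (a , b) (c , d) (e , f) → cong₂ _,_
            (solve 6 (λ a b c d e f → a :* (c :+ e) :- b :* (d :+ f)
                                   := (a :* c :- b :* d) :+ (a :* e :- b :* f)) refl a b c d e f)
            (solve 6 (λ a b c d e f → a :* (d :+ f) :+ b :* (c :+ e)
                                   := (a :* d :+ b :* c) :+ (a :* f :+ b :* e)) refl a b c d e f))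
                  , (λ (a , b) (c , d) (e , f) → cong₂ _,_
            (solve 6 (λ a b c d e f → (c :+ e) :* a :- (d :+ f) :* b
                                   := (c :* a :- d :* b) :+ (e :* a :- f :* b)) refl a b c d e f)
            (solve 6 (λ a b c d e f → (c :+ e) :* b :+ (d :+ f) :* a
                                   := (c :* b :+ d :* a) :+ (e :* b :+ f :* a)) refl a b c d e f))
        }
      ; *-comm = λ (a , b) (c , d) → cong₂ _,_
          (solve 4 (λ a b c d → a :* c :- b :* d := c :* a :- d :* b) refl a b c d)
          (solve 4 (λ a b c d → a :* d :+ b :* c := c :* b :+ d :* a) refl a b c d)
      }

  𝔾-commutativeRing : CommutativeRing 0ℓ 0ℓ
  𝔾-commutativeRing = record { isCommutativeRing = 𝔾-isCommutativeRing }

  module 𝔾 = CommutativeRing 𝔾-commutativeRing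
  module 𝔾Solver = RingSolver (ACR.fromCommutativeRing 𝔾-commutativeRing) (≡-dec ℚₚ._≟_ ℚₚ._≟_)

  /1-+ : ∀ a b → (a ℤ.+ b) ℚ./ 1 ≡ a ℚ./ 1 ℚ.+ b ℚ./ 1
  /1-+ a b = ℚₚ.toℚᵘ-injective (begin
    ℚ.toℚᵘ ((a ℤ.+ b) ℚ./ 1)                   ≈⟨ ℚₚ.toℚᵘ-fromℚᵘ (mkℚᵘ (a ℤ.+ b) 0) ⟩
    mkℚᵘ (a ℤ.+ b) 0                           ≈⟨ *≡* (cong₂ ℤ._*_ (sym (cong₂ ℤ._+_ (ℤₚ.*-identityʳ a) (ℤₚ.*-identityʳ b))) refl) ⟩
    mkℚᵘ a 0 ℚᵘ.+ mkℚᵘ b 0                     ≈⟨ ℚᵘₚ.+-cong (ℚₚ.toℚᵘ-fromℚᵘ (mkℚᵘ a 0)) (ℚₚ.toℚᵘ-fromℚᵘ (mkℚᵘ b 0)) ⟨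
    ℚ.toℚᵘ (a ℚ./ 1) ℚᵘ.+ ℚ.toℚᵘ (b ℚ./ 1)     ≈⟨ ℚₚ.toℚᵘ-homo-+ (a ℚ./ 1) (b ℚ./ 1) ⟨
    ℚ.toℚᵘ (a ℚ./ 1 ℚ.+ b ℚ./ 1)               ∎)
    where open ℚᵘₚ.≃-Reasoning

  /1-* : ∀ a b → (a ℤ.* b) ℚ./ 1 ≡ a ℚ./ 1 ℚ.* (b ℚ./ 1)
  /1-* a b = ℚₚ.toℚᵘ-injective (begin
    ℚ.toℚᵘ ((a ℤ.* b) ℚ./ 1)                   ≈⟨ ℚₚ.toℚᵘ-fromℚᵘ (mkℚᵘ (a ℤ.* b) 0) ⟩
    mkℚᵘ a 0 ℚᵘ.* mkℚᵘ b 0                     ≈⟨ ℚᵘₚ.*-cong (ℚₚ.toℚᵘ-fromℚᵘ (mkℚᵘ a 0)) (ℚₚ.toℚᵘ-fromℚᵘ (mkℚᵘ b 0)) ⟨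
    ℚ.toℚᵘ (a ℚ./ 1) ℚᵘ.* ℚ.toℚᵘ (b ℚ./ 1)     ≈⟨ ℚₚ.toℚᵘ-homo-* (a ℚ./ 1) (b ℚ./ 1) ⟨
    ℚ.toℚᵘ (a ℚ./ 1 ℚ.* (b ℚ./ 1))             ∎)
    where open ℚᵘₚ.≃-Reasoning

  fromℤ𝔾 : ℤ → 𝔾
  fromℤ𝔾 a = a ℚ./ 1 , 0ℚ

  fromℤ𝔾-+ : ∀ a b → fromℤ𝔾 (a ℤ.+ b) ≡ fromℤ𝔾 a ⊞ fromℤ𝔾 b
  fromℤ𝔾-+ a b = cong₂ _,_ (/1-+ a b) refl

  fromℤ𝔾-* : ∀ a b → fromℤ𝔾 (a ℤ.* b) ≡ fromℤ𝔾 a ⊠ fromℤ𝔾 b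
  fromℤ𝔾-* a b = cong₂ _,_
    (trans (/1-* a b) (solve 2 (λ x y → x :* y := x :* y :- con 0ℚ :* con 0ℚ) refl (a ℚ./ 1) (b ℚ./ 1)))
    (solve 2 (λ x y → con 0ℚ := x :* con 0ℚ :+ con 0ℚ :* y) refl (a ℚ./ 1) (b ℚ./ 1))
    where open ℚSolver.+-*-Solver

  eval𝔾 : Poly ℤ → 𝔾 → 𝔾
  eval𝔾 []      z = 0𝔾
  eval𝔾 (a ∷ p) z = fromℤ𝔾 a ⊞ z ⊠ eval𝔾 p z

  -- The operations on `ℝ` act termwise, so evaluation commutes with taking the n-th term. This
  -- moves every estimate into the commutative ring `𝔾`, where a ring solver applies.
  eval-seq : ∀ p z n →
    (seq (re (eval (map fromℤ p) z)) n , seq (im (eval (map fromℤ p) z)) n)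
    ≡ eval𝔾 p (seq (re z) n , seq (im z) n)
  eval-seq []      z n = refl
  eval-seq (a ∷ p) z n = cong (λ w → fromℤ𝔾 a ⊞ (seq (re z) n , seq (im z) n) ⊠ w) (eval-seq p z n)

  module _ (z : 𝔾) where
    open 𝔾Solver

    eval𝔾-⊕ : ∀ p q → eval𝔾 (p ⊕ q) z ≡ eval𝔾 p z ⊞ eval𝔾 q z
    eval𝔾-⊕ []      q       = sym (𝔾.+-identityˡ _)
    eval𝔾-⊕ (a ∷ p) []      = sym (𝔾.+-identityʳ _)
    eval𝔾-⊕ (a ∷ p) (b ∷ q) =
      trans (cong₂ (λ c w → c ⊞ z ⊠ w) (fromℤ𝔾-+ a b) (eval𝔾-⊕ p q))
        (solve 5 (λ a b z p q → (a :+ b) :+ z :* (p :+ q) := (a :+ z :* p) :+ (b :+ z :* q)) refl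
          (fromℤ𝔾 a) (fromℤ𝔾 b) z (eval𝔾 p z) (eval𝔾 q z))

    eval𝔾-map-* : ∀ a p → eval𝔾 (map (a ℤ.*_) p) z ≡ fromℤ𝔾 a ⊠ eval𝔾 p z
    eval𝔾-map-* a []      = sym (𝔾.zeroʳ (fromℤ𝔾 a))
    eval𝔾-map-* a (b ∷ p) =
      trans (cong₂ (λ c w → c ⊞ z ⊠ w) (fromℤ𝔾-* a b) (eval𝔾-map-* a p))
        (solve 4 (λ a b z p → a :* b :+ z :* (a :* p) := a :* (b :+ z :* p)) refl
          (fromℤ𝔾 a) (fromℤ𝔾 b) z (eval𝔾 p z))

    eval𝔾-⊗ : ∀ p q → eval𝔾 (p ⊗ q) z ≡ eval𝔾 p z ⊠ eval𝔾 q z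
    eval𝔾-⊗ []      q = sym (𝔾.zeroˡ (eval𝔾 q z))
    eval𝔾-⊗ (a ∷ p) q =
      trans (eval𝔾-⊕ (map (a ℤ.*_) q) (0ℤ ∷ (p ⊗ q)))
        (trans (cong₂ (λ v w → v ⊞ (0𝔾 ⊞ z ⊠ w)) (eval𝔾-map-* a q) (eval𝔾-⊗ p q))
          (solve 4 (λ a z p q → a :* q :+ (con 0𝔾 :+ z :* (p :* q)) := (a :+ z :* p) :* q) refl
            (fromℤ𝔾 a) z (eval𝔾 p z) (eval𝔾 q z)))

    eval𝔾-const : ∀ a → eval𝔾 [ a ] z ≡ fromℤ𝔾 a
    eval𝔾-const a = solve 2 (λ a z → a :+ z :* con 0𝔾 := a) refl (fromℤ𝔾 a) z

    eval𝔾-X : eval𝔾 X z ≡ z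
    eval𝔾-X = solve 1 (λ z → con 0𝔾 :+ z :* (con 1𝔾 :+ z :* con 0𝔾) := z) refl z

    eval𝔾-1-X : eval𝔾 1-X z ≡ 1𝔾 ⊞ ⊟ z
    eval𝔾-1-X = solve 1 (λ z → con 1𝔾 :+ z :* (con (⊟ 1𝔾) :+ z :* con 0𝔾) := con 1𝔾 :+ :- z) refl z

-- Uniform upper and lower bounds along sequences of Gaussian rationals.

module Estimates where

  open GaussianRationals
  open import Data.Nat using (ℕ)
  open import Data.List using ([]; _∷_)
  open import Data.List.Relation.Unary.All using ([]; _∷_)
  open import Data.Product using (_,_; proj₂)
  open import Data.Sum using (inj₁; inj₂)
  open import Data.Rational as ℚ using (ℚ; 0ℚ; 1ℚ)
  import Data.Rational.Properties as ℚₚ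
  import Data.Rational.Solver as ℚSolver
  open import Relation.Binary.PropositionalEquality hiding ([_])

  0≤p² : ∀ p → 0ℚ ℚ.≤ p ℚ.* p
  0≤p² p with ℚₚ.≤-total 0ℚ p
  ... | inj₁ 0≤p = ℚₚ.nonNegative⁻¹ _ {{ℚₚ.nonNeg*nonNeg⇒nonNeg p {{ℚ.nonNegative 0≤p}} p {{ℚ.nonNegative 0≤p}}}}
  ... | inj₂ p≤0 = ℚₚ.nonNegative⁻¹ _ {{ℚₚ.nonPos*nonPos⇒nonPos p {{ℚ.nonPositive p≤0}} p {{ℚ.nonPositive p≤0}}}}

  0≤p*q : ∀ {p q} → 0ℚ ℚ.≤ p → 0ℚ ℚ.≤ q → 0ℚ ℚ.≤ p ℚ.* q
  0≤p*q {p} {q} 0≤p 0≤q =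
    ℚₚ.nonNegative⁻¹ _ {{ℚₚ.nonNeg*nonNeg⇒nonNeg p {{ℚ.nonNegative 0≤p}} q {{ℚ.nonNegative 0≤q}}}}

  0≤p+q : ∀ {p q} → 0ℚ ℚ.≤ p → 0ℚ ℚ.≤ q → 0ℚ ℚ.≤ p ℚ.+ q
  0≤p+q = ℚₚ.+-mono-≤

  *-monoˡ-≤ : ∀ {p q r} → 0ℚ ℚ.≤ r → p ℚ.≤ q → r ℚ.* p ℚ.≤ r ℚ.* q
  *-monoˡ-≤ {r = r} 0≤r = ℚₚ.*-monoˡ-≤-nonNeg r {{ℚ.nonNegative 0≤r}}

  *-mono-≤ : ∀ {p q r s} → 0ℚ ℚ.≤ p → 0ℚ ℚ.≤ s → p ℚ.≤ q → r ℚ.≤ s → p ℚ.* r ℚ.≤ q ℚ.* s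
  *-mono-≤ {s = s} 0≤p 0≤s p≤q r≤s =
    ℚₚ.≤-trans (*-monoˡ-≤ 0≤p r≤s) (ℚₚ.*-monoʳ-≤-nonNeg s {{ℚ.nonNegative 0≤s}} p≤q)

  0≤1 : 0ℚ ℚ.≤ 1ℚ
  0≤1 = ℚₚ.nonNegative⁻¹ 1ℚ

  1≤p*q : ∀ {p q} → 1ℚ ℚ.≤ p → 1ℚ ℚ.≤ q → 1ℚ ℚ.≤ p ℚ.* q
  1≤p*q 1≤p 1≤q = *-mono-≤ 0≤1 (ℚₚ.≤-trans 0≤1 1≤q) 1≤p 1≤q

  p≤p+q : ∀ {p q} → 0ℚ ℚ.≤ q → p ℚ.≤ p ℚ.+ q
  p≤p+q {p} {q} 0≤q = subst (ℚ._≤ p ℚ.+ q) (ℚₚ.+-identityʳ p) (ℚₚ.+-monoʳ-≤ p 0≤q)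

  q≤p+q : ∀ {p q} → 0ℚ ℚ.≤ p → q ℚ.≤ p ℚ.+ q
  q≤p+q {p} {q} 0≤p = subst (ℚ._≤ p ℚ.+ q) (ℚₚ.+-identityˡ q) (ℚₚ.+-monoˡ-≤ q 0≤p)

  normSq : 𝔾 → ℚ
  normSq (a , b) = a ℚ.* a ℚ.+ b ℚ.* b

  -- The imaginary and the real part of conj v · w.
  cross dot : 𝔾 → 𝔾 → ℚ
  cross (a , b) (c , d) = a ℚ.* d ℚ.- b ℚ.* c
  dot   (a , b) (c , d) = a ℚ.* c ℚ.+ b ℚ.* d

  0≤normSq : ∀ v → 0ℚ ℚ.≤ normSq v
  0≤normSq (a , b) = 0≤p+q (0≤p² a) (0≤p² b)

  module _ where
    open ℚSolver.+-*-Solver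

    normSq-⊠ : ∀ v w → normSq (v ⊠ w) ≡ normSq v ℚ.* normSq w
    normSq-⊠ (a , b) (c , d) = solve 4 (λ a b c d →
      (a :* c :- b :* d) :* (a :* c :- b :* d) :+ (a :* d :+ b :* c) :* (a :* d :+ b :* c)
        := (a :* a :+ b :* b) :* (c :* c :+ d :* d)) refl a b c d

    -- Bounds |v + w|² by 2|v|² + 2|w|², a substitute for the triangle inequality that avoids square
    -- roots.
    parallelogram : ∀ v w → normSq (v ⊞ w) ℚ.+ normSq (v ⊞ ⊟ w)
                          ≡ (normSq v ℚ.+ normSq v) ℚ.+ (normSq w ℚ.+ normSq w)
    parallelogram (a , b) (c , d) = solve 4 (λ a b c d →
      ((a :+ c) :* (a :+ c) :+ (b :+ d) :* (b :+ d))
        :+ ((a :+ :- c) :* (a :+ :- c) :+ (b :+ :- d) :* (b :+ :- d))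
        := ((a :* a :+ b :* b) :+ (a :* a :+ b :* b)) :+ ((c :* c :+ d :* d) :+ (c :* c :+ d :* d))) refl a b c d

    -- Multiplicativity of the norm for conj v · w; dropping either square leaves a Cauchy-Schwarz
    -- inequality.
    lagrange : ∀ v w → normSq v ℚ.* normSq w ≡ cross v w ℚ.* cross v w ℚ.+ dot v w ℚ.* dot v w
    lagrange (a , b) (c , d) = solve 4 (λ a b c d →
      (a :* a :+ b :* b) :* (c :* c :+ d :* d)
        := (a :* d :- b :* c) :* (a :* d :- b :* c) :+ (a :* c :+ b :* d) :* (a :* c :+ b :* d)) refl a b c d

    cross-⊞ʳ : ∀ u v w → cross u (v ⊞ w) ≡ cross u v ℚ.+ cross u w
    cross-⊞ʳ (a , b) (c , d) (e , f) = solve 6 (λ a b c d e f →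
      a :* (d :+ f) :- b :* (c :+ e) := (a :* d :- b :* c) :+ (a :* f :- b :* e)) refl a b c d e f

    cross-⊞ˡ : ∀ u v w → cross (u ⊞ v) w ≡ cross u w ℚ.+ cross v w
    cross-⊞ˡ (a , b) (c , d) (e , f) = solve 6 (λ a b c d e f →
      (a :+ c) :* f :- (b :+ d) :* e := (a :* f :- b :* e) :+ (c :* f :- d :* e)) refl a b c d e f

    dot-⊞ʳ : ∀ u v w → dot u (v ⊞ w) ≡ dot u v ℚ.+ dot u w
    dot-⊞ʳ (a , b) (c , d) (e , f) = solve 6 (λ a b c d e f →
      a :* (c :+ e) :+ b :* (d :+ f) := (a :* c :+ b :* d) :+ (a :* e :+ b :* f)) refl a b c d e f

    cross-self : ∀ v → cross v v ≡ 0ℚ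
    cross-self (a , b) = solve 2 (λ a b → a :* b :- b :* a := con 0ℚ) refl a b

    cross-0ˡ : ∀ v → cross 0𝔾 v ≡ 0ℚ
    cross-0ˡ (a , b) = solve 2 (λ a b → con 0ℚ :* b :- con 0ℚ :* a := con 0ℚ) refl a b

    cross-0ʳ : ∀ v → cross v 0𝔾 ≡ 0ℚ
    cross-0ʳ (a , b) = solve 2 (λ a b → a :* con 0ℚ :- b :* con 0ℚ := con 0ℚ) refl a b

    dot-0ʳ : ∀ v → dot v 0𝔾 ≡ 0ℚ
    dot-0ʳ (a , b) = solve 2 (λ a b → a :* con 0ℚ :+ b :* con 0ℚ := con 0ℚ) refl a b

    cross-⊠ : ∀ z v w → cross (z ⊠ v) (z ⊠ w) ≡ normSq z ℚ.* cross v w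
    cross-⊠ (x , y) (a , b) (c , d) = solve 6 (λ x y a b c d →
      (x :* a :- y :* b) :* (x :* d :+ y :* c) :- (x :* b :+ y :* a) :* (x :* c :- y :* d)
        := (x :* x :+ y :* y) :* (a :* d :- b :* c)) refl x y a b c d

    -- Bilinearity gives four terms: `cross o o` vanishes, and `cross u (z ⊠ u)` is Im z · |u|², the
    -- only strictly positive contribution in the whole argument.
    cross-overlap : ∀ z u o → cross (u ⊞ o) (o ⊞ z ⊠ u)
                            ≡ (cross u o ℚ.+ cross o (z ⊠ u)) ℚ.+ proj₂ z ℚ.* normSq u
    cross-overlap (x , y) (a , b) (c , d) = solve 6 (λ x y a b c d →
      (a :+ c) :* (d :+ (x :* b :+ y :* a)) :- (b :+ d) :* (c :+ (x :* a :- y :* b))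
        := ((a :* d :- b :* c) :+ (c :* (x :* b :+ y :* a) :- d :* (x :* a :- y :* b)))
           :+ y :* (a :* a :+ b :* b)) refl x y a b c d

    cross-1-⊠1 : ∀ z → cross 1𝔾 (z ⊠ 1𝔾) ≡ proj₂ z
    cross-1-⊠1 (x , y) = solve 2 (λ x y →
      con 1ℚ :* (x :* con 0ℚ :+ y :* con 1ℚ) :- con 0ℚ :* (x :* con 1ℚ :- y :* con 0ℚ) := y) refl x y

  cross²≤ : ∀ v w → cross v w ℚ.* cross v w ℚ.≤ normSq v ℚ.* normSq w
  cross²≤ v w = subst (cross v w ℚ.* cross v w ℚ.≤_) (sym (lagrange v w)) (p≤p+q (0≤p² (dot v w)))

  dot²≤ : ∀ v w → dot v w ℚ.* dot v w ℚ.≤ normSq v ℚ.* normSq w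
  dot²≤ v w = subst (dot v w ℚ.* dot v w ℚ.≤_) (sym (lagrange v w)) (q≤p+q (0≤p² (cross v w)))

  -- A positive lower bound stored through its reciprocal, so that bounds for products are formed
  -- without division.
  record BoundedBelow (s : ℕ → ℚ) : Set where
    constructor mkBoundedBelow
    field
      factor    : ℚ
      0≤factor  : 0ℚ ℚ.≤ factor
      1≤factor* : ∀ n → 1ℚ ℚ.≤ factor ℚ.* s n

  -- The quantitative form of nonvanishing: the squared modulus stays above a fixed positive number.
  record Apart (f : ℕ → 𝔾) : Set where
    constructor mkApart
    field
      normSq-below : BoundedBelow (λ n → normSq (f n))

  record Bounded (f : ℕ → 𝔾) : Set where
    constructor mkBounded
    field
      bound        : ℚ
      0≤bound      : 0ℚ ℚ.≤ bound
      normSq≤bound : ∀ n → normSq (f n) ℚ.≤ bound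

  boundedBelow-mono : ∀ {s t : ℕ → ℚ} → (∀ n → s n ℚ.≤ t n) → BoundedBelow s → BoundedBelow t
  boundedBelow-mono s≤t (mkBoundedBelow K 0≤K 1≤) = mkBoundedBelow K 0≤K λ n → ℚₚ.≤-trans (1≤ n) (*-monoˡ-≤ 0≤K (s≤t n))

  boundedBelow-* : ∀ {s t : ℕ → ℚ} → BoundedBelow s → BoundedBelow t → BoundedBelow (λ n → s n ℚ.* t n)
  boundedBelow-* {s} {t} (mkBoundedBelow K 0≤K 1≤Ks) (mkBoundedBelow L 0≤L 1≤Lt) =
    mkBoundedBelow (K ℚ.* L) (0≤p*q 0≤K 0≤L) λ n →
    subst (1ℚ ℚ.≤_)
      (solve 4 (λ K L s t → (K :* s) :* (L :* t) := (K :* L) :* (s :* t)) refl K L (s n) (t n))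
      (1≤p*q (1≤Ks n) (1≤Lt n))
    where open ℚSolver.+-*-Solver

  -- From 1 ≤ K s t ≤ K B s. Removing a factor from a product bounded below requires an upper bound
  -- on that factor, not a lower one.
  boundedBelow-*⁻ : ∀ {s t : ℕ → ℚ} {B} → 0ℚ ℚ.≤ B → (∀ n → 0ℚ ℚ.≤ s n) → (∀ n → t n ℚ.≤ B) →
                    BoundedBelow (λ n → s n ℚ.* t n) → BoundedBelow s
  boundedBelow-*⁻ {s} {t} {B} 0≤B 0≤s t≤B (mkBoundedBelow K 0≤K 1≤) =
    mkBoundedBelow (K ℚ.* B) (0≤p*q 0≤K 0≤B) λ n →
    ℚₚ.≤-trans (1≤ n)
      (subst (K ℚ.* (s n ℚ.* t n) ℚ.≤_)
        (solve 3 (λ K s B → K :* (s :* B) := (K :* B) :* s) refl K (s n) B)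
        (*-monoˡ-≤ 0≤K (*-monoˡ-≤ (0≤s n) (t≤B n))))
    where open ℚSolver.+-*-Solver

  apart-cong : ∀ {f g} → (∀ n → f n ≡ g n) → Apart f → Apart g
  apart-cong f≗g (mkApart below) = mkApart (boundedBelow-mono (λ n → ℚₚ.≤-reflexive (cong normSq (f≗g n))) below)

  apart-⊠ : ∀ {f g} → Apart f → Apart g → Apart (λ n → f n ⊠ g n)
  apart-⊠ {f} {g} (mkApart af) (mkApart ag) = mkApart
    (boundedBelow-mono (λ n → ℚₚ.≤-reflexive (sym (normSq-⊠ (f n) (g n)))) (boundedBelow-* af ag))

  apart-⊠⁻ : ∀ {f g} → Bounded g → Apart (λ n → f n ⊠ g n) → Apart f
  apart-⊠⁻ {f} {g} (mkBounded B 0≤B g≤B) (mkApart afg) = mkApart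
    (boundedBelow-*⁻ {λ n → normSq (f n)} {λ n → normSq (g n)} 0≤B (λ n → 0≤normSq (f n)) g≤B
      (boundedBelow-mono (λ n → ℚₚ.≤-reflexive (normSq-⊠ (f n) (g n))) afg))

  -- Here s is `cross` or `dot` of f and g, and the hypothesis is Cauchy-Schwarz: a lower bound on s
  -- forces |g|² ≥ s² / B, where B bounds |f|².
  apart-by : ∀ {f g : ℕ → 𝔾} (s : ℕ → ℚ) → (∀ n → s n ℚ.* s n ℚ.≤ normSq (f n) ℚ.* normSq (g n)) →
             Bounded f → BoundedBelow s → Apart g
  apart-by {f} {g} s s²≤ (mkBounded B 0≤B f≤B) bs = mkApart
    (boundedBelow-*⁻ {λ n → normSq (g n)} {λ n → normSq (f n)} 0≤B (λ n → 0≤normSq (g n)) f≤B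
      (boundedBelow-mono
        (λ n → ℚₚ.≤-trans (s²≤ n) (ℚₚ.≤-reflexive (ℚₚ.*-comm (normSq (f n)) (normSq (g n)))))
        (boundedBelow-* bs bs)))

  bounded-const : ∀ v → Bounded (λ _ → v)
  bounded-const v = mkBounded (normSq v) (0≤normSq v) λ _ → ℚₚ.≤-refl

  bounded-⊠ : ∀ {f g} → Bounded f → Bounded g → Bounded (λ n → f n ⊠ g n)
  bounded-⊠ {f} {g} (mkBounded A 0≤A f≤) (mkBounded B 0≤B g≤) = mkBounded (A ℚ.* B) (0≤p*q 0≤A 0≤B) λ n →
    subst (ℚ._≤ A ℚ.* B) (sym (normSq-⊠ (f n) (g n))) (*-mono-≤ (0≤normSq (f n)) 0≤B (f≤ n) (g≤ n))

  bounded-⊞ : ∀ {f g} → Bounded f → Bounded g → Bounded (λ n → f n ⊞ g n)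
  bounded-⊞ {f} {g} (mkBounded A 0≤A f≤) (mkBounded B 0≤B g≤) =
    mkBounded ((A ℚ.+ A) ℚ.+ (B ℚ.+ B)) (0≤p+q (0≤p+q 0≤A 0≤A) (0≤p+q 0≤B 0≤B)) λ n →
      ℚₚ.≤-trans (p≤p+q (0≤normSq (f n ⊞ ⊟ g n)))
        (subst (ℚ._≤ (A ℚ.+ A) ℚ.+ (B ℚ.+ B)) (sym (parallelogram (f n) (g n)))
          (ℚₚ.+-mono-≤ (ℚₚ.+-mono-≤ (f≤ n) (f≤ n)) (ℚₚ.+-mono-≤ (g≤ n) (g≤ n))))

  bounded-eval𝔾 : ∀ {zs} → Bounded zs → ∀ p → Bounded (λ n → eval𝔾 p (zs n))
  bounded-eval𝔾 bz []      = bounded-const 0𝔾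
  bounded-eval𝔾 bz (a ∷ p) = bounded-⊞ (bounded-const (fromℤ𝔾 a)) (bounded-⊠ bz (bounded-eval𝔾 bz p))

-- The polynomials u^D_i, the signs of their cross products, and lower bounds for their sums.

module Interlacing where

  open GaussianRationals
  open Estimates
  open import Data.Nat as ℕ using (ℕ; zero; suc; _<_; _≤_; _+_; _∸_; s≤s; z≤n)
  import Data.Nat.Properties as ℕₚ
  open import Data.Integer using (ℤ; 0ℤ; 1ℤ)
  open import Data.List using (List; map; []; _∷_; [_]; _++_; foldr)
  open import Data.List.Relation.Unary.All as All using (All; []; _∷_)
  open import Data.List.Relation.Unary.Any using (Any; here; there; any?)
  open import Data.List.Membership.Propositional using (_∈_; find)
  open import Data.List.Relation.Unary.All.Properties using (¬Any⇒All¬)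
  open import Data.Product using (_×_; _,_; proj₂; ∃-syntax)
  open import Data.Sum using (inj₁; inj₂)
  open import Data.Rational as ℚ using (ℚ; 0ℚ; 1ℚ)
  import Data.Rational.Properties as ℚₚ
  open import Relation.Binary.PropositionalEquality hiding ([_])
  open import Relation.Nullary using (yes; no)
  open import Data.Empty using (⊥-elim)

  range : ℕ → ℕ → List ℕ
  range i zero    = []
  range i (suc k) = i ∷ range (suc i) k

  range-+ : ∀ i a b → range i (a + b) ≡ range i a ++ range (i + a) b
  range-+ i zero    b = cong (λ j → range j b) (sym (ℕₚ.+-identityʳ i))
  range-+ i (suc a) b = cong (i ∷_) (trans (range-+ (suc i) a b)
    (cong (λ j → range (suc i) a ++ range j b) (sym (ℕₚ.+-suc i a))))

  range-bounds : ∀ i k → All (λ j → i ≤ j × j < i + k) (range i k)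
  range-bounds i zero    = []
  range-bounds i (suc k) =
    (ℕₚ.≤-refl , ℕₚ.m<m+n i (s≤s z≤n)) ∷
    All.map (λ {j} (i<j , j<) → ℕₚ.<⇒≤ i<j , subst (j <_) (sym (ℕₚ.+-suc i k)) j<) (range-bounds (suc i) k)

  Σ𝔾 : (ℕ → 𝔾) → List ℕ → 𝔾
  Σ𝔾 V = foldr (λ i w → V i ⊞ w) 0𝔾

  Σ𝔾-++ : ∀ V is js → Σ𝔾 V (is ++ js) ≡ Σ𝔾 V is ⊞ Σ𝔾 V js
  Σ𝔾-++ V []       js = sym (𝔾.+-identityˡ _)
  Σ𝔾-++ V (i ∷ is) js = trans (cong (V i ⊞_) (Σ𝔾-++ V is js)) (sym (𝔾.+-assoc (V i) (Σ𝔾 V is) (Σ𝔾 V js)))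

  0≤cross-Σʳ : ∀ V v is → All (λ i → 0ℚ ℚ.≤ cross v (V i)) is → 0ℚ ℚ.≤ cross v (Σ𝔾 V is)
  0≤cross-Σʳ V v []       []       = ℚₚ.≤-reflexive (sym (cross-0ʳ v))
  0≤cross-Σʳ V v (i ∷ is) (p ∷ ps) =
    subst (0ℚ ℚ.≤_) (sym (cross-⊞ʳ v (V i) (Σ𝔾 V is))) (0≤p+q p (0≤cross-Σʳ V v is ps))

  0≤cross-Σ : ∀ V is js → All (λ i → All (λ j → 0ℚ ℚ.≤ cross (V i) (V j)) js) is →
              0ℚ ℚ.≤ cross (Σ𝔾 V is) (Σ𝔾 V js)
  0≤cross-Σ V []       js []       = ℚₚ.≤-reflexive (sym (cross-0ˡ (Σ𝔾 V js)))
  0≤cross-Σ V (i ∷ is) js (p ∷ ps) =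
    subst (0ℚ ℚ.≤_) (sym (cross-⊞ˡ (V i) (Σ𝔾 V is) (Σ𝔾 V js)))
      (0≤p+q (0≤cross-Σʳ V (V i) js p) (0≤cross-Σ V is js ps))

  -- All other terms of the sum contribute nonnegatively, so any single term is a lower bound.
  cross-Σ-term : ∀ V v is (p : ℕ → Set) → (∀ i → p i → 0ℚ ℚ.≤ cross v (V i)) → All p is →
                 ∀ {i} → Any (i ≡_) is → cross v (V i) ℚ.≤ cross v (Σ𝔾 V is)
  cross-Σ-term V v (i ∷ is) p 0≤ (_ ∷ ps) (here refl) =
    subst (cross v (V i) ℚ.≤_) (sym (cross-⊞ʳ v (V i) (Σ𝔾 V is)))
      (p≤p+q (0≤cross-Σʳ V v is (All.map (0≤ _) ps)))
  cross-Σ-term V v (j ∷ is) p 0≤ (pj ∷ ps) {i} (there i∈) =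
    subst (cross v (V i) ℚ.≤_) (sym (cross-⊞ʳ v (V j) (Σ𝔾 V is)))
      (ℚₚ.≤-trans (cross-Σ-term V v is p 0≤ ps i∈) (q≤p+q (0≤ j pj)))

  0≤dot-Σ : ∀ V v is → All (λ i → 0ℚ ℚ.≤ dot v (V i)) is → 0ℚ ℚ.≤ dot v (Σ𝔾 V is)
  0≤dot-Σ V v []       []       = ℚₚ.≤-reflexive (sym (dot-0ʳ v))
  0≤dot-Σ V v (i ∷ is) (p ∷ ps) =
    subst (0ℚ ℚ.≤_) (sym (dot-⊞ʳ v (V i) (Σ𝔾 V is))) (0≤p+q p (0≤dot-Σ V v is ps))

  module Sections (r-1 : ℕ) where

    r : ℕ
    r = suc r-1

    -- x^q if i = q r + c, and zero otherwise. The counter c runs down to the next multiple of r,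
    -- which replaces division by r with structural recursion.
    monomial : ℕ → ℕ → Poly ℤ
    monomial zero    zero    = [ 1ℤ ]
    monomial zero    (suc c) = []
    monomial (suc i) zero    = 0ℤ ∷ monomial i r-1
    monomial (suc i) (suc c) = monomial i c

    polySum : List (Poly ℤ) → Poly ℤ
    polySum = foldr _⊕_ []

    -- The part of x^i (1 + x + ... + x^(r-1))^D with exponents divisible by r, with x^r renamed to
    -- x. It is the u^D_i of the overview.
    section : ℕ → ℕ → Poly ℤ
    section zero    i = monomial i 0
    section (suc D) i = polySum (map (section D) (range i r))

    eval𝔾-polySum : ∀ (p : ℕ → Poly ℤ) is z → eval𝔾 (polySum (map p is)) z ≡ Σ𝔾 (λ i → eval𝔾 (p i) z) is
    eval𝔾-polySum p []       z = refl
    eval𝔾-polySum p (i ∷ is) z =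
      trans (eval𝔾-⊕ z (p i) (polySum (map p is))) (cong (eval𝔾 (p i) z ⊞_) (eval𝔾-polySum p is z))

    monomial-+ : ∀ c i → monomial (c + i) c ≡ monomial i 0
    monomial-+ zero    i = refl
    monomial-+ (suc c) i = monomial-+ c i

    monomial-< : ∀ {i c} → i < c → monomial i c ≡ []
    monomial-< {zero}  {suc c} (s≤s _)   = refl
    monomial-< {suc i} {suc c} (s≤s i<c) = monomial-< i<c

    module _ (z : 𝔾) where

      V : ℕ → ℕ → 𝔾
      V D i = eval𝔾 (section D i) z

      V-suc : ∀ D i → V (suc D) i ≡ Σ𝔾 (V D) (range i r)
      V-suc D i = eval𝔾-polySum (section D) (range i r) z

      V₀-0 : V 0 0 ≡ 1𝔾
      V₀-0 = eval𝔾-const z 1ℤ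

      V₀-< : ∀ {i} → 0 < i → i < r → V 0 i ≡ 0𝔾
      V₀-< {suc i} _ (s≤s i<r-1) =
        trans (cong (λ p → 0𝔾 ⊞ z ⊠ eval𝔾 p z) (monomial-< i<r-1))
              (trans (𝔾.+-identityˡ (z ⊠ 0𝔾)) (𝔾.zeroʳ z))

      Σ-shift : ∀ D → (∀ i → V D (r + i) ≡ z ⊠ V D i) →
                ∀ i k → Σ𝔾 (V D) (range (r + i) k) ≡ z ⊠ Σ𝔾 (V D) (range i k)
      Σ-shift D h i zero    = sym (𝔾.zeroʳ z)
      Σ-shift D h i (suc k) =
        trans (cong₂ _⊞_ (h i) (trans (cong (λ j → Σ𝔾 (V D) (range j k)) (sym (ℕₚ.+-suc r i))) (Σ-shift D h (suc i) k)))
              (sym (𝔾.distribˡ z (V D i) (Σ𝔾 (V D) (range (suc i) k))))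

      -- A factor x^r becomes a factor x after sectioning; for larger D this passes through the
      -- window sums by linearity.
      V-periodic : ∀ D i → V D (r + i) ≡ z ⊠ V D i
      V-periodic zero    i =
        trans (cong (λ p → 0𝔾 ⊞ z ⊠ eval𝔾 p z) (monomial-+ r-1 i)) (𝔾.+-identityˡ (z ⊠ V 0 i))
      V-periodic (suc D) i =
        trans (V-suc D (r + i)) (trans (Σ-shift D (V-periodic D) i r) (cong (z ⊠_) (sym (V-suc D i))))

      V₀-r : V 0 r ≡ z ⊠ 1𝔾
      V₀-r = trans (cong (V 0) (sym (ℕₚ.+-identityʳ r))) (trans (V-periodic 0 0) (cong (z ⊠_) V₀-0))

      -- The endpoint j = r + i is included because a restriction may have d + 1 = r elements.
      Positive-crosses : ℕ → Set
      Positive-crosses D = ∀ i j → i ≤ j → j ≤ r + i → 0ℚ ℚ.≤ cross (V D i) (V D j)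

      -- Two consecutive blocks of total length at most r contain only pairs of indices at distance
      -- less than r, in the right order.
      adjacent-blocks : ∀ D → Positive-crosses D → ∀ i s t → s + t ≤ r →
        0ℚ ℚ.≤ cross (Σ𝔾 (V D) (range i s)) (Σ𝔾 (V D) (range (i + s) t))
      adjacent-blocks D pos i s t s+t≤r = 0≤cross-Σ (V D) (range i s) (range (i + s) t)
        (All.map (λ {a} (i≤a , a<i+s) →
          All.map (λ {b} (i+s≤b , b<i+s+t) →
            pos a b (ℕₚ.≤-trans (ℕₚ.<⇒≤ a<i+s) i+s≤b)
              (ℕₚ.≤-trans (ℕₚ.<⇒≤ b<i+s+t)
                (ℕₚ.≤-trans (ℕₚ.≤-reflexive (ℕₚ.+-assoc i s t))
                  (ℕₚ.≤-trans (ℕₚ.+-monoʳ-≤ i s+t≤r)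
                    (ℕₚ.≤-trans (ℕₚ.≤-reflexive (ℕₚ.+-comm i r)) (ℕₚ.+-monoʳ-≤ r i≤a))))))
            (range-bounds (i + s) t))
          (range-bounds i s))

      -- The windows starting at i and at i + s share the block O; the block U dropped
      -- at the front reappears at the end as z ⊠ U, and cross U (z ⊠ U) = Im z |U|².
      window-cross : ∀ D → Positive-crosses D → ∀ i s → s ≤ r →
        proj₂ z ℚ.* normSq (Σ𝔾 (V D) (range i s)) ℚ.≤ cross (V (suc D) i) (V (suc D) (i + s))
      window-cross D pos i s s≤r =
        subst (proj₂ z ℚ.* normSq U ℚ.≤_)
          (sym (trans (cong₂ cross first second) (cross-overlap z U O)))
          (q≤p+q (0≤p+q (adjacent-blocks D pos i s t (ℕₚ.≤-reflexive s+t≡r))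
            (subst (λ w → 0ℚ ℚ.≤ cross O w) last-block
              (adjacent-blocks D pos (i + s) t s (ℕₚ.≤-reflexive (trans (ℕₚ.+-comm t s) s+t≡r))))))
        where
        t = r ∸ s
        U = Σ𝔾 (V D) (range i s)
        O = Σ𝔾 (V D) (range (i + s) t)
        s+t≡r : s + t ≡ r
        s+t≡r = ℕₚ.m+[n∸m]≡n s≤r
        last-block : Σ𝔾 (V D) (range (i + s + t) s) ≡ z ⊠ U
        last-block = trans
          (cong (λ j → Σ𝔾 (V D) (range j s))
                (trans (ℕₚ.+-assoc i s t) (trans (cong (i +_) s+t≡r) (ℕₚ.+-comm i r))))
          (Σ-shift D (V-periodic D) i s)
        first : V (suc D) i ≡ U ⊞ O
        first = trans (V-suc D i) (trans (cong (λ k → Σ𝔾 (V D) (range i k)) (sym s+t≡r))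
          (trans (cong (Σ𝔾 (V D)) (range-+ i s t)) (Σ𝔾-++ (V D) (range i s) (range (i + s) t))))
        second : V (suc D) (i + s) ≡ O ⊞ z ⊠ U
        second = trans (V-suc D (i + s))
          (trans (cong (λ k → Σ𝔾 (V D) (range (i + s) k)) (trans (sym s+t≡r) (ℕₚ.+-comm s t)))
          (trans (cong (Σ𝔾 (V D)) (range-+ (i + s) t s))
          (trans (Σ𝔾-++ (V D) (range (i + s) t) (range (i + s + t) s)) (cong (O ⊞_) last-block))))

      -- For D = 0 the values are powers of z at the multiples of r and 0 elsewhere. The induction
      -- step is `window-cross` with s = j - i, whose lower bound is nonnegative.
      positive-crosses : 0ℚ ℚ.≤ proj₂ z → ∀ D → Positive-crosses D
      positive-crosses 0≤y zero i j = base i i ℕₚ.≤-refl j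
        where
        -- Lowering both indices by r strips a factor z from both values, which scales the cross
        -- product by |z|². `fuel` bounds i, since `suc i ∸ r` is not structurally smaller. For i =
        -- 0 only j = r gives a nonzero value, Im z.
        base : ∀ fuel i → i ≤ fuel → ∀ j → i ≤ j → j ≤ r + i → 0ℚ ℚ.≤ cross (V 0 i) (V 0 j)
        base fuel zero i≤ zero _ _ = ℚₚ.≤-reflexive (sym (cross-self (V 0 0)))
        base fuel zero i≤ (suc j) _ j≤ with ℕₚ.m≤n⇒m<n∨m≡n (subst (suc j ≤_) (ℕₚ.+-identityʳ r) j≤)
        ... | inj₁ j<r  = ℚₚ.≤-reflexive (sym (trans (cong (cross (V 0 0)) (V₀-< (s≤s z≤n) j<r)) (cross-0ʳ (V 0 0))))
        ... | inj₂ refl = subst (0ℚ ℚ.≤_) (sym (trans (cong₂ cross V₀-0 V₀-r) (cross-1-⊠1 z))) 0≤y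
        base (suc fuel) (suc i) (s≤s i≤) j i<j j≤ with r ℕ.≤? suc i
        ... | no  r≰i = ℚₚ.≤-reflexive (sym (trans (cong (λ v → cross v (V 0 j)) (V₀-< (s≤s z≤n) (ℕₚ.≰⇒> r≰i)))
                                                (cross-0ˡ (V 0 j))))
        ... | yes r≤i =
          subst (0ℚ ℚ.≤_)
            (sym (trans (cong₂ cross (trans (cong (V 0) i-split) (V-periodic 0 i′)) (trans (cong (V 0) j-split) (V-periodic 0 j′)))
                        (cross-⊠ z (V 0 i′) (V 0 j′))))
            (0≤p*q (0≤normSq z)
              (base fuel i′ (ℕₚ.≤-trans (ℕₚ.m∸n≤m i r-1) i≤) j′
                (ℕₚ.∸-monoˡ-≤ r i<j)
                (ℕₚ.≤-trans (ℕₚ.∸-monoˡ-≤ r j≤) (ℕₚ.≤-reflexive (ℕₚ.+-∸-assoc r r≤i)))))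
          where
          i′ = suc i ∸ r
          j′ = j ∸ r
          i-split : suc i ≡ r + i′
          i-split = sym (ℕₚ.m+[n∸m]≡n r≤i)
          j-split : j ≡ r + j′
          j-split = sym (ℕₚ.m+[n∸m]≡n (ℕₚ.≤-trans r≤i i<j))
      positive-crosses 0≤y (suc D) i j i≤j j≤ =
        subst (λ k → 0ℚ ℚ.≤ cross (V (suc D) i) (V (suc D) k)) (ℕₚ.m+[n∸m]≡n i≤j)
          (ℚₚ.≤-trans (0≤p*q 0≤y (0≤normSq (Σ𝔾 (V D) (range i (j ∸ i)))))
            (window-cross D (positive-crosses 0≤y D) i (j ∸ i)
              (subst (j ∸ i ≤_) (ℕₚ.m+n∸n≡m r i) (ℕₚ.∸-monoˡ-≤ i j≤))))

    module _ (zs : ℕ → 𝔾) (im-below : BoundedBelow (λ n → proj₂ (zs n))) (zs-bounded : Bounded zs) where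

      0≤im : ∀ n → 0ℚ ℚ.≤ proj₂ (zs n)
      0≤im n with ℚₚ.≤-total 0ℚ (proj₂ (zs n))
      ... | inj₁ 0≤y = 0≤y
      ... | inj₂ y≤0 = ⊥-elim (ℚₚ.<-irrefl refl (ℚₚ.<-≤-trans (ℚₚ.positive⁻¹ 1ℚ)
            (ℚₚ.≤-trans (1≤factor* n)
              (subst (factor ℚ.* proj₂ (zs n) ℚ.≤_) (ℚₚ.*-zeroʳ factor) (*-monoˡ-≤ 0≤factor y≤0)))))
        where open BoundedBelow im-below

      V-bounded : ∀ D i → Bounded (λ n → V (zs n) D i)
      V-bounded D i = bounded-eval𝔾 zs-bounded (section D i)

      -- Taking `cross` with the value at 0 annihilates that value, and every other index lies
      -- within distance r of 0. One term bounded below then suffices.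
      apart-from-cross : ∀ D is {i} → All (_≤ r) is → Any (i ≡_) is →
        BoundedBelow (λ n → cross (V (zs n) D 0) (V (zs n) D i)) → Apart (λ n → Σ𝔾 (V (zs n) D) (0 ∷ is))
      apart-from-cross D is is≤r i∈is below =
        apart-by (λ n → cross (V (zs n) D 0) (Σ𝔾 (V (zs n) D) (0 ∷ is)))
          (λ n → cross²≤ (V (zs n) D 0) (Σ𝔾 (V (zs n) D) (0 ∷ is))) (V-bounded D 0)
          (boundedBelow-mono (λ n → cross-Σ-term (V (zs n) D) (V (zs n) D 0) (0 ∷ is) (_≤ r)
              (λ j j≤r → positive-crosses (zs n) (0≤im n) D 0 j z≤n (ℕₚ.≤-trans j≤r (ℕₚ.m≤m+n r 0)))
              (z≤n ∷ is≤r) (there i∈is))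
            below)

      -- Serves the case in which all cross products with the value at 0 may vanish: the sum then
      -- has no cancellation against that value.
      apart-from-dot : ∀ D is → (∀ n → All (λ i → 0ℚ ℚ.≤ dot (V (zs n) D 0) (V (zs n) D i)) is) →
        Apart (λ n → V (zs n) D 0) → Apart (λ n → Σ𝔾 (V (zs n) D) (0 ∷ is))
      apart-from-dot D is 0≤ (mkApart below) =
        apart-by (λ n → dot (V (zs n) D 0) (Σ𝔾 (V (zs n) D) (0 ∷ is)))
          (λ n → dot²≤ (V (zs n) D 0) (Σ𝔾 (V (zs n) D) (0 ∷ is))) (V-bounded D 0)
          (boundedBelow-mono (λ n →
              subst (normSq (V (zs n) D 0) ℚ.≤_)
                (sym (dot-⊞ʳ (V (zs n) D 0) (V (zs n) D 0) (Σ𝔾 (V (zs n) D) is)))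
                (p≤p+q (0≤dot-Σ (V (zs n) D) (V (zs n) D 0) is (0≤ n))))
            below)

      -- Proved together with `sections-apart`: sums at level D + 1 need initial blocks at level D,
      -- and an initial block is itself a sum of the kind treated there.
      block-apart : ∀ D i → i < r → Apart (λ n → Σ𝔾 (V (zs n) D) (range 0 (suc i)))

      -- If a positive index i occurs at level D + 1, then `window-cross` at 0 bounds a cross
      -- product below by Im z times the squared modulus of the block 0, ..., i - 1 at level D.
      -- Otherwise all indices are 0 and the sum is a multiple of one value. At level 0 the index r
      -- plays the part of i, and without it all values are 0 or 1.
      sections-apart : ∀ D is → All (_≤ r) is → Apart (λ n → Σ𝔾 (V (zs n) D) (0 ∷ is))
      sections-apart zero is is≤r with any? (r ℕ.≟_) is
      ... | yes r∈is = apart-from-cross 0 is is≤r r∈is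
        (boundedBelow-mono (λ n → ℚₚ.≤-reflexive (sym (trans (cong₂ cross (V₀-0 (zs n)) (V₀-r (zs n))) (cross-1-⊠1 (zs n)))))
          im-below)
      ... | no  r∉is = apart-from-dot 0 is
        (λ n → All.zipWith (λ {i} (r≢i , i≤r) → 0≤dot n i (ℕₚ.≤∧≢⇒< i≤r (λ i≡r → r≢i (sym i≡r)))) (¬Any⇒All¬ is r∉is , is≤r))
        (mkApart (mkBoundedBelow 1ℚ 0≤1 λ n → subst (λ v → 1ℚ ℚ.≤ 1ℚ ℚ.* normSq v) (sym (V₀-0 (zs n))) ℚₚ.≤-refl))
        where
        0≤dot : ∀ n i → i < r → 0ℚ ℚ.≤ dot (V (zs n) 0 0) (V (zs n) 0 i)
        0≤dot n zero    _   = 0≤normSq (V (zs n) 0 0)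
        0≤dot n (suc i) i<r = ℚₚ.≤-reflexive
          (sym (trans (cong (dot (V (zs n) 0 0)) (V₀-< (zs n) (s≤s z≤n) i<r)) (dot-0ʳ (V (zs n) 0 0))))
      sections-apart (suc D) is is≤r with any? (0 ℕ.<?_) is
      ... | yes p = via (find p)
        where
        via : ∃[ i ] (i ∈ is × 0 < i) → Apart (λ n → Σ𝔾 (V (zs n) (suc D)) (0 ∷ is))
        via (suc i , i∈is , _) = apart-from-cross (suc D) is is≤r i∈is
          (boundedBelow-mono
            (λ n → window-cross (zs n) D (positive-crosses (zs n) (0≤im n) D) 0 (suc i) (All.lookup is≤r i∈is))
            (boundedBelow-* im-below (Apart.normSq-below (block-apart D i (All.lookup is≤r i∈is)))))
      ... | no  ¬p = apart-from-dot (suc D) is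
        (λ n → All.map (λ { {zero} _ → 0≤normSq (V (zs n) (suc D) 0) ; {suc i} 0≮i → ⊥-elim (0≮i (s≤s z≤n)) })
                       (¬Any⇒All¬ is ¬p))
        -- The value at 0 on level D + 1 is the full block 0, ..., r - 1 on level D.
        (apart-cong (λ n → sym (V-suc (zs n) D 0)) (block-apart D r-1 ℕₚ.≤-refl))

      block-apart D i i<r = sections-apart D (range 1 i)
        (All.map (λ (_ , j<) → ℕₚ.≤-trans (ℕₚ.<⇒≤ j<) i<r) (range-bounds 1 i))

-- From lower bounds on both half planes to real-rootedness over the Cauchy reals.

module Nonvanishing where

  open GaussianRationals
  open Estimates
  open import Data.Nat using (ℕ; _⊔_) renaming (_≤_ to _≤ₙ_; _+_ to _+ₙ_)
  import Data.Nat.Properties as ℕₚ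
  open import Data.List using (map; []; _∷_)
  open import Data.Product using (_×_; _,_; proj₁; proj₂; ∃-syntax)
  open import Data.Sum using (inj₁; inj₂)
  open import Data.Rational as ℚ hiding (_≃_; _⊔_; _<_)
  import Data.Rational.Properties as ℚₚ
  import Data.Rational.Solver as ℚSolver
  open import Relation.Binary.PropositionalEquality hiding ([_])
  open import Relation.Nullary using (yes; no)
  open import Data.Empty using (⊥; ⊥-elim)

  open ℚSolver.+-*-Solver

  0<p*q : ∀ {p q} → 0ℚ ℚ.< p → 0ℚ ℚ.< q → 0ℚ ℚ.< p * q
  0<p*q {p} {q} 0<p 0<q = ℚₚ.positive⁻¹ (p * q) {{ℚₚ.pos*pos⇒pos p {{positive 0<p}} q {{positive 0<q}}}}

  p≤∣p∣ : ∀ p → p ≤ ∣ p ∣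
  p≤∣p∣ p with ℚₚ.≤-total 0ℚ p
  ... | inj₁ 0≤p = ℚₚ.≤-reflexive (sym (ℚₚ.0≤p⇒∣p∣≡p 0≤p))
  ... | inj₂ p≤0 = ℚₚ.≤-trans p≤0 (ℚₚ.0≤∣p∣ p)

  -p≤∣p∣ : ∀ p → - p ≤ ∣ p ∣
  -p≤∣p∣ p = subst (- p ≤_) (ℚₚ.∣-p∣≡∣p∣ p) (p≤∣p∣ (- p))

  ∣p∣≤⇒p²≤ : ∀ {p q} → ∣ p ∣ ≤ q → p * p ≤ q * q
  ∣p∣≤⇒p²≤ {p} {q} ∣p∣≤q = subst (_≤ q * q)
    (trans (sym (ℚₚ.∣p*q∣≡∣p∣*∣q∣ p p)) (ℚₚ.0≤p⇒∣p∣≡p (0≤p² p)))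
    (*-mono-≤ (ℚₚ.0≤∣p∣ p) (ℚₚ.≤-trans (ℚₚ.0≤∣p∣ p) ∣p∣≤q) ∣p∣≤q ∣p∣≤q)

  conj : 𝔾 → 𝔾
  conj (a , b) = a , - b

  conj-⊠ : ∀ v w → conj (v ⊠ w) ≡ conj v ⊠ conj w
  conj-⊠ (a , b) (c , d) = cong₂ _,_
    (solve 4 (λ a b c d → a :* c :- b :* d := a :* c :- :- b :* :- d) refl a b c d)
    (solve 4 (λ a b c d → :- (a :* d :+ b :* c) := a :* :- d :+ :- b :* c) refl a b c d)

  eval𝔾-conj : ∀ p z → eval𝔾 p (conj z) ≡ conj (eval𝔾 p z)
  eval𝔾-conj []      z = refl
  eval𝔾-conj (a ∷ p) z =
    trans (cong (λ w → fromℤ𝔾 a ⊞ w) (trans (cong (conj z ⊠_) (eval𝔾-conj p z)) (sym (conj-⊠ z (eval𝔾 p z)))))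
          (cong₂ _,_ refl (solve 1 (λ b → con 0ℚ :+ :- b := :- (con 0ℚ :+ b)) refl (proj₂ (z ⊠ eval𝔾 p z))))

  normSq-conj : ∀ v → normSq (conj v) ≡ normSq v
  normSq-conj (a , b) = solve 2 (λ a b → a :* a :+ :- b :* :- b := a :* a :+ b :* b) refl a b

  apart-conj : ∀ {f} → Apart (λ n → conj (f n)) → Apart f
  apart-conj {f} (mkApart below) = mkApart (boundedBelow-mono (λ n → ℚₚ.≤-reflexive (normSq-conj (f n))) below)

  bounded-conj : ∀ {f} → Bounded f → Bounded (λ n → conj (f n))
  bounded-conj {f} (mkBounded B 0≤B f≤B) = mkBounded B 0≤B λ n → subst (_≤ B) (sym (normSq-conj (f n))) (f≤B n)

  reciprocal : ∀ {δ} → 0ℚ ℚ.< δ → ∃[ K ] (0ℚ ≤ K × K * δ ≡ 1ℚ)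
  reciprocal {δ} 0<δ = 1/ δ , ℚₚ.<⇒≤ (ℚₚ.positive⁻¹ (1/ δ) {{ℚₚ.1/pos⇒pos δ}}) , ℚₚ.*-inverseˡ δ
    where
    instance
      δ-pos : Positive δ
      δ-pos = positive 0<δ
      δ-nonZero : NonZero δ
      δ-nonZero = ℚₚ.pos⇒nonZero δ

  boundedBelow-const : ∀ {s : ℕ → ℚ} {δ} → 0ℚ ℚ.< δ → (∀ n → δ ≤ s n) → BoundedBelow s
  boundedBelow-const 0<δ δ≤ with reciprocal 0<δ
  ... | K , 0≤K , Kδ≡1 = mkBoundedBelow K 0≤K λ n → subst (_≤ _) Kδ≡1 (*-monoˡ-≤ 0≤K (δ≤ n))

  -- For a given ε the question whether y is small is settled at one index N by comparing rationals.
  -- If the term there is large, the Cauchy condition keeps y away from 0 with a fixed sign, against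
  -- one of the hypotheses.
  ≃0-by-contradiction : ∀ y →
    (∀ δ N → 0ℚ ℚ.< δ → (∀ n → N ≤ₙ n → δ ≤ seq y n) → ⊥) →
    (∀ δ N → 0ℚ ℚ.< δ → (∀ n → N ≤ₙ n → δ ≤ - seq y n) → ⊥) → y ≃ 0ℝ
  ≃0-by-contradiction y ¬pos ¬neg ε 0<ε = conclude (cauchy y δ 0<δ)
    where
    -- A quarter of ε: a term of size ε/2 leaves at least ε/4 after a deviation of ε/4, and a term
    -- below ε/2 stays below ε.
    δ = ½ * (½ * ε)
    0<½ε : 0ℚ ℚ.< ½ * ε
    0<½ε = 0<p*q (ℚₚ.positive⁻¹ ½) 0<ε
    0<δ : 0ℚ ℚ.< δ
    0<δ = 0<p*q (ℚₚ.positive⁻¹ ½) 0<½ε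
    δ+δ : δ + δ ≡ ½ * ε
    δ+δ = solve 1 (λ ε → con ½ :* (con ½ :* ε) :+ con ½ :* (con ½ :* ε) := con ½ :* ε) refl ε
    conclude : ∃[ N ] (∀ m n → N ≤ₙ m → N ≤ₙ n → ∣ seq y m - seq y n ∣ ℚ.< δ) →
               ∃[ N ] (∀ n → N ≤ₙ n → ∣ seq y n - 0ℚ ∣ ℚ.< ε)
    conclude (N , close) with ½ * ε ≤? seq y N | ½ * ε ≤? - seq y N
    ... | yes big | _ = ⊥-elim (¬pos δ N 0<δ λ n N≤n →
      subst₂ _≤_
        (trans (cong (_+ - δ) (sym δ+δ)) (solve 1 (λ d → (d :+ d) :+ :- d := d) refl δ))
        (solve 2 (λ a b → a :+ :- (a :- b) := b) refl (seq y N) (seq y n))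
        (ℚₚ.+-mono-≤ big (ℚₚ.neg-antimono-≤
          (ℚₚ.≤-trans (p≤∣p∣ (seq y N - seq y n)) (ℚₚ.<⇒≤ (close N n ℕₚ.≤-refl N≤n))))))
    ... | no _ | yes big = ⊥-elim (¬neg δ N 0<δ λ n N≤n →
      subst₂ _≤_
        (trans (cong (_+ - δ) (sym δ+δ)) (solve 1 (λ d → (d :+ d) :+ :- d := d) refl δ))
        (solve 2 (λ a b → :- a :+ :- :- (a :- b) := :- b) refl (seq y N) (seq y n))
        (ℚₚ.+-mono-≤ big (ℚₚ.neg-antimono-≤
          (ℚₚ.≤-trans (-p≤∣p∣ (seq y N - seq y n)) (ℚₚ.<⇒≤ (close N n ℕₚ.≤-refl N≤n))))))
    ... | no ¬big | no ¬small = N , λ n N≤n →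
      subst (ℚ._< ε) (cong ∣_∣ (solve 2 (λ a b → (a :- b) :+ b := a :- con 0ℚ) refl (seq y n) (seq y N)))
        (ℚₚ.≤-<-trans (ℚₚ.∣p+q∣≤∣p∣+∣q∣ (seq y n - seq y N) (seq y N))
          (subst (∣ seq y n - seq y N ∣ + ∣ seq y N ∣ ℚ.<_)
            (solve 1 (λ ε → con ½ :* ε :+ con ½ :* ε := ε) refl ε)
            (ℚₚ.+-mono-< (ℚₚ.<-≤-trans (close n N N≤n ℕₚ.≤-refl)
                           (subst (δ ≤_) δ+δ (p≤p+q (ℚₚ.<⇒≤ 0<δ))))
                         ∣yN∣<)))
      where
      ∣yN∣< : ∣ seq y N ∣ ℚ.< ½ * ε
      ∣yN∣< with ℚₚ.∣p∣≡p∨∣p∣≡-p (seq y N)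
      ... | inj₁ eq = subst (ℚ._< ½ * ε) (sym eq) (ℚₚ.≰⇒> ¬big)
      ... | inj₂ eq = subst (ℚ._< ½ * ε) (sym eq) (ℚₚ.≰⇒> ¬small)

  values : ℂ → ℕ → 𝔾
  values z n = seq (re z) n , seq (im z) n

  -- A Cauchy sequence is bounded only eventually here, and its sign is known only eventually.
  -- Taking M ≥ N gives a tail on which both hold.
  tail-bounded : ∀ z N → ∃[ M ] (N ≤ₙ M × Bounded (λ n → values z (M +ₙ n)))
  tail-bounded z N =
    let A , 0<A , K , x≤ = cauchy-bounded (seq (re z)) (cauchy (re z))
        B , 0<B , L , y≤ = cauchy-bounded (seq (im z)) (cauchy (im z))
        M = N ⊔ (K ⊔ L)
        K≤M : K ≤ₙ M
        K≤M = ℕₚ.≤-trans (ℕₚ.m≤m⊔n K L) (ℕₚ.m≤n⊔m N (K ⊔ L))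
        L≤M : L ≤ₙ M
        L≤M = ℕₚ.≤-trans (ℕₚ.m≤n⊔m K L) (ℕₚ.m≤n⊔m N (K ⊔ L))
    in M , ℕₚ.m≤m⊔n N (K ⊔ L) , mkBounded (A * A + B * B) (0≤p+q (0≤p² A) (0≤p² B)) λ n →
         ℚₚ.+-mono-≤ (∣p∣≤⇒p²≤ (x≤ (M +ₙ n) (ℕₚ.≤-trans K≤M (ℕₚ.m≤m+n M n))))
                     (∣p∣≤⇒p²≤ (y≤ (M +ₙ n) (ℕₚ.≤-trans L≤M (ℕₚ.m≤m+n M n))))

  ¬zero-if-apart : ∀ p z M → Apart (λ n → eval𝔾 p (values z (M +ₙ n))) → IsZero (map fromℤ p) z → ⊥
  ¬zero-if-apart p z M (mkApart (mkBoundedBelow K 0≤K 1≤)) (re≃0 , im≃0) =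
    contradict (reciprocal 0<L)
    where
    -- With ε = 1 / (2K + 1) ≤ 1, a value with both coordinates below ε has squared modulus at most
    -- 2ε, and 2Kε = 1 - ε < 1.
    L = (K + K) + 1ℚ
    0<L : 0ℚ ℚ.< L
    0<L = ℚₚ.+-mono-≤-< (0≤p+q 0≤K 0≤K) (ℚₚ.positive⁻¹ 1ℚ)
    contradict : ∃[ ε ] (0ℚ ≤ ε × ε * L ≡ 1ℚ) → ⊥
    contradict (ε , 0≤ε , εL≡1) = ℚₚ.<-irrefl refl (ℚₚ.<-≤-trans small (1≤ n))
      where
      0<ε : 0ℚ ℚ.< ε
      0<ε with ε ≤? 0ℚ
      ... | no  ε≰0 = ℚₚ.≰⇒> ε≰0
      ... | yes ε≤0 = ⊥-elim (ℚₚ.<-irrefl refl (ℚₚ.<-≤-trans (ℚₚ.positive⁻¹ 1ℚ)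
        (subst₂ _≤_ (trans (ℚₚ.*-comm L ε) εL≡1) (ℚₚ.*-zeroʳ L) (*-monoˡ-≤ (ℚₚ.<⇒≤ 0<L) ε≤0))))
      ε≤1 : ε ≤ 1ℚ
      ε≤1 = subst₂ _≤_ (ℚₚ.*-identityʳ ε) εL≡1 (*-monoˡ-≤ 0≤ε (q≤p+q (0≤p+q 0≤K 0≤K)))
      N₁ = proj₁ (re≃0 ε 0<ε)
      N₂ = proj₁ (im≃0 ε 0<ε)
      n = N₁ ⊔ N₂
      N₁≤ : N₁ ≤ₙ M +ₙ n
      N₁≤ = ℕₚ.≤-trans (ℕₚ.m≤m⊔n N₁ N₂) (ℕₚ.m≤n+m n M)
      N₂≤ : N₂ ≤ₙ M +ₙ n
      N₂≤ = ℕₚ.≤-trans (ℕₚ.m≤n⊔m N₁ N₂) (ℕₚ.m≤n+m n M)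
      w = eval𝔾 p (values z (M +ₙ n))
      square : ∀ a → ∣ a - 0ℚ ∣ ℚ.< ε → a * a ≤ ε
      square a ∣a∣<ε = ℚₚ.≤-trans
        (∣p∣≤⇒p²≤ (subst (λ b → ∣ b ∣ ≤ ε) (ℚₚ.+-identityʳ a) (ℚₚ.<⇒≤ ∣a∣<ε)))
        (subst (ε * ε ≤_) (ℚₚ.*-identityʳ ε) (*-monoˡ-≤ 0≤ε ε≤1))
      w≤ : normSq w ≤ ε + ε
      w≤ = subst (λ v → normSq v ≤ ε + ε) (eval-seq p z (M +ₙ n))
        (ℚₚ.+-mono-≤
          (square (seq (re (eval (map fromℤ p) z)) (M +ₙ n)) (proj₂ (re≃0 ε 0<ε) (M +ₙ n) N₁≤)) 
          (square (seq (im (eval (map fromℤ p) z)) (M +ₙ n)) (proj₂ (im≃0 ε 0<ε) (M +ₙ n) N₂≤)))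
      small : K * normSq w ℚ.< 1ℚ
      small = ℚₚ.≤-<-trans (*-monoˡ-≤ 0≤K w≤)
        (subst₂ ℚ._<_ (ℚₚ.+-identityʳ (K * (ε + ε)))
          (trans (solve 2 (λ K ε → K :* (ε :+ ε) :+ ε := ε :* ((K :+ K) :+ con 1ℚ)) refl K ε) εL≡1)
          (ℚₚ.+-monoʳ-< (K * (ε + ε)) 0<ε))

  -- A root with Im z bounded above by a negative number is conjugated into the upper half plane;
  -- the coefficients are real, so the value is merely conjugated.
  realRooted-if-apart : ∀ p →
    (∀ zs → BoundedBelow (λ n → proj₂ (zs n)) → Bounded zs → Apart (λ n → eval𝔾 p (zs n))) →
    RealRooted (map fromℤ p)
  realRooted-if-apart p apart = inj₂ λ z zero-z →
    ≃0-by-contradiction (im z)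
      (λ δ N 0<δ δ≤ → let M , N≤M , bz = tail-bounded z N in
        ¬zero-if-apart p z M
          (apart (λ n → values z (M +ₙ n))
            (boundedBelow-const 0<δ (λ n → δ≤ (M +ₙ n) (ℕₚ.≤-trans N≤M (ℕₚ.m≤m+n M n)))) bz)
          zero-z)
      (λ δ N 0<δ δ≤ → let M , N≤M , bz = tail-bounded z N in
        ¬zero-if-apart p z M
          (apart-conj (apart-cong (λ n → eval𝔾-conj p (values z (M +ₙ n)))
            (apart (λ n → conj (values z (M +ₙ n)))
              (boundedBelow-const 0<δ (λ n → δ≤ (M +ₙ n) (ℕₚ.≤-trans N≤M (ℕₚ.m≤m+n M n)))) (bounded-conj bz))))
          zero-z)

-- Power series as coefficient sequences; the h-polynomial and the polynomials u^D_i as numerators.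

module HilbertSeries where

  open GaussianRationals
  open Interlacing
  open import Data.Nat as ℕ using (ℕ; zero; suc; _≤_; _∸_)
  import Data.Nat.Properties as ℕₚ
  open import Data.Integer as ℤ using (ℤ; 0ℤ; 1ℤ; -1ℤ; +_; _+_; _*_; _-_)
  import Data.Integer.Properties as ℤₚ
  import Data.Integer.Solver as ℤSolver
  open import Data.List using (List; map; []; _∷_; [_]; foldr; upTo)
  open import Data.List.Membership.Propositional.Properties using (∈-upTo⁻)
  open import Data.List.Relation.Unary.All as All using (All; []; _∷_)
  open import Relation.Binary.PropositionalEquality hiding ([_])

  private variable A : Set

  iter : (A → A) → ℕ → A → A
  iter f zero    x = x
  iter f (suc k) x = f (iter f k x)

  iter-+ : ∀ (f : A → A) j k x → iter f (j ℕ.+ k) x ≡ iter f j (iter f k x)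
  iter-+ f zero    k x = refl
  iter-+ f (suc j) k x = cong f (iter-+ f j k x)

  sumℤ : (A → ℤ) → List A → ℤ
  sumℤ f []       = 0ℤ
  sumℤ f (x ∷ xs) = f x + sumℤ f xs

  sumℤ-cong : ∀ {f g : A → ℤ} → (∀ a → f a ≡ g a) → ∀ xs → sumℤ f xs ≡ sumℤ g xs
  sumℤ-cong eq []       = refl
  sumℤ-cong eq (x ∷ xs) = cong₂ _+_ (eq x) (sumℤ-cong eq xs)

  sumℤ-cong-All : ∀ {f g : A → ℤ} {xs} → All (λ a → f a ≡ g a) xs → sumℤ f xs ≡ sumℤ g xs
  sumℤ-cong-All []         = refl
  sumℤ-cong-All (eq ∷ eqs) = cong₂ _+_ eq (sumℤ-cong-All eqs)

  -- Multiplication of a power series by x and by 1 - x.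
  shift ∇ : (ℕ → ℤ) → ℕ → ℤ
  shift s zero    = 0ℤ
  shift s (suc n) = s n
  ∇ s n = s n - shift s n

  δ : ℕ → ℤ
  δ zero    = 1ℤ
  δ (suc _) = 0ℤ

  shift-cong : ∀ {s t} → s ≗ t → shift s ≗ shift t
  shift-cong eq zero    = refl
  shift-cong eq (suc n) = eq n

  ∇-cong : ∀ {s t} → s ≗ t → ∇ s ≗ ∇ t
  ∇-cong eq n = cong₂ _-_ (eq n) (shift-cong eq n)

  ∇^-cong : ∀ k {s t} → s ≗ t → iter ∇ k s ≗ iter ∇ k t
  ∇^-cong zero    eq = eq
  ∇^-cong (suc k) eq = ∇-cong (∇^-cong k eq)

  ∇-shift : ∀ s → ∇ (shift s) ≗ shift (∇ s)
  ∇-shift s zero          = refl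
  ∇-shift s (suc zero)    = refl
  ∇-shift s (suc (suc n)) = refl

  ∇^-shift : ∀ k s → iter ∇ k (shift s) ≗ shift (iter ∇ k s)
  ∇^-shift zero    s n = refl
  ∇^-shift (suc k) s n = trans (∇-cong (∇^-shift k s) n) (∇-shift (iter ∇ k s) n)

  ∇^-∇ : ∀ k s → iter ∇ k (∇ s) ≡ ∇ (iter ∇ k s)
  ∇^-∇ zero    s = refl
  ∇^-∇ (suc k) s = cong ∇ (∇^-∇ k s)

  ∇^-comm : ∀ j k s → iter ∇ j (iter ∇ k s) ≡ iter ∇ k (iter ∇ j s)
  ∇^-comm j k s = trans (sym (iter-+ ∇ j k s)) (trans (cong (λ l → iter ∇ l s) (ℕₚ.+-comm j k)) (iter-+ ∇ k j s))

  module _ where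
    open ℤSolver.+-*-Solver

    ∇-+ : ∀ s t → ∇ (λ n → s n + t n) ≗ λ n → ∇ s n + ∇ t n
    ∇-+ s t zero    = solve 2 (λ a b → (a :+ b) :- con 0ℤ := (a :- con 0ℤ) :+ (b :- con 0ℤ)) refl (s 0) (t 0)
    ∇-+ s t (suc n) = solve 4 (λ a b c d → (a :+ b) :- (c :+ d) := (a :- c) :+ (b :- d)) refl
      (s (suc n)) (t (suc n)) (s n) (t n)

    ∇-* : ∀ c s → ∇ (λ n → c * s n) ≗ λ n → c * ∇ s n
    ∇-* c s zero    = solve 2 (λ c a → c :* a :- con 0ℤ := c :* (a :- con 0ℤ)) refl c (s 0)
    ∇-* c s (suc n) = solve 3 (λ c a b → c :* a :- c :* b := c :* (a :- b)) refl c (s (suc n)) (s n)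

    ∇-0 : ∇ (λ _ → 0ℤ) ≗ λ _ → 0ℤ
    ∇-0 zero    = refl
    ∇-0 (suc n) = refl

  ∇^-+ : ∀ k s t → iter ∇ k (λ n → s n + t n) ≗ λ n → iter ∇ k s n + iter ∇ k t n
  ∇^-+ zero    s t n = refl
  ∇^-+ (suc k) s t n = trans (∇-cong (∇^-+ k s t) n) (∇-+ (iter ∇ k s) (iter ∇ k t) n)

  ∇^-* : ∀ k c s → iter ∇ k (λ n → c * s n) ≗ λ n → c * iter ∇ k s n
  ∇^-* zero    c s n = refl
  ∇^-* (suc k) c s n = trans (∇-cong (∇^-* k c s) n) (∇-* c (iter ∇ k s) n)

  ∇^-0 : ∀ k → iter ∇ k (λ _ → 0ℤ) ≗ λ _ → 0ℤ
  ∇^-0 zero    n = refl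
  ∇^-0 (suc k) n = trans (∇-cong (∇^-0 k) n) (∇-0 n)

  ∇^-sum : ∀ k (s : A → ℕ → ℤ) xs →
           iter ∇ k (λ n → sumℤ (λ a → s a n) xs) ≗ λ n → sumℤ (λ a → iter ∇ k (s a) n) xs
  ∇^-sum k s []       n = ∇^-0 k n
  ∇^-sum k s (x ∷ xs) n = trans (∇^-+ k (s x) (λ n → sumℤ (λ a → s a n) xs) n)
                                (cong (λ w → iter ∇ k (s x) n + w) (∇^-sum k s xs n))

  coef : Poly ℤ → ℕ → ℤ
  coef []      n       = 0ℤ
  coef (a ∷ p) zero    = a
  coef (a ∷ p) (suc n) = coef p n

  coef-⊕ : ∀ p q n → coef (p ⊕ q) n ≡ coef p n + coef q n
  coef-⊕ []      q       n       = sym (ℤₚ.+-identityˡ (coef q n))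
  coef-⊕ (a ∷ p) []      n       = sym (ℤₚ.+-identityʳ (coef (a ∷ p) n))
  coef-⊕ (a ∷ p) (b ∷ q) zero    = refl
  coef-⊕ (a ∷ p) (b ∷ q) (suc n) = coef-⊕ p q n

  coef-map-* : ∀ c p n → coef (map (c *_) p) n ≡ c * coef p n
  coef-map-* c []      n       = sym (ℤₚ.*-zeroʳ c)
  coef-map-* c (a ∷ p) zero    = refl
  coef-map-* c (a ∷ p) (suc n) = coef-map-* c p n

  coef-1 : coef [ 1ℤ ] ≗ δ
  coef-1 zero    = refl
  coef-1 (suc n) = refl

  -- Polynomial counterparts of `shift` and `∇`. Their coefficients are computed directly, while
  -- products formed with `⊗` are reached only through values at z.
  mulX mul1-X : Poly ℤ → Poly ℤ
  mulX p   = 0ℤ ∷ p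
  mul1-X p = p ⊕ map (-1ℤ *_) (mulX p)

  coef-mulX : ∀ p → coef (mulX p) ≗ shift (coef p)
  coef-mulX p zero    = refl
  coef-mulX p (suc n) = refl

  coef-mul1-X : ∀ p → coef (mul1-X p) ≗ ∇ (coef p)
  coef-mul1-X p n = trans (coef-⊕ p (map (-1ℤ *_) (mulX p)) n)
    (cong (λ w → coef p n + w) (trans (coef-map-* -1ℤ (mulX p) n)
      (trans (ℤₚ.-1*i≡-i (coef (mulX p) n)) (cong ℤ.-_ (coef-mulX p n)))))

  coef-mulX^ : ∀ k p → coef (iter mulX k p) ≗ iter shift k (coef p)
  coef-mulX^ zero    p n = refl
  coef-mulX^ (suc k) p n = trans (coef-mulX (iter mulX k p) n) (shift-cong (coef-mulX^ k p) n)

  coef-mul1-X^ : ∀ k p → coef (iter mul1-X k p) ≗ iter ∇ k (coef p)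
  coef-mul1-X^ zero    p n = refl
  coef-mul1-X^ (suc k) p n = trans (coef-mul1-X (iter mul1-X k p) n) (∇-cong (coef-mul1-X^ k p) n)

  coef-polySum : ∀ (p : A → Poly ℤ) xs n → coef (foldr _⊕_ [] (map p xs)) n ≡ sumℤ (λ a → coef (p a) n) xs
  coef-polySum p []       n = refl
  coef-polySum p (x ∷ xs) n =
    trans (coef-⊕ (p x) (foldr _⊕_ [] (map p xs)) n) (cong (λ w → coef (p x) n + w) (coef-polySum p xs n))

  module _ (z : 𝔾) where
    open 𝔾Solver

    eval𝔾-zero : ∀ p → (∀ n → coef p n ≡ 0ℤ) → eval𝔾 p z ≡ 0𝔾
    eval𝔾-zero []      eq = refl
    eval𝔾-zero (a ∷ p) eq =
      trans (cong₂ (λ c w → fromℤ𝔾 c ⊞ z ⊠ w) (eq 0) (eval𝔾-zero p (λ n → eq (suc n))))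
            (trans (𝔾.+-identityˡ (z ⊠ 0𝔾)) (𝔾.zeroʳ z))

    -- Lists with equal coefficients may differ in trailing zeros, so they are identified only after
    -- evaluation.
    eval𝔾-cong : ∀ p q → coef p ≗ coef q → eval𝔾 p z ≡ eval𝔾 q z
    eval𝔾-cong []      q       eq = sym (eval𝔾-zero q (λ n → sym (eq n)))
    eval𝔾-cong (a ∷ p) []      eq = eval𝔾-zero (a ∷ p) eq
    eval𝔾-cong (a ∷ p) (b ∷ q) eq =
      cong₂ (λ c w → fromℤ𝔾 c ⊞ z ⊠ w) (eq 0) (eval𝔾-cong p q (λ n → eq (suc n)))

    eval𝔾-mul1-X : ∀ p → eval𝔾 (mul1-X p) z ≡ eval𝔾 1-X z ⊠ eval𝔾 p z
    eval𝔾-mul1-X p =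
      trans (eval𝔾-⊕ z p (map (-1ℤ *_) (mulX p)))
        (trans (cong (eval𝔾 p z ⊞_) (eval𝔾-map-* z -1ℤ (mulX p)))
          (trans (solve 2 (λ z p → p :+ con (⊟ 1𝔾) :* (con 0𝔾 :+ z :* p) := (con 1𝔾 :+ :- z) :* p) refl z (eval𝔾 p z))
            (cong (_⊠ eval𝔾 p z) (sym (eval𝔾-1-X z)))))

    eval𝔾-mulX : ∀ p → eval𝔾 (mulX p) z ≡ eval𝔾 X z ⊠ eval𝔾 p z
    eval𝔾-mulX p = trans (𝔾.+-identityˡ (z ⊠ eval𝔾 p z)) (cong (_⊠ eval𝔾 p z) (sym (eval𝔾-X z)))

    eval𝔾-1 : eval𝔾 [ 1ℤ ] z ≡ 1𝔾
    eval𝔾-1 = eval𝔾-const z 1ℤ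

    eval𝔾-mulX^ : ∀ k p → eval𝔾 (iter mulX k p) z ≡ eval𝔾 (X ^^ k) z ⊠ eval𝔾 p z
    eval𝔾-mulX^ zero    p = trans (sym (𝔾.*-identityˡ (eval𝔾 p z))) (cong (_⊠ eval𝔾 p z) (sym eval𝔾-1))
    eval𝔾-mulX^ (suc k) p = trans (eval𝔾-mulX (iter mulX k p))
      (trans (cong (eval𝔾 X z ⊠_) (eval𝔾-mulX^ k p))
        (trans (sym (𝔾.*-assoc (eval𝔾 X z) (eval𝔾 (X ^^ k) z) (eval𝔾 p z)))
          (cong (_⊠ eval𝔾 p z) (sym (eval𝔾-⊗ z X (X ^^ k))))))

    eval𝔾-mul1-X^ : ∀ k p → eval𝔾 (iter mul1-X k p) z ≡ eval𝔾 (1-X ^^ k) z ⊠ eval𝔾 p z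
    eval𝔾-mul1-X^ zero    p = trans (sym (𝔾.*-identityˡ (eval𝔾 p z))) (cong (_⊠ eval𝔾 p z) (sym eval𝔾-1))
    eval𝔾-mul1-X^ (suc k) p = trans (eval𝔾-mul1-X (iter mul1-X k p))
      (trans (cong (eval𝔾 1-X z ⊠_) (eval𝔾-mul1-X^ k p))
        (trans (sym (𝔾.*-assoc (eval𝔾 1-X z) (eval𝔾 (1-X ^^ k) z) (eval𝔾 p z)))
          (cong (_⊠ eval𝔾 p z) (sym (eval𝔾-⊗ z 1-X (1-X ^^ k))))))

  -- compositions k N is the number of ways to write N as an ordered sum of k positive
  -- integers, i.e. the coefficient of x^N in (x / (1 - x))^k.
  compositions : ℕ → ℕ → ℕ
  compositions zero    zero    = 1
  compositions zero    (suc N) = 0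
  compositions (suc k) zero    = 0
  compositions (suc k) (suc N) = compositions (suc k) N ℕ.+ compositions k N

  compositionsℤ : ℕ → ℕ → ℤ
  compositionsℤ k N = + compositions k N

  ∇-compositions : ∀ k → ∇ (compositionsℤ (suc k)) ≗ shift (compositionsℤ k)
  ∇-compositions k zero    = refl
  ∇-compositions k (suc N) =
    trans (cong (_- + compositions (suc k) N) (ℤₚ.pos-+ (compositions (suc k) N) (compositions k N)))
          (solve 2 (λ a b → (a :+ b) :- a := b) refl (+ compositions (suc k) N) (+ compositions k N))
    where open ℤSolver.+-*-Solver

  -- The identity (1 - x)^k (x / (1 - x))^k = x^k.
  ∇^-compositions : ∀ k → iter ∇ k (compositionsℤ k) ≗ iter shift k δ
  ∇^-compositions zero    zero    = refl
  ∇^-compositions zero    (suc N) = refl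
  ∇^-compositions (suc k) N =
    trans (cong (λ s → s N) (sym (∇^-∇ k (compositionsℤ (suc k)))))
      (trans (∇^-cong k (∇-compositions k) N)
        (trans (∇^-shift k (compositionsℤ k) N) (shift-cong (∇^-compositions k) N)))

  -- The body of `hPoly` with face counts and rank as free parameters; `hPoly K` unfolds to an
  -- instance of it.
  hForm : (ℕ → ℕ) → ℕ → Poly ℤ
  hForm f m = foldr _⊕_ [] (map (λ k → [ + f k ] ⊗ X ^^ k ⊗ 1-X ^^ (m ∸ k)) (upTo (suc m)))

  ∈upTo⇒≤ : ∀ m → All (_≤ m) (upTo (suc m))
  ∈upTo⇒≤ m = All.tabulate (λ k∈ → ℕₚ.≤-pred (∈-upTo⁻ k∈))

  hTerm : (ℕ → ℕ) → ℕ → ℕ → Poly ℤ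
  hTerm f m k = map (+ f k *_) (iter mul1-X (m ∸ k) (iter mulX k [ 1ℤ ]))

  eval𝔾-hForm : ∀ z f m → eval𝔾 (hForm f m) z ≡ eval𝔾 (foldr _⊕_ [] (map (hTerm f m) (upTo (suc m)))) z
  eval𝔾-hForm z f m = go (upTo (suc m))
    where
    open 𝔾Solver
    term : ∀ k → eval𝔾 ([ + f k ] ⊗ X ^^ k ⊗ 1-X ^^ (m ∸ k)) z ≡ eval𝔾 (hTerm f m k) z
    term k = trans (eval𝔾-⊗ z ([ + f k ] ⊗ X ^^ k) (1-X ^^ (m ∸ k)))
      (trans (cong (_⊠ eval𝔾 (1-X ^^ (m ∸ k)) z)
          (trans (eval𝔾-⊗ z [ + f k ] (X ^^ k)) (cong (_⊠ eval𝔾 (X ^^ k) z) (eval𝔾-const z (+ f k)))))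
      (trans (solve 3 (λ a x y → (a :* x) :* y := a :* (y :* (x :* con 1𝔾))) refl
               (fromℤ𝔾 (+ f k)) (eval𝔾 (X ^^ k) z) (eval𝔾 (1-X ^^ (m ∸ k)) z))
      (sym (trans (eval𝔾-map-* z (+ f k) (iter mul1-X (m ∸ k) (iter mulX k [ 1ℤ ])))
        (cong (fromℤ𝔾 (+ f k) ⊠_)
          (trans (eval𝔾-mul1-X^ z (m ∸ k) (iter mulX k [ 1ℤ ]))
            (cong (eval𝔾 (1-X ^^ (m ∸ k)) z ⊠_)
              (trans (eval𝔾-mulX^ z k [ 1ℤ ]) (cong (eval𝔾 (X ^^ k) z ⊠_) (eval𝔾-1 z))))))))))
    go : ∀ ks → eval𝔾 (foldr _⊕_ [] (map (λ k → [ + f k ] ⊗ X ^^ k ⊗ 1-X ^^ (m ∸ k)) ks)) z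
              ≡ eval𝔾 (foldr _⊕_ [] (map (hTerm f m) ks)) z
    go []       = refl
    go (k ∷ ks) = trans (eval𝔾-⊕ z ([ + f k ] ⊗ X ^^ k ⊗ 1-X ^^ (m ∸ k)) _)
      (trans (cong₂ _⊞_ (term k) (go ks)) (sym (eval𝔾-⊕ z (hTerm f m k) _)))

  -- Writing x^k as (1 - x)^k (x / (1 - x))^k raises the power of 1 - x from m - k to m. It no
  -- longer depends on k and can be taken out of the sum.
  coef-hTerm : ∀ f {m k} → k ≤ m → coef (hTerm f m k) ≗ iter ∇ m (λ N → + f k * compositionsℤ k N)
  coef-hTerm f {m} {k} k≤m N =
    trans (coef-map-* (+ f k) (iter mul1-X (m ∸ k) (iter mulX k [ 1ℤ ])) N)
    (trans (cong (+ f k *_) (begin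
      coef (iter mul1-X (m ∸ k) (iter mulX k [ 1ℤ ])) N      ≡⟨ coef-mul1-X^ (m ∸ k) (iter mulX k [ 1ℤ ]) N ⟩
      iter ∇ (m ∸ k) (coef (iter mulX k [ 1ℤ ])) N           ≡⟨ ∇^-cong (m ∸ k) (coef-mulX^ k [ 1ℤ ]) N ⟩
      iter ∇ (m ∸ k) (iter shift k (coef [ 1ℤ ])) N          ≡⟨ ∇^-cong (m ∸ k) (shift^-cong k coef-1) N ⟩
      iter ∇ (m ∸ k) (iter shift k δ) N                      ≡⟨ ∇^-cong (m ∸ k) (∇^-compositions k) N ⟨
      iter ∇ (m ∸ k) (iter ∇ k (compositionsℤ k)) N          ≡⟨ cong (λ s → s N) (iter-+ ∇ (m ∸ k) k (compositionsℤ k)) ⟨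
      iter ∇ (m ∸ k ℕ.+ k) (compositionsℤ k) N               ≡⟨ cong (λ l → iter ∇ l (compositionsℤ k) N) (ℕₚ.m∸n+n≡m k≤m) ⟩
      iter ∇ m (compositionsℤ k) N                           ∎))
    (sym (∇^-* m (+ f k) (compositionsℤ k) N)))
    where
    open ≡-Reasoning
    shift^-cong : ∀ k {s t} → s ≗ t → iter shift k s ≗ iter shift k t
    shift^-cong zero    eq = eq
    shift^-cong (suc k) eq = shift-cong (shift^-cong k eq)

  -- Σ_k f_k (x / (1 - x))^k as a power series, times (1 - x)^m.
  coef-hTerms : ∀ f m → coef (foldr _⊕_ [] (map (hTerm f m) (upTo (suc m))))
    ≗ iter ∇ m (λ N → sumℤ (λ k → + f k * compositionsℤ k N) (upTo (suc m)))
  coef-hTerms f m N =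
    trans (coef-polySum (hTerm f m) (upTo (suc m)) N)
      (trans (sumℤ-cong-All (All.map (λ k≤m → coef-hTerm f k≤m N) (∈upTo⇒≤ m)))
        (sym (∇^-sum m (λ k N → + f k * compositionsℤ k N) (upTo (suc m)) N)))

  -- latticeCount D M is the number of points of ℕ^D with coordinate sum M.
  latticeCount : ℕ → ℕ → ℕ
  latticeCount zero    zero    = 1
  latticeCount zero    (suc M) = 0
  latticeCount (suc D) zero    = latticeCount D zero
  latticeCount (suc D) (suc M) = latticeCount D (suc M) ℕ.+ latticeCount (suc D) M

  delay : ℕ → (ℕ → ℕ) → ℕ → ℕ
  delay zero    s M       = s M
  delay (suc i) s zero    = 0
  delay (suc i) s (suc M) = delay i s M

  delay-+ : ∀ a i s M → delay (a ℕ.+ i) s (a ℕ.+ M) ≡ delay i s M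
  delay-+ zero    i s M = refl
  delay-+ (suc a) i s M = delay-+ a i s M

  delay-latticeCount : ∀ D i M → delay i (latticeCount (suc D)) M
    ≡ delay i (latticeCount D) M ℕ.+ delay (suc i) (latticeCount (suc D)) M
  delay-latticeCount D zero    zero    = sym (ℕₚ.+-identityʳ (latticeCount D 0))
  delay-latticeCount D zero    (suc M) = refl
  delay-latticeCount D (suc i) zero    = refl
  delay-latticeCount D (suc i) (suc M) = delay-latticeCount D i M

  -- Telescoping of x^i / (1 - x)^(D+1) = x^i / (1 - x)^D + x^(i+1) / (1 - x)^(D+1), repeated k
  -- times.
  delay-latticeCount-range : ∀ D k i M → + delay i (latticeCount (suc D)) M
    ≡ sumℤ (λ j → + delay j (latticeCount D) M) (range i k) + + delay (k ℕ.+ i) (latticeCount (suc D)) M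
  delay-latticeCount-range D zero    i M = sym (ℤₚ.+-identityˡ _)
  delay-latticeCount-range D (suc k) i M =
    trans (cong +_ (delay-latticeCount D i M))
    (trans (ℤₚ.pos-+ (delay i (latticeCount D) M) (delay (suc i) (latticeCount (suc D)) M))
    (trans (cong (λ w → + delay i (latticeCount D) M + w) (delay-latticeCount-range D k (suc i) M))
    (trans (sym (ℤₚ.+-assoc (+ delay i (latticeCount D) M) (sumℤ (λ j → + delay j (latticeCount D) M) (range (suc i) k)) _))
      (cong (λ l → (+ delay i (latticeCount D) M + sumℤ (λ j → + delay j (latticeCount D) M) (range (suc i) k))
                   + + delay l (latticeCount (suc D)) M) (ℕₚ.+-suc k i)))))

  module HilbertSections (r-1 : ℕ) where
    open Sections r-1

    -- The Hilbert function of x^i / (1 - x)^D, sampled at the multiples of r.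
    hilbert : ℕ → ℕ → ℕ → ℤ
    hilbert D i N = + delay i (latticeCount D) (N ℕ.* r)

    -- On samples at the multiples of r, `∇` amounts to multiplication by 1 - x^r before sampling,
    -- which cancels the remainder of the telescoped sum of length r.
    ∇-hilbert : ∀ D i → ∇ (hilbert (suc D) i) ≗ λ N → sumℤ (λ j → hilbert D j N) (range i r)
    ∇-hilbert D i N =
      trans (cong₂ _-_ (delay-latticeCount-range D r i (N ℕ.* r)) (previous N))
        (solve 2 (λ a b → (a :+ b) :- b := a) refl
          (sumℤ (λ j → hilbert D j N) (range i r)) (+ delay (r ℕ.+ i) (latticeCount (suc D)) (N ℕ.* r)))
      where
      open ℤSolver.+-*-Solver
      previous : ∀ N → shift (hilbert (suc D) i) N ≡ + delay (r ℕ.+ i) (latticeCount (suc D)) (N ℕ.* r)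
      previous zero    = refl
      previous (suc N) = cong +_ (sym (delay-+ r i (latticeCount (suc D)) (N ℕ.* r)))

    -- The coefficient is 1 exactly when i = N r + c. The counter c is general because the recursion
    -- runs through all residues.
    coef-monomial : ∀ i c N → coef (monomial i c) N ≡ + delay i (latticeCount 0) (N ℕ.* r ℕ.+ c)
    coef-monomial zero    zero    zero    = refl
    coef-monomial zero    zero    (suc N) = refl
    coef-monomial zero    (suc c) N       =
      cong (λ M → + latticeCount 0 M) (sym (ℕₚ.+-suc (N ℕ.* r) c))
    coef-monomial (suc i) (suc c) N       =
      trans (coef-monomial i c N) (cong (λ M → + delay (suc i) (latticeCount 0) M) (sym (ℕₚ.+-suc (N ℕ.* r) c)))
    coef-monomial (suc i) zero    zero    = refl
    coef-monomial (suc i) zero    (suc N) =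
      trans (coef-monomial i r-1 N)
        (cong (λ M → + delay i (latticeCount 0) M)
          (trans (ℕₚ.+-comm (N ℕ.* r) r-1) (sym (ℕₚ.+-identityʳ (r-1 ℕ.+ N ℕ.* r)))))

    -- Each factor 1 - x lowers D by one and replaces an index by its window of length r, which is
    -- the recursion of `section`.
    coef-section : ∀ D i → coef (section D i) ≗ iter ∇ D (hilbert D i)
    coef-section zero    i N = trans (coef-monomial i 0 N)
      (cong (λ M → + delay i (latticeCount 0) M) (ℕₚ.+-identityʳ (N ℕ.* r)))
    coef-section (suc D) i N = begin
      coef (section (suc D) i) N                                      ≡⟨ coef-polySum (section D) (range i r) N ⟩
      sumℤ (λ j → coef (section D j) N) (range i r)                   ≡⟨ sumℤ-cong (λ j → coef-section D j N) (range i r) ⟩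
      sumℤ (λ j → iter ∇ D (hilbert D j) N) (range i r)               ≡⟨ ∇^-sum D (hilbert D) (range i r) N ⟨
      iter ∇ D (λ N → sumℤ (λ j → hilbert D j N) (range i r)) N       ≡⟨ ∇^-cong D (∇-hilbert D i) N ⟨
      iter ∇ D (∇ (hilbert (suc D) i)) N                              ≡⟨ cong (λ s → s N) (∇^-∇ D (hilbert (suc D) i)) ⟩
      iter ∇ (suc D) (hilbert (suc D) i) N                            ∎
      where open ≡-Reasoning

    -- With g the common power series, the left polynomial is (1 - x)^m g and the sum of sections is
    -- (1 - x)^D g. Multiplying across avoids any relation between m and D.
    hForm-sections : ∀ f m D is →
      (∀ N → sumℤ (λ k → + f k * compositionsℤ k N) (upTo (suc m)) ≡ sumℤ (λ i → hilbert D i N) is) →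
      ∀ z → eval𝔾 (1-X ^^ D) z ⊠ eval𝔾 (hForm f m) z ≡ eval𝔾 (1-X ^^ m) z ⊠ Σ𝔾 (V z D) is
    hForm-sections f m D is eq z = begin
      eval𝔾 (1-X ^^ D) z ⊠ eval𝔾 (hForm f m) z  ≡⟨ cong (eval𝔾 (1-X ^^ D) z ⊠_) (eval𝔾-hForm z f m) ⟩
      eval𝔾 (1-X ^^ D) z ⊠ eval𝔾 Q z            ≡⟨ eval𝔾-mul1-X^ z D Q ⟨
      eval𝔾 (iter mul1-X D Q) z                  ≡⟨ eval𝔾-cong z (iter mul1-X D Q) (iter mul1-X m P) same-coef ⟩
      eval𝔾 (iter mul1-X m P) z                  ≡⟨ eval𝔾-mul1-X^ z m P ⟩
      eval𝔾 (1-X ^^ m) z ⊠ eval𝔾 P z            ≡⟨ cong (eval𝔾 (1-X ^^ m) z ⊠_) (eval𝔾-polySum (section D) is z) ⟩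
      eval𝔾 (1-X ^^ m) z ⊠ Σ𝔾 (V z D) is        ∎
      where
      open ≡-Reasoning
      Q = foldr _⊕_ [] (map (hTerm f m) (upTo (suc m)))
      P = polySum (map (section D) is)
      g : ℕ → ℤ
      g N = sumℤ (λ k → + f k * compositionsℤ k N) (upTo (suc m))
      same-coef : coef (iter mul1-X D Q) ≗ coef (iter mul1-X m P)
      same-coef N = begin
        coef (iter mul1-X D Q) N                              ≡⟨ coef-mul1-X^ D Q N ⟩
        iter ∇ D (coef Q) N                                   ≡⟨ ∇^-cong D (coef-hTerms f m) N ⟩
        iter ∇ D (iter ∇ m g) N                               ≡⟨ cong (λ s → s N) (∇^-comm D m g) ⟩
        iter ∇ m (iter ∇ D g) N                               ≡⟨ ∇^-cong m (∇^-cong D eq) N ⟩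
        iter ∇ m (iter ∇ D (λ N → sumℤ (λ i → hilbert D i N) is)) N
          ≡⟨ ∇^-cong m (λ N → trans (∇^-sum D (hilbert D) is N) (sumℤ-cong (λ i → sym (coef-section D i N)) is)) N ⟩
        iter ∇ m (λ N → sumℤ (λ i → coef (section D i) N) is) N  ≡⟨ ∇^-cong m (coef-polySum (section D) is) N ⟨
        iter ∇ m (coef P) N                                   ≡⟨ coef-mul1-X^ m P N ⟨
        coef (iter mul1-X m P) N                              ∎

-- Face numbers as counts of multisets supported on faces.

module FaceCounting where

  open HilbertSeries
  open import Data.Fin.Subset using (Subset; inside; outside; ∣_∣)
  open import Data.Nat as ℕ using (ℕ; zero; suc; _≤_; _⊔_; s≤s)
  import Data.Nat.Properties as ℕₚ
  open import Data.Integer using (ℤ; 0ℤ; 1ℤ; +_; _+_; _*_)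
  import Data.Integer.Properties as ℤₚ
  import Data.Integer.Solver as ℤSolver
  open import Data.List using (List; map; []; _∷_; _++_; filter; length; foldr; upTo)
  open import Data.List.Membership.Propositional using (_∈_)
  open import Data.List.Membership.Propositional.Properties using (∈-upTo⁺)
  open import Data.List.Relation.Unary.All as All using (All; []; _∷_)
  open import Data.List.Relation.Unary.Any using (here; there)
  open import Data.List.Relation.Unary.AllPairs using (_∷_)
  open import Data.List.Relation.Unary.Unique.Propositional using (Unique)
  import Data.List.Relation.Unary.Unique.Propositional.Properties as Uniqueₚ
  open import Data.Vec using (Vec; []; _∷_)
  open import Function using (_∘_)
  open import Relation.Binary.PropositionalEquality hiding ([_])
  open import Relation.Nullary using (Dec; yes; no)
  open import Relation.Unary using (Decidable)
  open import Data.Empty using (⊥-elim)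

  private variable
    A B : Set

  sumℤ-map : ∀ (f : B → ℤ) (g : A → B) xs → sumℤ f (map g xs) ≡ sumℤ (f ∘ g) xs
  sumℤ-map f g []       = refl
  sumℤ-map f g (x ∷ xs) = cong (λ w → f (g x) + w) (sumℤ-map f g xs)

  sumℤ-++ : ∀ (f : A → ℤ) xs ys → sumℤ f (xs ++ ys) ≡ sumℤ f xs + sumℤ f ys
  sumℤ-++ f []       ys = sym (ℤₚ.+-identityˡ _)
  sumℤ-++ f (x ∷ xs) ys = trans (cong (λ w → f x + w) (sumℤ-++ f xs ys)) (sym (ℤₚ.+-assoc (f x) (sumℤ f xs) (sumℤ f ys)))

  sumℤ-0 : ∀ (xs : List A) → sumℤ (λ _ → 0ℤ) xs ≡ 0ℤ
  sumℤ-0 []       = refl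
  sumℤ-0 (x ∷ xs) = trans (ℤₚ.+-identityˡ _) (sumℤ-0 xs)

  sumℤ-zero : ∀ {f : A → ℤ} → (∀ a → f a ≡ 0ℤ) → ∀ xs → sumℤ f xs ≡ 0ℤ
  sumℤ-zero f≡0 xs = trans (sumℤ-cong f≡0 xs) (sumℤ-0 xs)

  sumℤ-+ : ∀ (f g : A → ℤ) xs → sumℤ (λ a → f a + g a) xs ≡ sumℤ f xs + sumℤ g xs
  sumℤ-+ f g []       = refl
  sumℤ-+ f g (x ∷ xs) = trans (cong (λ w → (f x + g x) + w) (sumℤ-+ f g xs))
    (solve 4 (λ a b c d → (a :+ b) :+ (c :+ d) := (a :+ c) :+ (b :+ d)) refl (f x) (g x) (sumℤ f xs) (sumℤ g xs))
    where open ℤSolver.+-*-Solver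

  sumℤ-swap : ∀ (f : A → B → ℤ) xs ys →
              sumℤ (λ a → sumℤ (f a) ys) xs ≡ sumℤ (λ b → sumℤ (λ a → f a b) xs) ys
  sumℤ-swap f []       ys = sym (sumℤ-0 ys)
  sumℤ-swap f (x ∷ xs) ys =
    trans (cong (λ w → sumℤ (f x) ys + w) (sumℤ-swap f xs ys))
          (sym (sumℤ-+ (f x) (λ b → sumℤ (λ a → f a b) xs) ys))

  indicator : ∀ {P : Set} → Dec P → ℤ
  indicator (yes _) = 1ℤ
  indicator (no  _) = 0ℤ

  indicator-⇔ : ∀ {P Q : Set} (p? : Dec P) (q? : Dec Q) → (P → Q) → (Q → P) → indicator p? ≡ indicator q?
  indicator-⇔ (yes p) (yes q) f g = refl
  indicator-⇔ (yes p) (no ¬q) f g = ⊥-elim (¬q (f p))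
  indicator-⇔ (no ¬p) (yes q) f g = ⊥-elim (¬p (g q))
  indicator-⇔ (no ¬p) (no ¬q) f g = refl

  module _ {P : A → Set} (P? : Decidable P) where

    length-filter-∷ : ∀ x xs → + length (filter P? (x ∷ xs)) ≡ indicator (P? x) + + length (filter P? xs)
    length-filter-∷ x xs with P? x
    ... | yes _ = ℤₚ.pos-+ 1 (length (filter P? xs))
    ... | no  _ = sym (ℤₚ.+-identityˡ _)

    length-filter : ∀ xs → + length (filter P? xs) ≡ sumℤ (λ x → indicator (P? x)) xs
    length-filter []       = refl
    length-filter (x ∷ xs) = trans (length-filter-∷ x xs) (cong (λ w → indicator (P? x) + w) (length-filter xs))

    sumℤ-filter : ∀ f xs → sumℤ f (filter P? xs) ≡ sumℤ (λ x → indicator (P? x) * f x) xs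
    sumℤ-filter f []       = refl
    sumℤ-filter f (x ∷ xs) with P? x
    ... | yes _ = cong₂ _+_ (sym (ℤₚ.*-identityˡ (f x))) (sumℤ-filter f xs)
    ... | no  _ = trans (sumℤ-filter f xs) (sym (trans (cong (λ w → w + sumℤ (λ x → indicator (P? x) * f x) xs) (ℤₚ.*-zeroˡ (f x)))
                                                     (ℤₚ.+-identityˡ _)))

  sumℤ-indicator-≟ : ∀ (c : ℕ → ℤ) j {ks} → Unique ks → j ∈ ks → sumℤ (λ k → indicator (j ℕ.≟ k) * c k) ks ≡ c j
  sumℤ-indicator-≟ c j {k ∷ ks} (k∉ks ∷ _) (here refl) with k ℕ.≟ k
  ... | no  k≢k = ⊥-elim (k≢k refl)
  ... | yes _   = trans (cong₂ _+_ (ℤₚ.*-identityˡ (c k))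
      (trans (sumℤ-cong-All (All.map (λ {l} k≢l → rest l k≢l) k∉ks)) (sumℤ-0 ks)))
    (ℤₚ.+-identityʳ (c k))
    where
    rest : ∀ l → k ≢ l → indicator (k ℕ.≟ l) * c l ≡ 0ℤ
    rest l k≢l with k ℕ.≟ l
    ... | yes k≡l = ⊥-elim (k≢l k≡l)
    ... | no  _   = ℤₚ.*-zeroˡ (c l)
  sumℤ-indicator-≟ c j {k ∷ ks} (k∉ks ∷ u) (there j∈) with j ℕ.≟ k
  ... | yes refl = ⊥-elim (All.lookup k∉ks j∈ refl)
  ... | no  _    = trans (cong₂ _+_ (ℤₚ.*-zeroˡ (c k)) (sumℤ-indicator-≟ c j u j∈)) (ℤₚ.+-identityˡ (c j))

  sumℤ-by-size : ∀ {n} (c : ℕ → ℤ) m (L : List (Subset n)) → All (λ S → ∣ S ∣ ≤ m) L →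
    sumℤ (λ k → + length (filter (λ S → ∣ S ∣ ℕ.≟ k) L) * c k) (upTo (suc m)) ≡ sumℤ (λ S → c ∣ S ∣) L
  sumℤ-by-size c m []      []         = trans (sumℤ-cong (λ k → ℤₚ.*-zeroˡ (c k)) (upTo (suc m))) (sumℤ-0 (upTo (suc m)))
  sumℤ-by-size c m (S ∷ L) (S≤m ∷ L≤m) =
    trans (sumℤ-cong (λ k → trans (cong (_* c k) (length-filter-∷ (λ S → ∣ S ∣ ℕ.≟ k) S L))
                                 (ℤₚ.*-distribʳ-+ (c k) (indicator (∣ S ∣ ℕ.≟ k)) _)) (upTo (suc m)))
    (trans (sumℤ-+ (λ k → indicator (∣ S ∣ ℕ.≟ k) * c k) (λ k → + length (filter (λ S → ∣ S ∣ ℕ.≟ k) L) * c k) (upTo (suc m)))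
      (cong₂ _+_ (sumℤ-indicator-≟ c ∣ S ∣ (Uniqueₚ.upTo⁺ (suc m)) (∈-upTo⁺ (s≤s S≤m))) (sumℤ-by-size c m L L≤m)))

  all≤foldr-⊔ : ∀ (f : A → ℕ) xs → All (λ x → f x ≤ foldr _⊔_ 0 (map f xs)) xs
  all≤foldr-⊔ f []       = []
  all≤foldr-⊔ f (x ∷ xs) = ℕₚ.m≤m⊔n (f x) _ ∷ All.map (λ fy≤ → ℕₚ.≤-trans fy≤ (ℕₚ.m≤n⊔m (f x) _)) (all≤foldr-⊔ f xs)

  module _ {n} (f : Vec ℕ (suc n) → ℤ) where

    sumℤ-latticePoints-zero : sumℤ f (latticePoints (suc n) 0) ≡ sumℤ (λ y → f (0 ∷ y)) (latticePoints n 0)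
    sumℤ-latticePoints-zero = sumℤ-map f (0 ∷_) (latticePoints n 0)

    sumℤ-latticePoints-suc : ∀ N → sumℤ f (latticePoints (suc n) (suc N))
      ≡ sumℤ (λ y → f (0 ∷ y)) (latticePoints n (suc N)) + sumℤ (λ w → f (incHead w)) (latticePoints (suc n) N)
    sumℤ-latticePoints-suc N =
      trans (sumℤ-++ f (map (0 ∷_) (latticePoints n (suc N))) (map incHead (latticePoints (suc n) N)))
        (cong₂ _+_ (sumℤ-map f (0 ∷_) (latticePoints n (suc N))) (sumℤ-map f incHead (latticePoints (suc n) N)))

  -- Both sides count multisets of size N: a multiset is its support S together with
  -- positive multiplicities on S, and it is also its vector of multiplicities.
  sumℤ-subsets : ∀ n (φ : Subset n → ℤ) N →
    sumℤ (λ S → φ S * compositionsℤ ∣ S ∣ N) (allSubsets n) ≡ sumℤ (λ v → φ (supp v)) (latticePoints n N)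

  -- The part in which the first element occurs, with one copy of it set aside. The recursion of
  -- `compositions` distinguishes whether further copies remain.
  sumℤ-subsets-inside : ∀ n (φ : Subset (suc n) → ℤ) N →
    sumℤ (λ S → φ (inside ∷ S) * compositionsℤ (suc ∣ S ∣) (suc N)) (allSubsets n)
    ≡ sumℤ (λ v → φ (supp (incHead v))) (latticePoints (suc n) N)

  sumℤ-subsets-split : ∀ n (φ : Subset (suc n) → ℤ) N →
    sumℤ (λ S → φ S * compositionsℤ ∣ S ∣ N) (allSubsets (suc n))
    ≡ sumℤ (λ S → φ (inside ∷ S) * compositionsℤ (suc ∣ S ∣) N) (allSubsets n)
      + sumℤ (λ v → φ (outside ∷ supp v)) (latticePoints n N)
  sumℤ-subsets-split n φ N = trans (sumℤ-++ _ (map (inside ∷_) (allSubsets n)) (map (outside ∷_) (allSubsets n)))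
    (cong₂ _+_ (sumℤ-map _ (inside ∷_) (allSubsets n))
      (trans (sumℤ-map _ (outside ∷_) (allSubsets n)) (sumℤ-subsets n (λ S → φ (outside ∷ S)) N)))

  sumℤ-subsets zero φ zero    = cong (_+ 0ℤ) (ℤₚ.*-identityʳ (φ []))
  sumℤ-subsets zero φ (suc N) = cong (_+ 0ℤ) (ℤₚ.*-zeroʳ (φ []))
  sumℤ-subsets (suc n) φ zero =
    trans (sumℤ-subsets-split n φ 0)
    (trans (cong₂ _+_ (sumℤ-zero (λ S → ℤₚ.*-zeroʳ (φ (inside ∷ S))) (allSubsets n))
                      (sym (sumℤ-latticePoints-zero (λ v → φ (supp v)))))
      (ℤₚ.+-identityˡ _))
  sumℤ-subsets (suc n) φ (suc N) =
    trans (sumℤ-subsets-split n φ (suc N))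
    (trans (ℤₚ.+-comm _ (sumℤ (λ v → φ (outside ∷ supp v)) (latticePoints n (suc N))))
    (trans (cong (λ w → sumℤ (λ v → φ (outside ∷ supp v)) (latticePoints n (suc N)) + w) (sumℤ-subsets-inside n φ N))
      (sym (sumℤ-latticePoints-suc (λ v → φ (supp v)) N))))

  sumℤ-subsets-inside n φ zero =
    trans (sumℤ-subsets n (λ S → φ (inside ∷ S)) 0) (sym (sumℤ-latticePoints-zero (λ v → φ (supp (incHead v)))))
  sumℤ-subsets-inside n φ (suc N) = begin
    sumℤ (λ S → φ (inside ∷ S) * + (compositions (suc ∣ S ∣) (suc N) ℕ.+ compositions ∣ S ∣ (suc N))) (allSubsets n)
      ≡⟨ sumℤ-cong (λ S → trans (cong (φ (inside ∷ S) *_) (ℤₚ.pos-+ (compositions (suc ∣ S ∣) (suc N)) (compositions ∣ S ∣ (suc N))))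
           (ℤₚ.*-distribˡ-+ (φ (inside ∷ S)) (compositionsℤ (suc ∣ S ∣) (suc N)) (compositionsℤ ∣ S ∣ (suc N)))) (allSubsets n) ⟩
    sumℤ (λ S → φ (inside ∷ S) * compositionsℤ (suc ∣ S ∣) (suc N) + φ (inside ∷ S) * compositionsℤ ∣ S ∣ (suc N)) (allSubsets n)
      ≡⟨ sumℤ-+ (λ S → φ (inside ∷ S) * compositionsℤ (suc ∣ S ∣) (suc N)) (λ S → φ (inside ∷ S) * compositionsℤ ∣ S ∣ (suc N)) (allSubsets n) ⟩
    sumℤ (λ S → φ (inside ∷ S) * compositionsℤ (suc ∣ S ∣) (suc N)) (allSubsets n)
      + sumℤ (λ S → φ (inside ∷ S) * compositionsℤ ∣ S ∣ (suc N)) (allSubsets n)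
      ≡⟨ cong₂ _+_ (sumℤ-subsets-inside n φ N) (sumℤ-subsets n (λ S → φ (inside ∷ S)) (suc N)) ⟩
    sumℤ (λ v → φ (supp (incHead v))) (latticePoints (suc n) N) + sumℤ (λ v → φ (inside ∷ supp v)) (latticePoints n (suc N))
      ≡⟨ ℤₚ.+-comm _ (sumℤ (λ v → φ (inside ∷ supp v)) (latticePoints n (suc N))) ⟩
    sumℤ (λ v → φ (inside ∷ supp v)) (latticePoints n (suc N)) + sumℤ (λ v → φ (supp (incHead v))) (latticePoints (suc n) N)
      -- A second copy of the first element does not change the support.
      ≡⟨ cong (λ w → sumℤ (λ v → φ (inside ∷ supp v)) (latticePoints n (suc N)) + w)
           (sumℤ-cong (λ { (_ ∷ _) → refl }) (latticePoints (suc n) N)) ⟩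
    sumℤ (λ v → φ (inside ∷ supp v)) (latticePoints n (suc N)) + sumℤ (λ v → φ (supp (incHead (incHead v)))) (latticePoints (suc n) N)
      ≡⟨ sumℤ-latticePoints-suc (λ v → φ (supp (incHead v))) N ⟨
    sumℤ (λ v → φ (supp (incHead v))) (latticePoints (suc n) (suc N)) ∎
    where open ≡-Reasoning

  -- The series f(K; x / (1 - x)) is the Hilbert series of the Stanley-Reisner ring of K: a monomial
  -- is nonzero there when its support is a face.
  faceCounts-latticePoints : ∀ {n} (K : SimplicialComplex n) N →
    sumℤ (λ k → + faceCount K k * compositionsℤ k N) (upTo (suc (rank K)))
    ≡ sumℤ (λ v → indicator (isFace? K (supp v))) (latticePoints n N)
  faceCounts-latticePoints {n} K N =
    trans (sumℤ-by-size (λ k → compositionsℤ k N) (rank K) (faces K) (all≤foldr-⊔ ∣_∣ (faces K)))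
    (trans (sumℤ-filter (isFace? K) (λ S → compositionsℤ ∣ S ∣ N) (allSubsets n))
      (sumℤ-subsets n (λ S → indicator (isFace? K S)) N))

-- Multisets of lattice points and uniqueness of their decomposition into chains.

module Multichains where

  open import Data.Empty using (⊥-elim)
  open import Data.Fin using (Fin; zero; suc)
  open import Data.Fin.Subset using (Subset; inside; outside; _∈_; _∉_; _⊆_)
  open import Data.Integer using (_⊖_; 0ℤ; 1ℤ)
  import Data.Integer.Properties as ℤₚ
  open import Data.List using (List; []; _∷_; length; lookup)
  open import Data.List.Membership.Propositional.Properties using (∈-lookup)
  open import Data.List.Relation.Unary.All as All using (All; []; _∷_)
  open import Data.List.Relation.Unary.AllPairs using (_∷_)
  open import Data.List.Relation.Unary.Unique.Propositional using (Unique)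
  open import Data.Nat
  open import Data.Nat.Properties
  open import Algebra.Properties.CommutativeSemigroup +-commutativeSemigroup using (interchange)
  open import Data.Product using (_×_; _,_; proj₁; proj₂; ∃-syntax)
  open import Data.Sum using (_⊎_; inj₁; inj₂)
  import Data.Sum as Sum
  open import Data.Vec as Vec using (Vec; []; _∷_; here; there; replicate; zipWith)
  open import Data.Vec.Properties using (zipWith-assoc; zipWith-comm; zipWith-identityˡ)
  open import Relation.Binary.PropositionalEquality hiding ([_])
  open import Relation.Nullary using (yes; no)

  private variable
    n : ℕ

  0v : Vec ℕ n
  0v = replicate _ 0

  infixl 6 _+v_

  _+v_ : Vec ℕ n → Vec ℕ n → Vec ℕ n
  _+v_ = zipWith _+_

  +v-assoc : (x y z : Vec ℕ n) → (x +v y) +v z ≡ x +v (y +v z)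
  +v-assoc = zipWith-assoc +-assoc

  +v-comm : (x y : Vec ℕ n) → x +v y ≡ y +v x
  +v-comm = zipWith-comm +-comm

  +v-identityˡ : (x : Vec ℕ n) → 0v +v x ≡ x
  +v-identityˡ = zipWith-identityˡ +-identityˡ

  ι-+v : (x y : Vec ℕ n) → ∀ k → ι (x +v y) k ≡ ι x k + ι y k
  ι-+v (a ∷ x) (b ∷ y) zero    = refl
  ι-+v (a ∷ x) (b ∷ y) (suc k) = trans (cong (a + b +_) (ι-+v x y k)) (interchange a b (ι x k) (ι y k))

  ι-0v : ∀ (k : Fin n) → ι 0v k ≡ 0
  ι-0v zero    = refl
  ι-0v (suc k) = ι-0v k

  ι-injective : (x y : Vec ℕ n) → (∀ k → ι x k ≡ ι y k) → x ≡ y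
  ι-injective []      []      eq = refl
  ι-injective (a ∷ x) (b ∷ y) eq with eq zero
  ... | refl = cong (a ∷_) (ι-injective x y (λ k → +-cancelˡ-≡ a (ι x k) (ι y k) (eq (suc k))))

  +v-cancelˡ : (x y z : Vec ℕ n) → x +v y ≡ x +v z → y ≡ z
  +v-cancelˡ []      []      []      eq = refl
  +v-cancelˡ (a ∷ x) (b ∷ y) (c ∷ z) eq =
    cong₂ _∷_ (+-cancelˡ-≡ a b c (cong Vec.head eq)) (+v-cancelˡ x y z (cong Vec.tail eq))

  sum-+v : (x y : Vec ℕ n) → Vec.sum (x +v y) ≡ Vec.sum x + Vec.sum y
  sum-+v []      []      = refl
  sum-+v (a ∷ x) (b ∷ y) = trans (cong (a + b +_) (sum-+v x y)) (interchange a b (Vec.sum x) (Vec.sum y))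

  sum-0v : ∀ n → Vec.sum (0v {n}) ≡ 0
  sum-0v zero    = refl
  sum-0v (suc n) = sum-0v n

  sum≡0⇒0v : (x : Vec ℕ n) → Vec.sum x ≡ 0 → x ≡ 0v
  sum≡0⇒0v []         eq = refl
  sum≡0⇒0v (zero ∷ x) eq = cong (0 ∷_) (sum≡0⇒0v x eq)

  ∉supp-0v : ∀ {k : Fin n} → k ∉ supp 0v
  ∉supp-0v (there k∈) = ∉supp-0v k∈

  ∈supp-+v⁻ : (x y : Vec ℕ n) → ∀ {k} → k ∈ supp (x +v y) → k ∈ supp x ⊎ k ∈ supp y
  ∈supp-+v⁻ (zero  ∷ x) (suc b ∷ y) here       = inj₂ here
  ∈supp-+v⁻ (suc a ∷ x) (b ∷ y)     here       = inj₁ here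
  ∈supp-+v⁻ (a ∷ x)     (b ∷ y)     (there k∈) = Sum.map there there (∈supp-+v⁻ x y k∈)

  inc : Fin n → Vec ℕ n → Vec ℕ n
  inc zero    (c ∷ v) = suc c ∷ v
  inc (suc i) (c ∷ v) = c ∷ inc i v

  sum-inc : ∀ (i : Fin n) v → Vec.sum (inc i v) ≡ suc (Vec.sum v)
  sum-inc zero    (c ∷ v) = refl
  sum-inc (suc i) (c ∷ v) = trans (cong (c +_) (sum-inc i v)) (+-suc c (Vec.sum v))

  ∈supp-inc : ∀ (i : Fin n) v → i ∈ supp (inc i v)
  ∈supp-inc zero    (c ∷ v) = here
  ∈supp-inc (suc i) (c ∷ v) = there (∈supp-inc i v)

  supp⊆supp-inc : ∀ (i : Fin n) v → supp v ⊆ supp (inc i v)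
  supp⊆supp-inc zero    (suc c ∷ v) here       = here
  supp⊆supp-inc zero    (c ∷ v)     (there j∈) = there j∈
  supp⊆supp-inc (suc i) (suc c ∷ v) here       = here
  supp⊆supp-inc (suc i) (c ∷ v)     (there j∈) = there (supp⊆supp-inc i v j∈)

  ∈supp-inc⁻ : ∀ (i : Fin n) v {j} → j ∈ supp (inc i v) → j ≡ i ⊎ j ∈ supp v
  ∈supp-inc⁻ zero    (c ∷ v)     here       = inj₁ refl
  ∈supp-inc⁻ zero    (c ∷ v)     (there j∈) = inj₂ (there j∈)
  ∈supp-inc⁻ (suc i) (suc c ∷ v) here       = inj₂ here
  ∈supp-inc⁻ (suc i) (c ∷ v)     (there j∈) = Sum.map (cong suc) there (∈supp-inc⁻ i v j∈)

  ∈supp⇒inc : ∀ (v : Vec ℕ n) {i} → i ∈ supp v → ∃[ w ] v ≡ inc i w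
  ∈supp⇒inc (suc c ∷ v) here       = c ∷ v , refl
  ∈supp⇒inc (c ∷ v)     (there i∈) with ∈supp⇒inc v i∈
  ... | w , refl = c ∷ w , refl

  sum≡suc⇒inc : ∀ (v : Vec ℕ n) {N} → Vec.sum v ≡ suc N → ∃[ i ] ∃[ w ] v ≡ inc i w
  sum≡suc⇒inc (suc c ∷ v) eq = zero , c ∷ v , refl
  sum≡suc⇒inc (zero ∷ v)  eq with sum≡suc⇒inc v eq
  ... | i , w , refl = suc i , 0 ∷ w , refl

  multiset-induction : (P : Vec ℕ n → Set) → P 0v → (∀ i v → P v → P (inc i v)) → ∀ v → P v
  multiset-induction P P0 Pinc v = go (Vec.sum v) v refl
    where
    go : ∀ N v → Vec.sum v ≡ N → P v
    go zero    v eq = subst P (sym (sum≡0⇒0v v eq)) P0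
    go (suc N) v eq with sum≡suc⇒inc v eq
    ... | i , w , refl = Pinc i w (go N w (suc-injective (trans (sym (sum-inc i w)) eq)))

  scale : ℕ → Vec ℕ n → Vec ℕ n
  scale zero    p = 0v
  scale (suc c) p = p +v scale c p

  -- A vector v of multiplicities on a list L of points is a multiset of points;
  -- combine L v is the sum of its members.
  combine : (L : List (Vec ℕ n)) → Vec ℕ (length L) → Vec ℕ n
  combine []      []      = 0v
  combine (p ∷ L) (c ∷ v) = scale c p +v combine L v

  combine-0v : (L : List (Vec ℕ n)) → combine L 0v ≡ 0v
  combine-0v []      = refl
  combine-0v (p ∷ L) = trans (+v-identityˡ (combine L 0v)) (combine-0v L)

  combine-inc : (L : List (Vec ℕ n)) → ∀ i v → combine L (inc i v) ≡ lookup L i +v combine L v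
  combine-inc (p ∷ L) zero    (c ∷ v) = +v-assoc p (scale c p) (combine L v)
  combine-inc (p ∷ L) (suc i) (c ∷ v) =
    trans (cong (scale c p +v_) (combine-inc L i v))
      (trans (sym (+v-assoc (scale c p) (lookup L i) (combine L v)))
        (trans (cong (_+v combine L v) (+v-comm (scale c p) (lookup L i)))
          (+v-assoc (lookup L i) (scale c p) (combine L v))))

  ι-combine-inc : (L : List (Vec ℕ n)) → ∀ i v k → ι (combine L (inc i v)) k ≡ ι (lookup L i) k + ι (combine L v) k
  ι-combine-inc L i v k = trans (cong (λ x → ι x k) (combine-inc L i v)) (ι-+v (lookup L i) (combine L v) k)

  ι-combine-0v : (L : List (Vec ℕ n)) → ∀ k → ι (combine L 0v) k ≡ 0
  ι-combine-0v L k = trans (cong (λ x → ι x k) (combine-0v L)) (ι-0v k)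

  lookup-injective : ∀ {A : Set} {xs : List A} → Unique xs → ∀ i j → lookup xs i ≡ lookup xs j → i ≡ j
  lookup-injective (x∉ ∷ u) zero    zero    eq = refl
  lookup-injective (x∉ ∷ u) zero    (suc j) eq = ⊥-elim (All.lookup x∉ (∈-lookup j) eq)
  lookup-injective (x∉ ∷ u) (suc i) zero    eq = ⊥-elim (All.lookup x∉ (∈-lookup i) (sym eq))
  lookup-injective (x∉ ∷ u) (suc i) (suc j) eq = cong suc (lookup-injective u i j eq)

  m⊖n≡0⇒m≡n : ∀ m n → m ⊖ n ≡ 0ℤ → m ≡ n
  m⊖n≡0⇒m≡n zero    zero    eq = refl
  m⊖n≡0⇒m≡n (suc m) (suc n) eq = cong suc (m⊖n≡0⇒m≡n m n (trans (sym (ℤₚ.[1+m]⊖[1+n]≡m⊖n m n)) eq))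

  m⊖n≡1⇒m≡1+n : ∀ m n → m ⊖ n ≡ 1ℤ → m ≡ suc n
  m⊖n≡1⇒m≡1+n (suc zero) zero    eq = refl
  m⊖n≡1⇒m≡1+n (suc m)    (suc n) eq = cong suc (m⊖n≡1⇒m≡1+n m n (trans (sym (ℤₚ.[1+m]⊖[1+n]≡m⊖n m n)) eq))

  [1+n]⊖n≡1 : ∀ n → suc n ⊖ n ≡ 1ℤ
  [1+n]⊖n≡1 zero    = refl
  [1+n]⊖n≡1 (suc n) = trans (ℤₚ.[1+m]⊖[1+n]≡m⊖n (suc n) n) ([1+n]⊖n≡1 n)

  EqualOrSucc : ℕ → ℕ → Set
  EqualOrSucc a b = a ≡ b ⊎ a ≡ suc b

  infix 4 _⊒_

  -- Compares all n partial sums, which frees the relation from the facet F in `ι-Diff01`.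
  _⊒_ : Vec ℕ n → Vec ℕ n → Set
  x ⊒ y = ∀ k → EqualOrSucc (ι x k) (ι y k)

  -- Between consecutive elements of F the partial sums of a vector supported in F
  -- are constant, so they are controlled by their values on F.
  ι-on-support : (P : ℕ → ℕ → Set) → ∀ (F : Subset n) x y a b → P a b → supp x ⊆ F → supp y ⊆ F →
    (∀ k → k ∈ F → P (a + ι x k) (b + ι y k)) → ∀ k → P (a + ι x k) (b + ι y k)
  ι-on-support P (s ∷ F) (c ∷ x) (d ∷ y) a b Pab x⊆F y⊆F h = λ { zero → headP s x⊆F y⊆F (h zero) ; (suc k) →
      subst₂ P (+-assoc a c (ι x k)) (+-assoc b d (ι y k))
        (ι-on-support P F x y (a + c) (b + d) (headP s x⊆F y⊆F (h zero)) (drop c x x⊆F) (drop d y y⊆F)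
          (λ k k∈F → subst₂ P (sym (+-assoc a c (ι x k))) (sym (+-assoc b d (ι y k))) (h (suc k) (there k∈F))) k) }
    where
    drop : ∀ e z → supp (e ∷ z) ⊆ s ∷ F → supp z ⊆ F
    drop e z ⊆F k∈ with ⊆F (there k∈)
    ... | there k∈F = k∈F
    outside⇒0 : ∀ e z → supp (e ∷ z) ⊆ outside ∷ F → e ≡ 0
    outside⇒0 zero    z ⊆F = refl
    outside⇒0 (suc e) z ⊆F with ⊆F here
    ... | ()
    headP : ∀ s → supp (c ∷ x) ⊆ s ∷ F → supp (d ∷ y) ⊆ s ∷ F → (zero ∈ s ∷ F → P (a + c) (b + d)) → P (a + c) (b + d)
    headP inside  _   _   h₀ = h₀ here
    headP outside x⊆F y⊆F h₀ = subst₂ P (trans (sym (+-identityʳ a)) (cong (a +_) (sym (outside⇒0 c x x⊆F))))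
                                        (trans (sym (+-identityʳ b)) (cong (b +_) (sym (outside⇒0 d y y⊆F)))) Pab

  ι-Diff01⇒⊒ : ∀ (F : Subset n) x y → supp x ⊆ F → supp y ⊆ F → ι-Diff01 F x y → x ⊒ y
  ι-Diff01⇒⊒ F x y x⊆F y⊆F h = ι-on-support EqualOrSucc F x y 0 0 (inj₁ refl) x⊆F y⊆F
    λ k k∈F → Sum.map (m⊖n≡0⇒m≡n (ι x k) (ι y k)) (m⊖n≡1⇒m≡1+n (ι x k) (ι y k)) (h k k∈F)

  ⊒⇒ι-Diff01 : ∀ (F : Subset n) x y → x ⊒ y → ι-Diff01 F x y
  ⊒⇒ι-Diff01 F x y x⊒y k _ = Sum.map
    (λ eq → trans (cong (_⊖ ι y k) eq) (ℤₚ.n⊖n≡0 (ι y k)))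
    (λ eq → trans (cong (_⊖ ι y k) eq) ([1+n]⊖n≡1 (ι y k))) (x⊒y k)

  ⊒-refl : (x : Vec ℕ n) → x ⊒ x
  ⊒-refl x k = inj₁ refl

  ⊒⇒≥ : ∀ (x y : Vec ℕ n) → x ⊒ y → ∀ k → ι y k ≤ ι x k
  ⊒⇒≥ x y x⊒y k with x⊒y k
  ... | inj₁ eq = ≤-reflexive (sym eq)
  ... | inj₂ eq = ≤-trans (n≤1+n _) (≤-reflexive (sym eq))

  -- Two steps may differ by 2, so transitivity needs the ends to be comparable. In the reversed
  -- case all three have the same partial sums.
  ⊒-trans : ∀ (x y z : Vec ℕ n) → x ⊒ y → y ⊒ z → x ⊒ z ⊎ z ⊒ x → x ⊒ z
  ⊒-trans x y z x⊒y y⊒z (inj₁ x⊒z)   = x⊒z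
  ⊒-trans x y z x⊒y y⊒z (inj₂ z⊒x) k =
    inj₁ (≤-antisym (⊒⇒≥ z x z⊒x k) (≤-trans (⊒⇒≥ y z y⊒z k) (⊒⇒≥ x y x⊒y k)))

  module Multisets {n} (L : List (Vec ℕ n)) where

    Chain : Subset (length L) → Set
    Chain S = ∀ i → i ∈ S → ∀ j → j ∈ S → lookup L i ⊒ lookup L j ⊎ lookup L j ⊒ lookup L i

    chain-⊆ : ∀ {S T} → S ⊆ T → Chain T → Chain S
    chain-⊆ S⊆T c i i∈S j j∈S = c i (S⊆T i∈S) j (S⊆T j∈S)

    Top : Vec ℕ (length L) → Set
    Top v = ∃[ t ] (t ∈ supp v × (∀ j → j ∈ supp v → lookup L t ⊒ lookup L j))

    -- An inserted point is comparable with the old maximum, and the larger of the two is the new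
    -- one.
    top : ∀ v → Chain (supp v) → v ≡ 0v ⊎ Top v
    top = multiset-induction (λ v → Chain (supp v) → v ≡ 0v ⊎ Top v) (λ _ → inj₁ refl) step
      where
      step : ∀ i v → (Chain (supp v) → v ≡ 0v ⊎ Top v) →
             Chain (supp (inc i v)) → inc i v ≡ 0v ⊎ Top (inc i v)
      step i v IH chain with IH (chain-⊆ (supp⊆supp-inc i v) chain)
      ... | inj₁ refl = inj₂ (i , ∈supp-inc i v , λ j j∈ → only j (∈supp-inc⁻ i v j∈))
        where
        only : ∀ j → j ≡ i ⊎ j ∈ supp 0v → lookup L i ⊒ lookup L j
        only j (inj₁ refl) = ⊒-refl (lookup L i)
        only j (inj₂ j∈)   = ⊥-elim (∉supp-0v j∈)
      ... | inj₂ (t , t∈ , t-top) with chain i (∈supp-inc i v) t (supp⊆supp-inc i v t∈)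
      ... | inj₁ i⊒t = inj₂ (i , ∈supp-inc i v , λ j j∈ → below j j∈ (∈supp-inc⁻ i v j∈))
        where
        below : ∀ j → j ∈ supp (inc i v) → j ≡ i ⊎ j ∈ supp v → lookup L i ⊒ lookup L j
        below j _    (inj₁ refl) = ⊒-refl (lookup L i)
        below j j∈ᵢ (inj₂ j∈)   =
          ⊒-trans (lookup L i) (lookup L t) (lookup L j) i⊒t (t-top j j∈) (chain i (∈supp-inc i v) j j∈ᵢ)
      ... | inj₂ t⊒i = inj₂ (t , supp⊆supp-inc i v t∈ , λ j j∈ → below j (∈supp-inc⁻ i v j∈))
        where
        below : ∀ j → j ≡ i ⊎ j ∈ supp v → lookup L t ⊒ lookup L j
        below j (inj₁ refl) = t⊒i
        below j (inj₂ j∈)   = t-top j j∈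

    -- Each of the N members has k-th partial sum c or c - 1, so the total lies between N(c - 1) and
    -- N c. The lower bound is stated without subtraction.
    combine-bounds : ∀ c k v → (∀ j → j ∈ supp v → EqualOrSucc c (ι (lookup L j) k)) →
      ι (combine L v) k ≤ Vec.sum v * c × Vec.sum v * c ≤ ι (combine L v) k + Vec.sum v
    combine-bounds c k = multiset-induction
      (λ v → (∀ j → j ∈ supp v → EqualOrSucc c (ι (lookup L j) k)) →
             ι (combine L v) k ≤ Vec.sum v * c × Vec.sum v * c ≤ ι (combine L v) k + Vec.sum v)
      (λ _ → subst (_≤ _) (sym (ι-combine-0v L k)) z≤n
           , subst (λ s → s * c ≤ ι (combine L 0v) k + s) (sym (sum-0v (length L))) z≤n)
      λ i v IH h → let upper , lower = IH (λ j j∈ → h j (supp⊆supp-inc i v j∈)) in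
          subst₂ _≤_ (sym (ι-combine-inc L i v k)) (cong (_* c) (sym (sum-inc i v)))
            (+-mono-≤ (below (h i (∈supp-inc i v))) upper)
        , subst₂ _≤_ (cong (_* c) (sym (sum-inc i v)))
            (trans (suc-shift (ι (lookup L i) k) (ι (combine L v) k) (Vec.sum v))
              (cong₂ _+_ (sym (ι-combine-inc L i v k)) (sym (sum-inc i v))))
            (+-mono-≤ (above (h i (∈supp-inc i v))) lower)
      where
      below : ∀ {a} → EqualOrSucc c a → a ≤ c
      below (inj₁ refl) = ≤-refl
      below (inj₂ refl) = n≤1+n _
      above : ∀ {a} → EqualOrSucc c a → c ≤ suc a
      above (inj₁ refl) = n≤1+n _
      above (inj₂ refl) = ≤-refl
      suc-shift : ∀ a b s → suc a + (b + s) ≡ (a + b) + suc s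
      suc-shift a b s = trans (cong suc (sym (+-assoc a b s))) (sym (+-suc (a + b) s))

    -- The partial sums of the top element t are ⌈ ι (combine L v) k / sum v ⌉.
    top-≤ : ∀ N v v′ k c c′ → Vec.sum v ≡ N → Vec.sum v′ ≡ N →
      (∀ j → j ∈ supp v → EqualOrSucc c (ι (lookup L j) k)) →
      (∀ j → j ∈ supp v′ → EqualOrSucc c′ (ι (lookup L j) k)) →
      c + ι (combine L v) k ≡ c′ + ι (combine L v′) k → c ≤ c′
    top-≤ N v v′ k c c′ refl sum′ h h′ eq with c ≤? c′
    ... | yes c≤c′ = c≤c′
    ... | no  c≰c′ = ⊥-elim (<-irrefl refl (begin-strict
      c + Vec.sum v * c                       ≤⟨ +-monoʳ-≤ c (proj₂ (combine-bounds c k v h)) ⟩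
      c + (ι (combine L v) k + Vec.sum v)     ≡⟨ +-assoc c (ι (combine L v) k) (Vec.sum v) ⟨
      (c + ι (combine L v) k) + Vec.sum v     ≡⟨ cong (_+ Vec.sum v) eq ⟩
      (c′ + ι (combine L v′) k) + Vec.sum v   ≤⟨ +-monoˡ-≤ (Vec.sum v) (+-monoʳ-≤ c′ (proj₁ (combine-bounds c′ k v′ h′))) ⟩
      (c′ + Vec.sum v′ * c′) + Vec.sum v      ≡⟨ cong (λ s → (c′ + s * c′) + Vec.sum v) sum′ ⟩
      suc (Vec.sum v) * c′ + Vec.sum v        <⟨ +-monoʳ-< (suc (Vec.sum v) * c′) (n<1+n (Vec.sum v)) ⟩
      suc (Vec.sum v) * c′ + suc (Vec.sum v)  ≡⟨ +-comm (suc (Vec.sum v) * c′) (suc (Vec.sum v)) ⟩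
      suc (Vec.sum v) + suc (Vec.sum v) * c′  ≡⟨ *-suc (suc (Vec.sum v)) c′ ⟨
      suc (Vec.sum v) * suc c′                ≤⟨ *-monoʳ-≤ (suc (Vec.sum v)) (≰⇒> c≰c′) ⟩
      c + Vec.sum v * c                       ∎))
      where open ≤-Reasoning

    -- The partial sums of the top element are determined by the total and N. Both multisets thus
    -- have the same top element, one copy of which is cancelled.
    combine-injective : Unique L → ∀ N v v′ → Vec.sum v ≡ N → Vec.sum v′ ≡ N →
      Chain (supp v) → Chain (supp v′) → combine L v ≡ combine L v′ → v ≡ v′
    combine-injective uL zero v v′ sum sum′ _ _ _ = trans (sum≡0⇒0v v sum) (sym (sum≡0⇒0v v′ sum′))
    combine-injective uL (suc N) v v′ sum sum′ chain chain′ eq with top v chain | top v′ chain′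
    ... | inj₁ refl | _ = ⊥-elim (0≢1+n (trans (sym (sum-0v (length L))) sum))
    ... | inj₂ _ | inj₁ refl = ⊥-elim (0≢1+n (trans (sym (sum-0v (length L))) sum′))
    ... | inj₂ (t , t∈ , t-top) | inj₂ (t′ , t′∈ , t′-top) with ∈supp⇒inc v t∈ | ∈supp⇒inc v′ t′∈
    ... | w , refl | w′ , refl with same-top
      where
      sum-w : Vec.sum w ≡ N
      sum-w = suc-injective (trans (sym (sum-inc t w)) sum)
      sum-w′ : Vec.sum w′ ≡ N
      sum-w′ = suc-injective (trans (sym (sum-inc t′ w′)) sum′)
      ι-eq : ∀ k → ι (lookup L t) k + ι (combine L w) k ≡ ι (lookup L t′) k + ι (combine L w′) k
      ι-eq k = trans (sym (ι-combine-inc L t w k)) (trans (cong (λ x → ι x k) eq) (ι-combine-inc L t′ w′ k))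
      same-top : t ≡ t′
      same-top = lookup-injective uL t t′ (ι-injective (lookup L t) (lookup L t′) λ k → ≤-antisym
        (top-≤ N w w′ k _ _ sum-w sum-w′ (λ j j∈ → t-top j (supp⊆supp-inc t w j∈) k)
          (λ j j∈ → t′-top j (supp⊆supp-inc t′ w′ j∈) k) (ι-eq k))
        (top-≤ N w′ w k _ _ sum-w′ sum-w (λ j j∈ → t′-top j (supp⊆supp-inc t′ w′ j∈) k)
          (λ j j∈ → t-top j (supp⊆supp-inc t w j∈) k) (sym (ι-eq k))))
    ... | refl = cong (inc t) (combine-injective uL N w w′
      (suc-injective (trans (sym (sum-inc t w)) sum)) (suc-injective (trans (sym (sum-inc t w′)) sum′))
      (chain-⊆ (supp⊆supp-inc t w) chain) (chain-⊆ (supp⊆supp-inc t w′) chain′)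
      (+v-cancelˡ (lookup L t) (combine L w) (combine L w′)
        (trans (sym (combine-inc L t w)) (trans eq (combine-inc L t w′)))))

    sum-combine : ∀ r → (∀ i → Vec.sum (lookup L i) ≡ r) → ∀ v → Vec.sum (combine L v) ≡ Vec.sum v * r
    sum-combine r h = multiset-induction (λ v → Vec.sum (combine L v) ≡ Vec.sum v * r)
      (trans (cong Vec.sum (combine-0v L)) (trans (sum-0v n) (cong (_* r) (sym (sum-0v (length L))))))
      λ i v IH → trans (cong Vec.sum (combine-inc L i v))
        (trans (sum-+v (lookup L i) (combine L v))
          (trans (cong₂ _+_ (h i) IH) (cong (_* r) (sym (sum-inc i v)))))

    supp-combine : ∀ F v → (∀ i → i ∈ supp v → supp (lookup L i) ⊆ F) → supp (combine L v) ⊆ F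
    supp-combine F = multiset-induction
      (λ v → (∀ i → i ∈ supp v → supp (lookup L i) ⊆ F) → supp (combine L v) ⊆ F)
      (λ _ k∈ → ⊥-elim (∉supp-0v (subst (λ x → _ ∈ supp x) (combine-0v L) k∈)))
      λ i v IH h k∈ → Sum.[ h i (∈supp-inc i v) , IH (λ j j∈ → h j (supp⊆supp-inc i v j∈)) ]
        (∈supp-+v⁻ (lookup L i) (combine L v) (subst (λ x → _ ∈ supp x) (combine-inc L i v) k∈))

-- Slicing a lattice point into a multichain; the bijection between multisets on C⟨r⟩ and lattice
-- points over C.

module EdgewiseSubdivision where

  open HilbertSeries
  open FaceCounting
  open Multichains
  open import Data.Empty using (⊥-elim)
  open import Data.Fin using (Fin; zero; suc)
  open import Data.Fin.Subset using (_∈_; _⊆_)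
  open import Data.Fin.Subset.Properties using (⊆-trans)
  open import Data.List using (List; []; _∷_; length; lookup; map; filter)
  open import Data.List.Membership.Propositional using () renaming (_∈_ to _∈ₗ_)
  open import Data.List.Membership.Propositional.Properties using (∈-lookup; ∈-map⁺; ∈-map⁻; ∈-filter⁺; ∈-filter⁻)
  open import Data.List.Membership.Propositional.Properties.WithK using (unique∧set⇒bag)
  open import Data.List.Properties using (length-map)
  open import Data.List.Relation.Binary.BagAndSetEquality using (∼bag⇒↭)
  open import Data.List.Relation.Binary.Permutation.Propositional.Properties using (↭-length)
  open import Data.List.Relation.Unary.All as All using (All; []; _∷_)
  import Data.List.Relation.Unary.All.Properties as Allₚ
  open import Data.List.Relation.Unary.Any as Any using (Any; here; there)
  open import Data.List.Relation.Unary.Any.Properties using (lookup-index)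
  open import Data.List.Relation.Unary.AllPairs using ([]; _∷_)
  open import Data.List.Relation.Unary.Unique.Propositional using (Unique)
  import Data.List.Relation.Unary.Unique.Propositional.Properties as Uniqueₚ
  import Data.Integer as ℤ
  open import Data.Nat
  open import Data.Nat.DivMod
  open import Data.Nat.Properties
  open import Data.Product using (_×_; _,_; proj₁; ∃-syntax)
  open import Data.Sum using (_⊎_; inj₁; inj₂)
  import Data.Sum as Sum
  open import Data.Vec as Vec using (Vec; []; _∷_; here; there)
  open import Function.Bundles using (mk⇔)
  open import Relation.Binary.PropositionalEquality hiding ([_])

  private variable
    n : ℕ

  -- The coordinates of slice N j s y are the differences of the sequence
  -- ⌊ (s + ι y k + j) / N ⌋, which is ι of the slice when s + j < N.
  slice : (N : ℕ) .{{_ : NonZero N}} → ℕ → ℕ → Vec ℕ n → Vec ℕ n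
  slice N j s []      = []
  slice N j s (c ∷ y) = ((s + c + j) / N ∸ (s + j) / N) ∷ slice N j (s + c) y

  module _ (N : ℕ) .{{_ : NonZero N}} where

    slice-head : ∀ j s c → ((s + c + j) / N ∸ (s + j) / N) + (s + j) / N ≡ (s + c + j) / N
    slice-head j s c = m∸n+n≡m (/-monoˡ-≤ N (+-monoˡ-≤ j (m≤m+n s c)))

    slice-step : ∀ j s c x → ((s + c + j) / N ∸ (s + j) / N) + x + (s + j) / N ≡ x + (s + c + j) / N
    slice-step j s c x =
      trans (cong (_+ (s + j) / N) (+-comm ((s + c + j) / N ∸ (s + j) / N) x))
        (trans (+-assoc x _ ((s + j) / N)) (cong (x +_) (slice-head j s c)))

    ι-slice : ∀ j s (y : Vec ℕ n) k → ι (slice N j s y) k + (s + j) / N ≡ (s + ι y k + j) / N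
    ι-slice j s (c ∷ y) zero    = slice-head j s c
    ι-slice j s (c ∷ y) (suc k) = trans (slice-step j s c (ι (slice N j (s + c) y) k))
      (trans (ι-slice j (s + c) y k) (cong (λ m → (m + j) / N) (+-assoc s c (ι y k))))

    sum-slice : ∀ j s (y : Vec ℕ n) → Vec.sum (slice N j s y) + (s + j) / N ≡ (s + Vec.sum y + j) / N
    sum-slice j s []      = cong (λ m → (m + j) / N) (sym (+-identityʳ s))
    sum-slice j s (c ∷ y) = trans (slice-step j s c (Vec.sum (slice N j (s + c) y)))
      (trans (sum-slice j (s + c) y) (cong (λ m → (m + j) / N) (+-assoc s c (Vec.sum y))))

    supp-slice : ∀ j s (y : Vec ℕ n) → supp (slice N j s y) ⊆ supp y
    supp-slice j s (suc c ∷ y) {zero} k∈ = here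
    supp-slice j s (zero ∷ y)  {zero} k∈
      rewrite +-identityʳ s | n∸n≡0 ((s + j) / N) with k∈
    ... | ()
    supp-slice j s (c ∷ y) {suc k} (there k∈) = there (supp-slice j (s + c) y k∈)

    ι-slice₀ : ∀ j → j < N → ∀ (y : Vec ℕ n) k → ι (slice N j 0 y) k ≡ (ι y k + j) / N
    ι-slice₀ j j<N y k = trans (sym (+-identityʳ _)) (trans (cong (ι (slice N j 0 y) k +_) (sym (m<n⇒m/n≡0 j<N))) (ι-slice j 0 y k))

    sum-slice₀ : ∀ j → j < N → ∀ (y : Vec ℕ n) r → Vec.sum y ≡ N * r → Vec.sum (slice N j 0 y) ≡ r
    sum-slice₀ j j<N y r sum≡ = trans (sym (+-identityʳ _))
      (trans (cong (Vec.sum (slice N j 0 y) +_) (sym (m<n⇒m/n≡0 j<N)))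
      (trans (sum-slice j 0 y)
      (trans (cong (λ m → (m + j) / N) (trans sum≡ (*-comm N r)))
      (trans (+-distrib-/ (r * N) j (subst (_< N) (sym (cong₂ _+_ (m*n%n≡0 r N) (m<n⇒m%n≡m j<N))) j<N))
        (trans (cong₂ _+_ (m*n/n≡m r N) (m<n⇒m/n≡0 j<N)) (+-identityʳ r))))))

    +N-/ : ∀ b → (b + N) / N ≡ suc (b / N)
    +N-/ b = trans (m/n≡1+[m∸n]/n (m≤n+m N b)) (cong (λ m → suc (m / N)) (m+n∸n≡m b N))

    -- For i ≤ j < N the numbers b + i ≤ b + j < b + i + N have quotients by N that differ by at
    -- most 1.
    slices-⊒ : ∀ i j → i ≤ j → j < N → (y : Vec ℕ n) → slice N j 0 y ⊒ slice N i 0 y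
    slices-⊒ i j i≤j j<N y k
      rewrite ι-slice₀ j j<N y k | ι-slice₀ i (≤-<-trans i≤j j<N) y k
      with m≤n⇒m<n∨m≡n (/-monoˡ-≤ N (+-monoʳ-≤ (ι y k) i≤j))
    ... | inj₂ eq = inj₁ (sym eq)
    ... | inj₁ lt = inj₂ (≤-antisym
      (≤-trans (/-monoˡ-≤ N (≤-trans (+-monoʳ-≤ (ι y k) (≤-trans (<⇒≤ j<N) (m≤n+m N i)))
                                     (≤-reflexive (sym (+-assoc (ι y k) i N)))))
               (≤-reflexive (+N-/ (ι y k + i)))) lt)

    slices-comparable : ∀ i j → i < N → j < N → (y : Vec ℕ n) →
      slice N i 0 y ⊒ slice N j 0 y ⊎ slice N j 0 y ⊒ slice N i 0 y
    slices-comparable i j i<N j<N y with ≤-total i j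
    ... | inj₁ i≤j = inj₂ (slices-⊒ i j i≤j j<N y)
    ... | inj₂ j≤i = inj₁ (slices-⊒ j i j≤i i<N y)

    floorSum : ℕ → ℕ → ℕ
    floorSum zero    b = 0
    floorSum (suc J) b = (b + J) / N + floorSum J b

    floorSum-suc : ∀ J b → floorSum J (suc b) + b / N ≡ floorSum J b + (b + J) / N
    floorSum-suc zero    b = cong (_/ N) (sym (+-identityʳ b))
    floorSum-suc (suc J) b =
      trans (+-assoc ((suc b + J) / N) (floorSum J (suc b)) (b / N))
      (trans (cong₂ _+_ (cong (_/ N) (sym (+-suc b J))) (trans (floorSum-suc J b) (+-comm (floorSum J b) ((b + J) / N))))
        (+-comm ((b + suc J) / N) ((b + J) / N + floorSum J b)))

    floorSum-0 : ∀ J → J ≤ N → floorSum J 0 ≡ 0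
    floorSum-0 zero    _   = refl
    floorSum-0 (suc J) J<N = cong₂ _+_ (m<n⇒m/n≡0 J<N) (floorSum-0 J (<⇒≤ J<N))

    -- Hermite's identity: the floors of (b + j) / N for j < N add up to b. Raising b by one
    -- replaces the term b / N by (b + N) / N, one more.
    hermite : ∀ b → floorSum N b ≡ b
    hermite zero    = floorSum-0 N ≤-refl
    hermite (suc b) = +-cancelʳ-≡ (b / N) (floorSum N (suc b)) (suc b)
      (trans (floorSum-suc N b)
        (trans (cong₂ _+_ (hermite b) (+N-/ b)) (+-suc b (b / N))))

  module LatticePoints (n r : ℕ) where

    L : List (Vec ℕ n)
    L = latticePoints n r

    open Multisets L

    sum-point : ∀ i → Vec.sum (lookup L i) ≡ r
    sum-point i = latticePoints-sound n r (∈-lookup i)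

    module _ (N : ℕ) .{{_ : NonZero N}} (y : Vec ℕ n) (sum-y : Vec.sum y ≡ N * r) where

      sliceIndex : ∀ j → j < N → Fin (Index n r)
      sliceIndex j j<N = Any.index (latticePoints-complete n r (slice N j 0 y) (sum-slice₀ N j j<N y r sum-y))

      lookup-sliceIndex : ∀ j j<N → lookup L (sliceIndex j j<N) ≡ slice N j 0 y
      lookup-sliceIndex j j<N = sym (lookup-index (latticePoints-complete n r (slice N j 0 y) (sum-slice₀ N j j<N y r sum-y)))

      slices : ∀ J → J ≤ N → Vec ℕ (Index n r)
      slices zero    _   = 0v
      slices (suc J) J<N = inc (sliceIndex J J<N) (slices J (<⇒≤ J<N))

      sum-slices : ∀ J J≤N → Vec.sum (slices J J≤N) ≡ J
      sum-slices zero    _   = sum-0v (Index n r)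
      sum-slices (suc J) J<N = trans (sum-inc (sliceIndex J J<N) (slices J (<⇒≤ J<N))) (cong suc (sum-slices J (<⇒≤ J<N)))

      ∈supp-slices⁻ : ∀ J J≤N {i} → i ∈ supp (slices J J≤N) → ∃[ j ] (j < N × lookup L i ≡ slice N j 0 y)
      ∈supp-slices⁻ zero    J≤N i∈ = ⊥-elim (∉supp-0v i∈)
      ∈supp-slices⁻ (suc J) J<N i∈ with ∈supp-inc⁻ (sliceIndex J J<N) (slices J (<⇒≤ J<N)) i∈
      ... | inj₁ refl = J , J<N , lookup-sliceIndex J J<N
      ... | inj₂ i∈′  = ∈supp-slices⁻ J (<⇒≤ J<N) i∈′

      ι-combine-slices : ∀ J J≤N k → ι (combine L (slices J J≤N)) k ≡ floorSum N J (ι y k)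
      ι-combine-slices zero    _   k = ι-combine-0v L k
      ι-combine-slices (suc J) J<N k =
        trans (ι-combine-inc L (sliceIndex J J<N) (slices J (<⇒≤ J<N)) k)
          (cong₂ _+_ (trans (cong (λ x → ι x k) (lookup-sliceIndex J J<N)) (ι-slice₀ N J J<N y k))
                     (ι-combine-slices J (<⇒≤ J<N) k))

      combine-slices : combine L (slices N ≤-refl) ≡ y
      combine-slices = ι-injective _ y λ k → trans (ι-combine-slices N ≤-refl k) (hermite N (ι y k))

    -- The preimage consists of the N slices of y, whose partial sums add up to those of y by
    -- Hermite's identity. N = 0 is separate because slicing divides by N.
    combine-surjective : ∀ N y → Vec.sum y ≡ N * r → ∃[ v ] (Vec.sum v ≡ N × combine L v ≡ y
      × (∀ i → i ∈ supp v → supp (lookup L i) ⊆ supp y) × Chain (supp v))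
    combine-surjective zero y sum-y =
      0v , sum-0v (Index n r) , trans (combine-0v L) (sym (sum≡0⇒0v y sum-y))
      , (λ i i∈ → ⊥-elim (∉supp-0v i∈)) , (λ i i∈ → ⊥-elim (∉supp-0v i∈))
    combine-surjective N@(suc _) y sum-y = slices N y sum-y N ≤-refl , sum-slices N y sum-y N ≤-refl , combine-slices N y sum-y
      , (λ i i∈ → let j , _ , eq = ∈supp-slices⁻ N y sum-y N ≤-refl i∈ in
          subst (λ x → supp x ⊆ supp y) (sym eq) (supp-slice N j 0 y))
      , λ i i∈ i′ i′∈ → let j , j<N , eq = ∈supp-slices⁻ N y sum-y N ≤-refl i∈
                            j′ , j′<N , eq′ = ∈supp-slices⁻ N y sum-y N ≤-refl i′∈ in
          subst₂ (λ x x′ → x ⊒ x′ ⊎ x′ ⊒ x) (sym eq) (sym eq′) (slices-comparable N j j′ j<N j′<N y)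

  unique-map : ∀ {A B : Set} (f : A → B) xs → (∀ {x y} → x ∈ₗ xs → y ∈ₗ xs → f x ≡ f y → x ≡ y) →
               Unique xs → Unique (map f xs)
  unique-map f []       inj []       = []
  unique-map f (x ∷ xs) inj (x∉ ∷ u) =
    Allₚ.map⁺ (All.tabulate λ y∈ fx≡fy → All.lookup x∉ y∈ (inj (here refl) (there y∈) fx≡fy))
    ∷ unique-map f xs (λ x∈ y∈ → inj (there x∈) (there y∈)) u

  length-bijection : ∀ {A B : Set} (f : A → B) {xs ys} → Unique xs → Unique ys →
    (∀ {x} → x ∈ₗ xs → f x ∈ₗ ys) → (∀ {x y} → x ∈ₗ xs → y ∈ₗ xs → f x ≡ f y → x ≡ y) →
    (∀ {y} → y ∈ₗ ys → ∃[ x ] (x ∈ₗ xs × f x ≡ y)) → length xs ≡ length ys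
  length-bijection f {xs} {ys} uxs uys into inj onto =
    trans (sym (length-map f xs)) (↭-length (∼bag⇒↭ (unique∧set⇒bag (unique-map f xs inj uxs) uys
      (mk⇔ (λ z∈ → let x , x∈ , z≡ = ∈-map⁻ f z∈ in subst (_∈ₗ ys) (sym z≡) (into x∈))
           (λ z∈ → let x , x∈ , fx≡ = onto z∈ in subst (_∈ₗ map f xs) fx≡ (∈-map⁺ f x∈))))))

  module _ {n} (C : SimplicialComplex n) (r : ℕ) where
    open LatticePoints n r
    open Multisets L

    face⇒chain : ∀ {S} → IsFace (C ⟨ r ⟩) S → Chain S
    face⇒chain (F , _ , supp⊆F , comparable) i i∈ j j∈ = Sum.map
      (ι-Diff01⇒⊒ F (lookup L i) (lookup L j) (supp⊆F i i∈) (supp⊆F j j∈))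
      (ι-Diff01⇒⊒ F (lookup L j) (lookup L i) (supp⊆F j j∈) (supp⊆F i i∈))
      (comparable i i∈ j j∈)

    sumℤ-combine : ∀ N →
      sumℤ (λ v → indicator (isFace? (C ⟨ r ⟩) (supp v))) (latticePoints (Index n r) N)
      ≡ sumℤ (λ y → indicator (isFace? C (supp y))) (latticePoints n (N * r))
    sumℤ-combine N = trans (sym (length-filter (λ v → isFace? (C ⟨ r ⟩) (supp v)) (latticePoints (Index n r) N)))
      (trans (cong ℤ.+_ (length-bijection (combine L)
        (Uniqueₚ.filter⁺ P? (latticePoints-unique (Index n r) N)) (Uniqueₚ.filter⁺ Q? (latticePoints-unique n (N * r)))
        into inj onto))
      (length-filter (λ y → isFace? C (supp y)) (latticePoints n (N * r))))
      where
      P? = λ (v : Vec ℕ (Index n r)) → isFace? (C ⟨ r ⟩) (supp v)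
      Q? = λ (y : Vec ℕ n) → isFace? C (supp y)
      into : ∀ {v} → v ∈ₗ filter P? (latticePoints (Index n r) N) → combine L v ∈ₗ filter Q? (latticePoints n (N * r))
      into {v} v∈ with ∈-filter⁻ P? {xs = latticePoints (Index n r) N} v∈
      ... | v∈lp , F , F-facet , supp⊆F , _ = ∈-filter⁺ Q?
        (latticePoints-complete n (N * r) (combine L v)
          (trans (sum-combine r sum-point v) (cong (_* r) (latticePoints-sound (Index n r) N v∈lp))))
        (⊆-closed C (supp-combine F v supp⊆F) (proj₁ F-facet))
      inj : ∀ {v w} → v ∈ₗ filter P? (latticePoints (Index n r) N) → w ∈ₗ filter P? (latticePoints (Index n r) N) →
            combine L v ≡ combine L w → v ≡ w
      inj {v} {w} v∈ w∈ eq with ∈-filter⁻ P? {xs = latticePoints (Index n r) N} v∈ | ∈-filter⁻ P? {xs = latticePoints (Index n r) N} w∈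
      ... | v∈lp , v-face | w∈lp , w-face = combine-injective (latticePoints-unique n r) N v w
        (latticePoints-sound (Index n r) N v∈lp) (latticePoints-sound (Index n r) N w∈lp)
        (face⇒chain v-face) (face⇒chain w-face) eq
      onto : ∀ {y} → y ∈ₗ filter Q? (latticePoints n (N * r)) →
             ∃[ v ] (v ∈ₗ filter P? (latticePoints (Index n r) N) × combine L v ≡ y)
      onto {y} y∈ with ∈-filter⁻ Q? {xs = latticePoints n (N * r)} y∈
      ... | y∈lp , y-face with combine-surjective N y (latticePoints-sound n (N * r) y∈lp) | face⊆facet C (supp y) y-face
      -- Any facet F containing supp y serves for all slices at once, since their supports lie in
      -- supp y.
      ... | v , sum-v , eq , supp⊆ , chain | F , F-facet , y⊆F =
        v , ∈-filter⁺ P? (latticePoints-complete (Index n r) N v sum-v)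
              (F , F-facet , (λ i i∈ → ⊆-trans (supp⊆ i i∈) y⊆F)
              , λ i i∈ j j∈ → Sum.map (⊒⇒ι-Diff01 F (lookup L i) (lookup L j)) (⊒⇒ι-Diff01 F (lookup L j) (lookup L i))
                                     (chain i i∈ j j∈))
          , eq

-- Restriction sets and the interval partition of a shelling.

module Shellings where

  open HilbertSeries
  open FaceCounting
  open import Data.Bool using (true)
  open import Data.Empty using (⊥-elim)
  open import Data.Fin using (zero; suc; toℕ)
  open import Data.Fin.Properties using (¬∀⟶∃¬)
  open import Data.Fin.Subset hiding (⊤)
  open import Data.Fin.Subset.Properties
  open import Data.Integer as ℤ using (ℤ; 0ℤ; 1ℤ)
  import Data.Integer.Properties as ℤₚ
  open import Data.List using (List; []; _∷_; _∷ʳ_; _++_; lookup; take; map)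
  open import Data.List.Membership.Propositional using (find; lose) renaming (_∈_ to _∈ₗ_)
  open import Data.List.Membership.Propositional.Properties using (∈-lookup)
  open import Data.List.Properties using (++-identityʳ; ++-assoc)
  open import Data.List.Relation.Unary.All as All using (All; []; _∷_)
  open import Data.List.Relation.Unary.Any as Any using (Any; here; there; any?)
  import Data.List.Relation.Unary.Any.Properties as Anyₚ
  open import Data.List.Relation.Unary.AllPairs using ([]; _∷_)
  open import Data.List.Relation.Unary.Unique.Propositional using (Unique)
  open import Data.Nat as ℕ using (ℕ; zero; suc; _≤_; s≤s; z≤n)
  import Data.Nat.Properties as ℕₚ
  open import Data.Product using (_×_; _,_; proj₁; proj₂; ∃-syntax)
  open import Data.Sum using (_⊎_; inj₁; inj₂)
  open import Data.Unit using (⊤; tt)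
  open import Data.Vec using ([]; _∷_; here; there; tabulate)
  open import Data.Vec.Properties using (lookup∘tabulate; []=⇒lookup; lookup⇒[]=)
  open import Function.Bundles using (Equivalence)
  open import Relation.Binary.PropositionalEquality hiding ([_])
  open import Relation.Nullary using (¬_; Dec; yes; no; ¬?; does)
  open import Relation.Nullary.Decidable using (_×-dec_; _→-dec_; dec-true; decidable-stable)

  private variable
    n : ℕ

  ⊈⇒∃ : ∀ {p q : Subset n} → p ⊈ q → ∃[ v ] (v ∈ p × v ∉ q)
  ⊈⇒∃ {n} {p} {q} p⊈q with ¬∀⟶∃¬ n (λ v → v ∈ p → v ∈ q) (λ v → (v ∈? p) →-dec (v ∈? q)) (λ h → p⊈q (λ {x} → h x))
  ... | v , ¬h = v , decidable-stable (v ∈? p) (λ v∉p → ¬h (λ v∈p → ⊥-elim (v∉p v∈p))) , λ v∈q → ¬h (λ _ → v∈q)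

  x∈p⇒0<∣p∣ : ∀ {p : Subset n} {x} → x ∈ p → 1 ≤ ∣ p ∣
  x∈p⇒0<∣p∣ {p = p} {x} x∈p =
    subst (_≤ ∣ p ∣) (∣⁅x⁆∣≡1 x) (p⊆q⇒∣p∣≤∣q∣ (λ {y} y∈ → subst (_∈ p) (sym (x∈⁅y⁆⇒x≡y x y∈)) x∈p))

  p⊆q-x : ∀ {p q : Subset n} {x} → p ⊆ q → x ∉ p → p ⊆ q - x
  p⊆q-x {p = p} p⊆q x∉p y∈p = x∈p∧x≢y⇒x∈p-y (p⊆q y∈p) λ { refl → x∉p y∈p }

  ∈-take⁻ : ∀ {A : Set} m {xs : List A} {x} → x ∈ₗ take m xs → x ∈ₗ xs
  ∈-take⁻ (suc m) {_ ∷ _} (here refl) = here refl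
  ∈-take⁻ (suc m) {_ ∷ _} (there x∈)  = there (∈-take⁻ m x∈)

  ∈-take⇒≢lookup : ∀ {A : Set} {xs : List A} → Unique xs → ∀ j {x} → x ∈ₗ take (toℕ j) xs → x ≢ lookup xs j
  ∈-take⇒≢lookup (x∉ ∷ u) (suc j) (here refl) eq = All.lookup x∉ (∈-lookup j) eq
  ∈-take⇒≢lookup (x∉ ∷ u) (suc j) (there x∈)  eq = ∈-take⇒≢lookup u j x∈ eq

  -- The attaching complex of F is generated by ridges `F - v`: the familiar non-recursive form of
  -- the shelling condition.
  RidgeCover : List (Subset n) → Subset n → Set
  RidgeCover pre F = ∀ S → S ⊆ F → Span pre S → ∃[ v ] (v ∈ F × v ∉ S × Span pre (F - v))

  -- The minimal face that is new when F is attached to the simplices of pre.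
  restriction : List (Subset n) → Subset n → Subset n
  restriction pre F = tabulate λ v → does ((v ∈? F) ×-dec any? (λ G → (F - v) ⊆? G) pre)

  does⁻ : ∀ {P : Set} (p? : Dec P) → does p? ≡ true → P
  does⁻ (yes p) _ = p

  module _ (pre : List (Subset n)) (F : Subset n) where

    private
      ridge-old? : ∀ v → Dec (v ∈ F × Span pre (F - v))
      ridge-old? v = (v ∈? F) ×-dec any? (λ G → (F - v) ⊆? G) pre

    ∈restriction⁻ : ∀ {v} → v ∈ restriction pre F → v ∈ F × Span pre (F - v)
    ∈restriction⁻ {v} v∈ = does⁻ (ridge-old? v)
      (trans (sym (lookup∘tabulate (λ v → does (ridge-old? v)) v)) ([]=⇒lookup v∈))

    ∈restriction⁺ : ∀ {v} → v ∈ F → Span pre (F - v) → v ∈ restriction pre F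
    ∈restriction⁺ {v} v∈F old = lookup⇒[]= v (restriction pre F)
      (trans (lookup∘tabulate (λ v → does (ridge-old? v)) v) (dec-true (ridge-old? v) (v∈F , old)))

    restriction⊆ : restriction pre F ⊆ F
    restriction⊆ v∈ = proj₁ (∈restriction⁻ v∈)

    -- If S missed some v of the restriction, it would lie in the old ridge `F - v`.
    new⇒restriction⊆ : ∀ {S} → S ⊆ F → ¬ Span pre S → restriction pre F ⊆ S
    new⇒restriction⊆ {S} S⊆F new {v} v∈ = decidable-stable (v ∈? S) λ v∉S →
      new (Any.map (⊆-trans (p⊆q-x S⊆F v∉S)) (proj₂ (∈restriction⁻ v∈)))

    -- An old S lies in an old ridge `F - v`; this v belongs to the restriction but not to S.
    restriction⊆⇒new : RidgeCover pre F → ∀ {S} → S ⊆ F → restriction pre F ⊆ S → ¬ Span pre S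
    restriction⊆⇒new cover {S} S⊆F R⊆S old with cover S S⊆F old
    ... | v , v∈F , v∉S , ridge-old = v∉S (R⊆S (∈restriction⁺ v∈F ridge-old))

  intervals : List (Subset n) → List (Subset n) → List (Subset n × Subset n)
  intervals pre []       = []
  intervals pre (F ∷ Fs) = (restriction pre F , F) ∷ intervals (pre ∷ʳ F) Fs

  RidgeCovers : List (Subset n) → List (Subset n) → Set
  RidgeCovers pre []       = ⊤
  RidgeCovers pre (F ∷ Fs) = RidgeCover pre F × RidgeCovers (pre ∷ʳ F) Fs

  ridgeCovers : ∀ (pre Fs : List (Subset n)) →
    (∀ j → RidgeCover (pre ++ take (toℕ j) Fs) (lookup Fs j)) → RidgeCovers pre Fs
  ridgeCovers pre []       h = tt
  ridgeCovers pre (F ∷ Fs) h =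
      subst (λ Gs → RidgeCover Gs F) (++-identityʳ pre) (h zero)
    , ridgeCovers (pre ∷ʳ F) Fs (λ j →
        subst (λ Gs → RidgeCover Gs (lookup Fs j)) (sym (++-assoc pre (F ∷ []) (take (toℕ j) Fs))) (h (suc j)))

  span? : ∀ (Gs : List (Subset n)) S → Dec (Span Gs S)
  span? Gs S = any? (S ⊆?_) Gs

  between? : ∀ (S : Subset n) (I : Subset n × Subset n) → Dec (proj₁ I ⊆ S × S ⊆ proj₂ I)
  between? S (R , F) = (R ⊆? S) ×-dec (S ⊆? F)

  indicator-yes : ∀ {P : Set} (p? : Dec P) → P → indicator p? ≡ 1ℤ
  indicator-yes (yes _) p = refl
  indicator-yes (no ¬p) p = ⊥-elim (¬p p)

  indicator-no : ∀ {P : Set} (p? : Dec P) → ¬ P → indicator p? ≡ 0ℤ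
  indicator-no (yes p) ¬p = ⊥-elim (¬p p)
  indicator-no (no _)  ¬p = refl

  -- S is counted once, at the first F of `Fs` that contains it. From then on S is old, and no later
  -- interval contains it.
  intervals-partition : ∀ (pre Fs : List (Subset n)) → RidgeCovers pre Fs → ∀ S →
    sumℤ (λ I → indicator (between? S I)) (intervals pre Fs) ≡ indicator (¬? (span? pre S) ×-dec span? Fs S)
  intervals-partition pre [] _ S = sym (indicator-no (¬? (span? pre S) ×-dec span? [] S) λ { (_ , ()) })
  intervals-partition pre (F ∷ Fs) (cover , covers) S = go (span? pre S) (S ⊆? F)
    where
    target? : Dec (¬ Span pre S × Span (F ∷ Fs) S)
    target? = ¬? (span? pre S) ×-dec span? (F ∷ Fs) S
    rest? : Dec (¬ Span (pre ∷ʳ F) S × Span Fs S)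
    rest? = ¬? (span? (pre ∷ʳ F) S) ×-dec span? Fs S
    head? : Dec (restriction pre F ⊆ S × S ⊆ F)
    head? = between? S (restriction pre F , F)
    rest : sumℤ (λ I → indicator (between? S I)) (intervals (pre ∷ʳ F) Fs) ≡ indicator rest?
    rest = intervals-partition (pre ∷ʳ F) Fs covers S
    go : Dec (Span pre S) → Dec (S ⊆ F) →
         indicator head? ℤ.+ sumℤ (λ I → indicator (between? S I)) (intervals (pre ∷ʳ F) Fs) ≡ indicator target?
    go (yes old) _ = trans
      (cong₂ ℤ._+_
        (indicator-no head? λ (R⊆S , S⊆F) → restriction⊆⇒new pre F cover S⊆F R⊆S old)
        (trans rest (indicator-no rest? λ (new , _) → new (Anyₚ.++⁺ˡ old))))
      (sym (indicator-no target? λ (new , _) → new old))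
    go (no new) (yes S⊆F) = trans
      (cong₂ ℤ._+_
        (indicator-yes head? (new⇒restriction⊆ pre F S⊆F new , S⊆F))
        (trans rest (indicator-no rest? λ (new′ , _) → new′ (Anyₚ.++⁺ʳ pre (here S⊆F)))))
      (sym (indicator-yes target? (new , here S⊆F)))
    go (no new) (no S⊈F) = trans
      (cong₂ ℤ._+_
        (indicator-no head? λ (_ , S⊆F) → S⊈F S⊆F)
        (trans rest (indicator-⇔ rest? target?
          (λ (_ , S∈Fs) → new , there S∈Fs)
          λ { (_ , here S⊆F)   → ⊥-elim (S⊈F S⊆F)
            ; (_ , there S∈Fs) → (λ S∈ → still-new (Anyₚ.++⁻ pre S∈)) , S∈Fs })))
      (ℤₚ.+-identityˡ _)
      where
      still-new : ¬ (Span pre S ⊎ Span (F ∷ []) S)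
      still-new (inj₁ old)        = new old
      still-new (inj₂ (here S⊆F)) = S⊈F S⊆F

  facet-⊆⇒≡ : ∀ {𝓕 F G} → Facet {n} 𝓕 F → 𝓕 G → F ⊆ G → F ≡ G
  facet-⊆⇒≡ {F = F} {G} (_ , maximal) G∈ F⊆G = ⊆-antisym F⊆G
    (decidable-stable (G ⊆? F) λ G⊈F → maximal (G , G∈ , F⊆G , ⊈⇒∃ G⊈F))

  shelling-facetOrdering : ∀ d {𝓕 : Subset n → Set} {Fs} → IsShelling d 𝓕 Fs → FacetOrdering 𝓕 Fs
  shelling-facetOrdering zero    ordering       = ordering
  shelling-facetOrdering (suc d) (ordering , _) = ordering

  -- In positive dimension an old face S lies in one of the first m facets G of the boundary of F.
  -- Maximality of G among proper faces gives `F - v ⊆ G` for any v of F outside G, and G is itself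
  -- old.
  shelling-ridgeCover : ∀ d {𝓕 : Subset n → Set} {Fs} → Pure d 𝓕 → IsShelling d 𝓕 Fs →
    ∀ j → RidgeCover (take (toℕ j) Fs) (lookup Fs j)
  shelling-ridgeCover zero {𝓕} {Fs} pure (unique , facets) j S S⊆F old with find old
  -- Facets are single points when d = 0, so `F - v` is empty and lies in any earlier facet.
  ... | G , G∈ , S⊆G = v , v∈F , (λ v∈S → v∉G (S⊆G v∈S)) , lose G∈ λ w∈ → ⊥-elim (ℕₚ.<-irrefl refl
          (ℕₚ.≤-trans (s≤s (x∈p⇒0<∣p∣ w∈)) (subst (∣ F - v ∣ ℕ.<_) (pure F F-facet) (x∈p⇒∣p-x∣<∣p∣ v∈F))))
    where
    F = lookup Fs j
    F-facet : Facet 𝓕 F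
    F-facet = Equivalence.to (facets F) (∈-lookup j)
    F⊈G : F ⊈ G
    F⊈G F⊆G = ∈-take⇒≢lookup unique j G∈
      (sym (facet-⊆⇒≡ F-facet (proj₁ (Equivalence.to (facets G) (∈-take⁻ (toℕ j) G∈))) F⊆G))
    outside-G = ⊈⇒∃ F⊈G
    v = proj₁ outside-G
    v∈F = proj₁ (proj₂ outside-G)
    v∉G = proj₂ (proj₂ outside-G)
  shelling-ridgeCover (suc d) {Fs = _ ∷ _} pure _ zero S S⊆F ()
  shelling-ridgeCover (suc d) {𝓕} {Fs@(_ ∷ _)} pure (_ , _ , attach) (suc j) S S⊆F old
    with attach (suc j) (s≤s z≤n)
  ... | _ , Gs , boundary , m , _ , _ , attaching with find (Equivalence.to (attaching S) (S⊆F , old))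
  ... | G , G∈ , S⊆G with Equivalence.to (proj₂ (shelling-facetOrdering d boundary) G) (∈-take⁻ m G∈)
  ... | (G⊆F , v , v∈F , v∉G) , maximal =
    v , v∈F , (λ v∈S → v∉G (S⊆G v∈S)) ,
    Any.map (⊆-trans F-v⊆G) (proj₂ (Equivalence.from (attaching G) (lose G∈ ⊆-refl)))
    where
    F = lookup Fs (suc j)
    F-v⊆G : F - v ⊆ G
    F-v⊆G = decidable-stable ((F - v) ⊆? G) λ F-v⊈G →
      maximal (F - v , x∈p⇒p-x⊂p v∈F , p⊆q-x G⊆F v∉G , ⊈⇒∃ F-v⊈G)

-- Lattice points with support between two given faces.

module Intervals where

  open HilbertSeries
  open FaceCounting
  open Shellings
  open import Data.Fin using (zero; suc)
  open import Data.Fin.Subset using (Subset; inside; outside; ∣_∣; _⊆_; _∉_)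
  open import Data.Fin.Subset.Properties
  open import Data.Integer as ℤ using (ℤ; 0ℤ)
  import Data.Integer.Properties as ℤₚ
  open import Data.Nat using (ℕ; zero; suc)
  import Data.Nat.Properties as ℕₚ
  open import Data.Product using (_,_)
  open import Data.Vec using (Vec; []; _∷_; here; there)
  open import Relation.Binary.PropositionalEquality hiding ([_])

  weight : ∀ {n} → Subset n → Subset n → Vec ℕ n → ℤ
  weight R F y = indicator (between? (supp y) (R , F))

  module _ {n} (R F : Subset n) where

    weight-0∷ : ∀ s y → weight (outside ∷ R) (s ∷ F) (0 ∷ y) ≡ weight R F y
    weight-0∷ s y = indicator-⇔ (between? (supp (0 ∷ y)) (outside ∷ R , s ∷ F)) (between? (supp y) (R , F))
      (λ (R⊆ , ⊆F) → drop-∷-⊆ R⊆ , drop-∷-⊆ ⊆F) (λ (R⊆ , ⊆F) → out⊆ R⊆ , out⊆ ⊆F)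

    weight-inside-0∷ : ∀ y → weight (inside ∷ R) (inside ∷ F) (0 ∷ y) ≡ 0ℤ
    weight-inside-0∷ y = indicator-no (between? (supp (0 ∷ y)) (inside ∷ R , inside ∷ F)) λ (R⊆ , _) → absurd (R⊆ here)
      where
      absurd : zero ∉ outside ∷ supp y
      absurd ()

    weight-outside-incHead : ∀ w → weight (outside ∷ R) (outside ∷ F) (incHead w) ≡ 0ℤ
    weight-outside-incHead (c ∷ y) = indicator-no (between? (inside ∷ supp y) (outside ∷ R , outside ∷ F)) λ (_ , ⊆F) → absurd (⊆F here)
      where
      absurd : zero ∉ outside ∷ F
      absurd ()

    -- A positive coordinate already meets the demand of R. After one unit is removed, the rest of
    -- that coordinate is unconstrained.
    weight-inside-incHead : ∀ s w → weight (s ∷ R) (inside ∷ F) (incHead w) ≡ weight (outside ∷ R) (inside ∷ F) w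
    weight-inside-incHead s (c ∷ y) =
      indicator-⇔ (between? (inside ∷ supp y) (s ∷ R , inside ∷ F)) (between? (supp (c ∷ y)) (outside ∷ R , inside ∷ F))
        (λ (R⊆ , ⊆F) → out⊆ (drop-∷-⊆ R⊆) , ∷⊆inside (drop-∷-⊆ ⊆F))
        (λ (R⊆ , ⊆F) → ∷⊆inside (drop-∷-⊆ R⊆) , ∷⊆inside (drop-∷-⊆ ⊆F))
      where
      ∷⊆inside : ∀ {t} {p q : Subset n} → p ⊆ q → t ∷ p ⊆ inside ∷ q
      ∷⊆inside p⊆q here       = here
      ∷⊆inside p⊆q (there x∈) = there (p⊆q x∈)

  -- The generating function is x^|R| / (1 - x)^|F|: coordinates in R are positive, those in F
  -- outside R are free, and the others are 0.
  interval-latticePoints : ∀ n (R F : Subset n) → R ⊆ F → ∀ M →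
    sumℤ (weight R F) (latticePoints n M) ≡ ℤ.+ delay ∣ R ∣ (latticeCount ∣ F ∣) M
  interval-latticePoints zero    []            []            _   zero    = refl
  interval-latticePoints zero    []            []            _   (suc M) = refl
  interval-latticePoints (suc n) (inside ∷ R)  (outside ∷ F) R⊆F M with R⊆F here
  ... | ()
  interval-latticePoints (suc n) (outside ∷ R) (outside ∷ F) R⊆F zero =
    trans (sumℤ-latticePoints-zero (weight (outside ∷ R) (outside ∷ F)))
    (trans (sumℤ-cong (weight-0∷ R F outside) (latticePoints n 0))
      (interval-latticePoints n R F (drop-∷-⊆ R⊆F) 0))
  interval-latticePoints (suc n) (outside ∷ R) (outside ∷ F) R⊆F (suc M) =
    trans (sumℤ-latticePoints-suc (weight (outside ∷ R) (outside ∷ F)) M)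
    (trans (cong₂ ℤ._+_
      (trans (sumℤ-cong (weight-0∷ R F outside) (latticePoints n (suc M)))
             (interval-latticePoints n R F (drop-∷-⊆ R⊆F) (suc M)))
      (sumℤ-zero (weight-outside-incHead R F) (latticePoints (suc n) M)))
      (ℤₚ.+-identityʳ _))
  interval-latticePoints (suc n) (outside ∷ R) (inside ∷ F) R⊆F zero =
    trans (sumℤ-latticePoints-zero (weight (outside ∷ R) (inside ∷ F)))
    (trans (sumℤ-cong (weight-0∷ R F inside) (latticePoints n 0))
    (trans (interval-latticePoints n R F (drop-∷-⊆ R⊆F) 0)
      (cong ℤ.+_ (sym (trans (delay-latticeCount ∣ F ∣ ∣ R ∣ 0) (ℕₚ.+-identityʳ _))))))
  interval-latticePoints (suc n) (outside ∷ R) (inside ∷ F) R⊆F (suc M) =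
    trans (sumℤ-latticePoints-suc (weight (outside ∷ R) (inside ∷ F)) M)
    (trans (cong₂ ℤ._+_
      (trans (sumℤ-cong (weight-0∷ R F inside) (latticePoints n (suc M)))
             (interval-latticePoints n R F (drop-∷-⊆ R⊆F) (suc M)))
      (trans (sumℤ-cong (weight-inside-incHead R F outside) (latticePoints (suc n) M))
             (interval-latticePoints (suc n) (outside ∷ R) (inside ∷ F) R⊆F M)))
    (trans (sym (ℤₚ.pos-+ (delay ∣ R ∣ (latticeCount ∣ F ∣) (suc M)) _))
      (cong ℤ.+_ (sym (delay-latticeCount ∣ F ∣ ∣ R ∣ (suc M))))))
  interval-latticePoints (suc n) (inside ∷ R) (inside ∷ F) R⊆F zero =
    trans (sumℤ-latticePoints-zero (weight (inside ∷ R) (inside ∷ F))) (sumℤ-zero (weight-inside-0∷ R F) (latticePoints n 0))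
  interval-latticePoints (suc n) (inside ∷ R) (inside ∷ F) R⊆F (suc M) =
    trans (sumℤ-latticePoints-suc (weight (inside ∷ R) (inside ∷ F)) M)
    (trans (cong₂ ℤ._+_
      (sumℤ-zero (weight-inside-0∷ R F) (latticePoints n (suc M)))
      (trans (sumℤ-cong (weight-inside-incHead R F inside) (latticePoints (suc n) M))
             (interval-latticePoints (suc n) (outside ∷ R) (inside ∷ F) (out⊆ (drop-∷-⊆ R⊆F)) M)))
    (ℤₚ.+-identityˡ _))

-- Assembling the lattice point count and the lower bounds for a shellable complex.

module Conclusion where

  open GaussianRationals
  open Estimates
  open Interlacing
  open Nonvanishing
  open HilbertSeries
  open FaceCounting
  open EdgewiseSubdivision
  open Shellings
  open Intervals
  open import Data.Fin.Subset using (Subset; ⊥; ∣_∣; _⊆_)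
  open import Data.Fin.Subset.Properties
  open import Data.Integer as ℤ using (ℤ)
  open import Data.List using (List; []; _∷_; _∷ʳ_; map; upTo)
  open import Data.List.Membership.Propositional using (find; lose) renaming (_∈_ to _∈ₗ_)
  open import Data.List.Relation.Unary.All as All using (All; []; _∷_)
  import Data.List.Relation.Unary.All.Properties as Allₚ
  open import Data.List.Relation.Unary.Any using (here; there)
  open import Data.Nat as ℕ using (ℕ; zero; suc; _≤_; _<_)
  import Data.Nat.Properties as ℕₚ
  open import Data.Product using (_×_; _,_; proj₁; proj₂; ∃-syntax)
  open import Data.Rational as ℚ using (0ℚ; 1ℚ)
  import Data.Rational.Properties as ℚₚ
  import Data.Rational.Solver as ℚSolver
  open import Function.Bundles using (Equivalence)
  open import Relation.Binary.PropositionalEquality hiding ([_])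
  open import Relation.Nullary using (¬?)
  open import Relation.Nullary.Decidable using (_×-dec_)

  module _ (zs : ℕ → 𝔾) (im-below : BoundedBelow (λ n → proj₂ (zs n))) where
    open ℚSolver.+-*-Solver

    -- The imaginary part alone gives |1 - z|² ≥ (Im z)².
    1-X-apart : Apart (λ n → eval𝔾 1-X (zs n))
    1-X-apart = apart-cong {λ n → 1𝔾 ⊞ ⊟ zs n} (λ n → sym (eval𝔾-1-X (zs n))) (mkApart
      (boundedBelow-mono (λ n → subst (ℚ._≤ normSq (1𝔾 ⊞ ⊟ zs n))
          (solve 1 (λ y → (con 0ℚ :+ :- y) :* (con 0ℚ :+ :- y) := y :* y) refl (proj₂ (zs n)))
          (q≤p+q (0≤p² (1ℚ ℚ.+ ℚ.- proj₁ (zs n)))))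
        (boundedBelow-* im-below im-below)))

    1-X^-apart : ∀ k → Apart (λ n → eval𝔾 (1-X ^^ k) (zs n))
    1-X^-apart zero    =
      apart-cong {λ _ → 1𝔾} (λ n → sym (eval𝔾-1 (zs n))) (mkApart (mkBoundedBelow 1ℚ 0≤1 λ n → ℚₚ.≤-refl))
    1-X^-apart (suc k) =
      apart-cong {λ n → eval𝔾 1-X (zs n) ⊠ eval𝔾 (1-X ^^ k) (zs n)} (λ n → sym (eval𝔾-⊗ (zs n) 1-X (1-X ^^ k)))
        (apart-⊠ 1-X-apart (1-X^-apart k))

  module _ {n d : ℕ} (C : SimplicialComplex n) (pure : Pure d (IsFace C)) {Fs} (shelling : IsShelling d (IsFace C) Fs) where

    shellingIntervals : List (Subset n × Subset n)
    shellingIntervals = intervals [] Fs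

    facet∈ : ∀ {F} → Facet (IsFace C) F → F ∈ₗ Fs
    facet∈ {F} = Equivalence.from (proj₂ (shelling-facetOrdering d shelling) F)

    ∈facet : ∀ {F} → F ∈ₗ Fs → Facet (IsFace C) F
    ∈facet {F} = Equivalence.to (proj₂ (shelling-facetOrdering d shelling) F)

    isFace-intervals : ∀ S → indicator (isFace? C S) ≡ sumℤ (λ I → indicator (between? S I)) shellingIntervals
    isFace-intervals S = sym (trans
      (intervals-partition [] Fs (ridgeCovers [] Fs (shelling-ridgeCover d pure shelling)) S)
      (indicator-⇔ (¬? (span? [] S) ×-dec span? Fs S) (isFace? C S)
        (λ (_ , S∈) → let F , F∈ , S⊆F = find S∈ in ⊆-closed C S⊆F (proj₁ (∈facet F∈)))
        (λ S∈C → let F , F-facet , S⊆F = face⊆facet C S S∈C in (λ ()) , lose (facet∈ F-facet) S⊆F)))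

    intervals-wellFormed : All (λ I → proj₁ I ⊆ proj₂ I × ∣ proj₂ I ∣ ≡ suc d) shellingIntervals
    intervals-wellFormed = go [] Fs (λ F∈ → F∈)
      where
      go : ∀ pre Gs → (∀ {F} → F ∈ₗ Gs → F ∈ₗ Fs) →
           All (λ I → proj₁ I ⊆ proj₂ I × ∣ proj₂ I ∣ ≡ suc d) (intervals pre Gs)
      go pre []       _  = []
      go pre (F ∷ Gs) ⊆Fs =
        ((λ {x} → restriction⊆ pre F {x}) , pure F (∈facet (⊆Fs (here refl)))) ∷ go (pre ∷ʳ F) Gs (λ F∈ → ⊆Fs (there F∈))

    restrictionSizes : List ℕ
    restrictionSizes = map (λ I → ∣ proj₁ I ∣) shellingIntervals

    restrictionSizes-≤ : All (_≤ suc d) restrictionSizes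
    restrictionSizes-≤ = Allₚ.map⁺ (All.map
      (λ { {R , F} (R⊆F , ∣F∣≡) → ℕₚ.≤-trans (p⊆q⇒∣p∣≤∣q∣ R⊆F) (ℕₚ.≤-reflexive ∣F∣≡) }) intervals-wellFormed)

    -- Since ∅ is a face, there is a first facet, and no ridge of it is old. This supplies the index
    -- 0 that `sections-apart` requires.
    restrictionSizes-head : ∃[ js ] (restrictionSizes ≡ 0 ∷ js)
    restrictionSizes-head with face⊆facet C ⊥ (⊥-isFace C)
    ... | F , F-facet , _ = first Fs (facet∈ F-facet)
      where
      first : ∀ Gs → F ∈ₗ Gs → ∃[ js ] (map (λ I → ∣ proj₁ I ∣) (intervals [] Gs) ≡ 0 ∷ js)
      first (G ∷ Gs) _ = map (λ I → ∣ proj₁ I ∣) (intervals (G ∷ []) Gs) , cong (_∷ map (λ I → ∣ proj₁ I ∣) (intervals (G ∷ []) Gs)) (trans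
        (cong ∣_∣ (Empty-unique λ (v , v∈) → no-ridge (∈restriction⁻ [] G v∈))) (∣⊥∣≡0 n))
        where
        no-ridge : ∀ {v} → v Data.Fin.Subset.∈ G × Span [] (G Data.Fin.Subset.- v) → _
        no-ridge (_ , ())

  module _ (r-1 : ℕ) where
    open Sections r-1
    open HilbertSections r-1

    hPoly-sections : ∀ {m} (K : SimplicialComplex m) D is →
      (∀ N → sumℤ (λ k → ℤ.+ faceCount K k ℤ.* compositionsℤ k N) (upTo (suc (rank K))) ≡ sumℤ (λ i → hilbert D i N) is) →
      ∀ z → eval𝔾 (1-X ^^ D) z ⊠ eval𝔾 (hPoly K) z ≡ eval𝔾 (1-X ^^ rank K) z ⊠ Σ𝔾 (V z D) is
    hPoly-sections K D is eq z = trans (cong (λ p → eval𝔾 (1-X ^^ D) z ⊠ eval𝔾 p z) hPoly≡hForm)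
      (hForm-sections (faceCount K) (rank K) D is eq z)
      where
      hPoly≡hForm : hPoly K ≡ hForm (faceCount K) (rank K)
      hPoly≡hForm = refl

    -- The right side of `hPoly-sections` is a product of two factors bounded away from 0. On the
    -- left the power of 1 - x is bounded above, so it can be divided out.
    realRooted-hPoly : ∀ {m} (K : SimplicialComplex m) D is → All (_≤ r) is →
      (∀ N → sumℤ (λ k → ℤ.+ faceCount K k ℤ.* compositionsℤ k N) (upTo (suc (rank K)))
           ≡ sumℤ (λ i → hilbert D i N) (0 ∷ is)) →
      RealRooted (map fromℤ (hPoly K))
    realRooted-hPoly K D is is≤r eq = realRooted-if-apart (hPoly K) λ zs im-below bounded →
      apart-⊠⁻ {λ n → eval𝔾 (hPoly K) (zs n)} (bounded-eval𝔾 bounded (1-X ^^ D))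
        (apart-cong {λ n → eval𝔾 (1-X ^^ rank K) (zs n) ⊠ Σ𝔾 (V (zs n) D) (0 ∷ is)}
          (λ n → trans (sym (hPoly-sections K D (0 ∷ is) eq (zs n)))
                       (𝔾.*-comm (eval𝔾 (1-X ^^ D) (zs n)) (eval𝔾 (hPoly K) (zs n))))
          (apart-⊠ (1-X^-apart zs im-below (rank K)) (sections-apart zs im-below bounded D is is≤r)))

  module _ {n d r-1 : ℕ} (C : SimplicialComplex n) (pure : Pure d (IsFace C)) {Fs} (shelling : IsShelling d (IsFace C) Fs) where
    open Sections r-1
    open HilbertSections r-1

    -- Lattice points of degree N r supported in C are counted once as multisets of vertices of C⟨r⟩
    -- and once by the shelling interval that contains their support.
    faceCounts-hilbert : ∀ N →
      sumℤ (λ k → ℤ.+ faceCount (C ⟨ r ⟩) k ℤ.* compositionsℤ k N) (upTo (suc (rank (C ⟨ r ⟩))))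
      ≡ sumℤ (λ i → hilbert (suc d) i N) (restrictionSizes C pure shelling)
    faceCounts-hilbert N = begin
      sumℤ (λ k → ℤ.+ faceCount (C ⟨ r ⟩) k ℤ.* compositionsℤ k N) (upTo (suc (rank (C ⟨ r ⟩))))
        ≡⟨ faceCounts-latticePoints (C ⟨ r ⟩) N ⟩
      sumℤ (λ v → indicator (isFace? (C ⟨ r ⟩) (supp v))) (latticePoints (Index n r) N)
        ≡⟨ sumℤ-combine C r N ⟩
      sumℤ (λ y → indicator (isFace? C (supp y))) (latticePoints n (N ℕ.* r))
        ≡⟨ sumℤ-cong (λ y → isFace-intervals C pure shelling (supp y)) (latticePoints n (N ℕ.* r)) ⟩
      sumℤ (λ y → sumℤ (λ I → indicator (between? (supp y) I)) Is) (latticePoints n (N ℕ.* r))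
        ≡⟨ sumℤ-swap (λ y I → indicator (between? (supp y) I)) (latticePoints n (N ℕ.* r)) Is ⟩
      sumℤ (λ I → sumℤ (λ y → indicator (between? (supp y) I)) (latticePoints n (N ℕ.* r))) Is
        ≡⟨ sumℤ-cong-All (All.map (λ { {R , F} (R⊆F , ∣F∣≡) →
             trans (interval-latticePoints n R F R⊆F (N ℕ.* r))
                   (cong (λ D → ℤ.+ delay ∣ R ∣ (latticeCount D) (N ℕ.* r)) ∣F∣≡) })
             (intervals-wellFormed C pure shelling)) ⟩
      sumℤ (λ I → hilbert (suc d) ∣ proj₁ I ∣ N) Is
        ≡⟨ sumℤ-map (λ i → hilbert (suc d) i N) (λ I → ∣ proj₁ I ∣) Is ⟨
      sumℤ (λ i → hilbert (suc d) i N) (restrictionSizes C pure shelling) ∎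
      where
      open ≡-Reasoning
      Is = shellingIntervals C pure shelling

open import Data.List using (_∷_)
open import Data.List.Relation.Unary.All as All using (All)
open import Data.Nat using (suc; _≤_)
open import Data.Nat.Properties using (≤-trans)
open import Data.Product using (_,_; proj₁; proj₂)
open import Relation.Binary.PropositionalEquality using (_≡_; trans; cong; subst)
open HilbertSeries using (sumℤ; module HilbertSections)
open Conclusion

theorem4p17 : (n d r : ℕ) (C : SimplicialComplex n) →
    Shellable d C → d < r → RealRooted (map fromℤ (hPoly (C ⟨ r ⟩)))
theorem4p17 n d (suc r-1) C (pure , Fs , shelling) d<r =
  realRooted-hPoly r-1 (C ⟨ suc r-1 ⟩) (suc d) is is≤r
    (λ N → trans (faceCounts-hilbert {r-1 = r-1} C pure shelling N)
                 (cong (sumℤ (λ i → hilbert (suc d) i N)) sizes≡))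
  where
  open HilbertSections r-1
  is = proj₁ (restrictionSizes-head C pure shelling)
  sizes≡ : restrictionSizes C pure shelling ≡ 0 ∷ is
  sizes≡ = proj₂ (restrictionSizes-head C pure shelling)
  is≤r : All (_≤ suc r-1) is
  -- This is where d < r enters: restriction sizes are at most d + 1, hence at most r.
  is≤r = All.map (λ i≤ → ≤-trans i≤ d<r)
    (All.tail (subst (All (_≤ suc d)) sizes≡ (restrictionSizes-≤ C pure shelling)))
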